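{- Let $\Phi=(D,\varphi)$ be a $\mathbb{T}$-gain digraph on $n$ vertices in which every digon carries conjugate gains. Then $$\rho(\Phi)\ \ge\ \sqrt{\frac{2q}{n}},$$ where $q$ is the number of digons of $D$.
   Context: A digraph $D=(V,\mathcal{A})$ has a finite vertex set $V=\{v_1,\dots,v_n\}$ and a set $\mathcal{A}$ of ordered pairs of distinct vertices, called arcs (no loops; at most one arc from $v_i$ to $v_j$ for each ordered pair; opposite arcs may both be present). A digon is a directed cycle of length $2$, i.e. an unordered pair $\{v_i,v_j\}$ with both $(v_i,v_j)$ and $(v_j,v_i)$ in $\mathcal{A}$. Let $\mathbb{T}=\{z\in\mathbb{C}:|z|=1\}$. A $\mathbb{T}$-gain digraph is a pair $\Phi=(D,\varphi)$ with $\varphi:\mathcal{A}\to\mathbb{T}$ a function. A digon $\{v_i,v_j\}$ carries conjugate gains if $\varphi(v_j,v_i)=\overline{\varphi(v_i,v_j)}$. The gain adjacency matrix $A(\Phi)$ has entries $A(\Phi)_{ij}=\varphi(v_i,v_j)$ if $(v_i,v_j)\in\mathcal{A}$ and $0$ otherwise; $\rho(\Phi)$ is its spectral radius (maximum modulus of a complex eigenvalue). -}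

module Defs where

open import Data.Bool.Base using (Bool; true; false; T)
open import Data.Bool.Properties using (T?)
open import Data.Fin.Base as Fin using (Fin)
import Data.Fin.Properties as Fin
open import Data.Integer.Base as ℤ using (ℤ; +_; -[1+_])
import Data.Integer.Properties as ℤ
import Data.Integer.DivMod as ℤ
open import Data.List.Base using (List; length; filter; cartesianProduct; allFin)
open import Data.Nat.Base as ℕ using (ℕ; zero; suc)
import Data.Nat.Properties as ℕ
open import Data.Product.Base using (Σ; ∃-syntax; _×_; _,_; proj₁; proj₂)
open import Data.Rational.Base as ℚ using (ℚ; mkℚ; 0ℚ; 1ℚ; ½)
import Data.Rational.Properties as ℚ
import Data.Rational.Unnormalised.Base as ℚᵘ
import Data.Rational.Unnormalised.Properties as ℚᵘ
open import Data.Rational.Solver using (module +-*-Solver)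
open import Data.Sum.Base using (inj₁; inj₂)
open import Data.Unit.Base using (tt)
open import Data.Vec.Functional using (Vector; foldr)
open import Relation.Binary.PropositionalEquality
  using (_≡_; refl; sym; trans; cong; cong₂; subst; subst₂)
open import Relation.Nullary using (¬_; yes; no; Dec)
open import Relation.Nullary.Decidable using (_×-dec_)

------------------------------------------------------------------------
-- Rational preliminaries

open +-*-Solver using (solve; _:=_; _:+_; _:*_; _:-_; :-_; con)

module RationalLemmas where

  half-pos : ∀ {ε} → 0ℚ ℚ.< ε → 0ℚ ℚ.< ½ ℚ.* ε
  half-pos {ε} 0<ε = subst (ℚ._< ½ ℚ.* ε) (ℚ.*-zeroʳ ½) (ℚ.*-monoʳ-<-pos ½ 0<ε)

  halves : ∀ ε → ½ ℚ.* ε ℚ.+ ½ ℚ.* ε ≡ ε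
  halves ε = trans (sym (ℚ.*-distribʳ-+ ε ½ ½)) (ℚ.*-identityˡ ε)

  *-pos : ∀ {p q} → 0ℚ ℚ.< p → 0ℚ ℚ.< q → 0ℚ ℚ.< p ℚ.* q
  *-pos {p} {q} 0<p 0<q =
    subst (ℚ._< p ℚ.* q) (ℚ.*-zeroʳ p) (ℚ.*-monoʳ-<-pos p {{ℚ.positive 0<p}} 0<q)

  *-nonNeg : ∀ {p q} → 0ℚ ℚ.≤ p → 0ℚ ℚ.≤ q → 0ℚ ℚ.≤ p ℚ.* q
  *-nonNeg {p} {q} 0≤p 0≤q =
    subst (ℚ._≤ p ℚ.* q) (ℚ.*-zeroʳ p) (ℚ.*-monoˡ-≤-nonNeg p {{ℚ.nonNegative 0≤p}} 0≤q)

  sq-mono : ∀ {p q} → 0ℚ ℚ.≤ p → p ℚ.≤ q → p ℚ.* p ℚ.≤ q ℚ.* q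
  sq-mono {p} {q} 0≤p p≤q = ℚ.≤-trans
    (ℚ.*-monoˡ-≤-nonNeg p {{ℚ.nonNegative 0≤p}} p≤q)
    (ℚ.*-monoʳ-≤-nonNeg q {{ℚ.nonNegative (ℚ.≤-trans 0≤p p≤q)}} p≤q)

  ∣p-q∣≡∣q-p∣ : ∀ p q → ℚ.∣ p ℚ.- q ∣ ≡ ℚ.∣ q ℚ.- p ∣
  ∣p-q∣≡∣q-p∣ p q = trans
    (cong ℚ.∣_∣ (solve 2 (λ p q → p :- q := :- (q :- p)) refl p q))
    (ℚ.∣-p∣≡∣p∣ (q ℚ.- p))

  p≤∣p∣ : ∀ p → p ℚ.≤ ℚ.∣ p ∣
  p≤∣p∣ p with ℚ.≤-total 0ℚ p
  ... | inj₁ 0≤p = ℚ.≤-reflexive (sym (ℚ.0≤p⇒∣p∣≡p 0≤p))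
  ... | inj₂ p≤0 = ℚ.≤-trans p≤0 (ℚ.0≤∣p∣ p)

  fromℕ : ℕ → ℚ
  fromℕ n = + n ℚ./ 1

  toℚᵘ-fromℕ : ∀ n → ℚ.toℚᵘ (fromℕ n) ℚᵘ.≃ ℚᵘ.mkℚᵘ (+ n) 0
  toℚᵘ-fromℕ n = ℚ.toℚᵘ-fromℚᵘ (ℚᵘ.mkℚᵘ (+ n) 0)

  fromℕ-+ : ∀ m n → fromℕ m ℚ.+ fromℕ n ≡ fromℕ (m ℕ.+ n)
  fromℕ-+ m n = ℚ.toℚᵘ-injective (begin
    ℚ.toℚᵘ (fromℕ m ℚ.+ fromℕ n)                  ≈⟨ ℚ.toℚᵘ-homo-+ (fromℕ m) (fromℕ n) ⟩
    ℚ.toℚᵘ (fromℕ m) ℚᵘ.+ ℚ.toℚᵘ (fromℕ n)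
      ≈⟨ ℚᵘ.+-cong (toℚᵘ-fromℕ m) (toℚᵘ-fromℕ n) ⟩
    ℚᵘ.mkℚᵘ (+ m) 0 ℚᵘ.+ ℚᵘ.mkℚᵘ (+ n) 0
      ≈⟨ ℚᵘ.*≡* (cong₂ (λ a b → (a ℤ.+ b) ℤ.* + 1) (ℤ.*-identityʳ (+ m)) (ℤ.*-identityʳ (+ n))) ⟩
    ℚᵘ.mkℚᵘ (+ (m ℕ.+ n)) 0                       ≈⟨ toℚᵘ-fromℕ (m ℕ.+ n) ⟨
    ℚ.toℚᵘ (fromℕ (m ℕ.+ n))                      ∎)
    where open ℚᵘ.≃-Reasoning

  fromℕ-* : ∀ m n → fromℕ m ℚ.* fromℕ n ≡ fromℕ (m ℕ.* n)
  fromℕ-* m n = ℚ.toℚᵘ-injective (begin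
    ℚ.toℚᵘ (fromℕ m ℚ.* fromℕ n)                  ≈⟨ ℚ.toℚᵘ-homo-* (fromℕ m) (fromℕ n) ⟩
    ℚ.toℚᵘ (fromℕ m) ℚᵘ.* ℚ.toℚᵘ (fromℕ n)
      ≈⟨ ℚᵘ.*-cong (toℚᵘ-fromℕ m) (toℚᵘ-fromℕ n) ⟩
    ℚᵘ.mkℚᵘ (+ m) 0 ℚᵘ.* ℚᵘ.mkℚᵘ (+ n) 0
      ≈⟨ ℚᵘ.*≡* (cong (ℤ._* + 1) (sym (ℤ.pos-* m n))) ⟩
    ℚᵘ.mkℚᵘ (+ (m ℕ.* n)) 0                       ≈⟨ toℚᵘ-fromℕ (m ℕ.* n) ⟨
    ℚ.toℚᵘ (fromℕ (m ℕ.* n))                      ∎)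
    where open ℚᵘ.≃-Reasoning

  fromℕ-mono : ∀ {m n} → m ℕ.≤ n → fromℕ m ℚ.≤ fromℕ n
  fromℕ-mono {m} {n} m≤n = ℚ.toℚᵘ-cancel-≤ (begin
    ℚ.toℚᵘ (fromℕ m)  ≃⟨ toℚᵘ-fromℕ m ⟩
    ℚᵘ.mkℚᵘ (+ m) 0   ≤⟨ ℚᵘ.*≤* (ℤ.*-monoʳ-≤-nonNeg (+ 1) (ℤ.+≤+ m≤n)) ⟩
    ℚᵘ.mkℚᵘ (+ n) 0   ≃⟨ toℚᵘ-fromℕ n ⟨
    ℚ.toℚᵘ (fromℕ n)  ∎)
    where open ℚᵘ.≤-Reasoning

  0≤fromℕ : ∀ n → 0ℚ ℚ.≤ fromℕ n
  0≤fromℕ n = fromℕ-mono {0} {n} ℕ.z≤n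

  1/suc : ℕ → ℚ
  1/suc k = + 1 ℚ./ suc k

  1/suc*suc : ∀ k → 1/suc k ℚ.* fromℕ (suc k) ≡ 1ℚ
  1/suc*suc k = ℚ.toℚᵘ-injective (begin
    ℚ.toℚᵘ (1/suc k ℚ.* fromℕ (suc k))
      ≈⟨ ℚ.toℚᵘ-homo-* (1/suc k) (fromℕ (suc k)) ⟩
    ℚ.toℚᵘ (1/suc k) ℚᵘ.* ℚ.toℚᵘ (fromℕ (suc k))
      ≈⟨ ℚᵘ.*-cong (ℚ.toℚᵘ-fromℚᵘ (ℚᵘ.mkℚᵘ (+ 1) k)) (toℚᵘ-fromℕ (suc k)) ⟩
    ℚᵘ.mkℚᵘ (+ 1) k ℚᵘ.* ℚᵘ.mkℚᵘ (+ suc k) 0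
      ≈⟨ ℚᵘ.*≡* (trans (ℤ.*-identityʳ _) (cong (ℤ._*_ (+ 1)) (cong +_ (sym (ℕ.*-identityʳ (suc k)))))) ⟩
    ℚᵘ.1ℚᵘ ∎)
    where open ℚᵘ.≃-Reasoning

  0<fromℕ-suc : ∀ k → 0ℚ ℚ.< fromℕ (suc k)
  0<fromℕ-suc k = ℚ.<-≤-trans (ℚ.positive⁻¹ 1ℚ) (fromℕ-mono {1} {suc k} (ℕ.s≤s ℕ.z≤n))

  0<1/suc : ∀ k → 0ℚ ℚ.< 1/suc k
  0<1/suc k = ℚ.positive⁻¹ (1/suc k) {{ℚ.normalize-pos 1 (suc k)}}

  -- For p ≥ 0 (in general for ⌊p⌋ ≥ 0), ∣ ⌊ p ⌋ ∣ is the natural floor.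
  floorℕ : ℚ → ℕ
  floorℕ p = ℤ.∣ ℚ.floor p ∣

  0≤floor : ∀ {p} → 0ℚ ℚ.≤ p → + floorℕ p ≡ ℚ.floor p
  0≤floor {mkℚ (+ n) d _} _ = ℤ.0≤i⇒+∣i∣≡i (ℤ.0≤n⇒0≤n/d (+ n) (+ suc d) (ℤ.+≤+ ℕ.z≤n) (ℤ.+≤+ ℕ.z≤n))
  0≤floor {mkℚ -[1+ n ] d _} (ℚ.*≤* ())

  floor-≤ : ∀ {p} → 0ℚ ℚ.≤ p → fromℕ (floorℕ p) ℚ.≤ p
  floor-≤ {p@(mkℚ i d _)} 0≤p = ℚ.toℚᵘ-cancel-≤ (begin
    ℚ.toℚᵘ (fromℕ (floorℕ p))  ≃⟨ toℚᵘ-fromℕ (floorℕ p) ⟩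
    ℚᵘ.mkℚᵘ (+ floorℕ p) 0
      ≤⟨ ℚᵘ.*≤* (subst₂ ℤ._≤_ (cong (ℤ._* + suc d) (sym (0≤floor 0≤p))) (sym (ℤ.*-identityʳ i))
                   (ℤ.[n/d]*d≤n i (+ suc d))) ⟩
    ℚᵘ.mkℚᵘ i d                ∎)
    where open ℚᵘ.≤-Reasoning

  <-floor : ∀ {p} → 0ℚ ℚ.≤ p → p ℚ.< fromℕ (suc (floorℕ p))
  <-floor {p@(mkℚ i d _)} 0≤p = ℚ.toℚᵘ-cancel-< (begin-strict
    ℚᵘ.mkℚᵘ i d
      <⟨ ℚᵘ.*<* (subst₂ ℤ._<_ (sym (ℤ.*-identityʳ i))
                   (cong (ℤ._* + suc d) (cong ℤ.suc (sym (trans (0≤floor 0≤p) (ℤ.div-pos-is-/ℕ i (suc d))))))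
                   (ℤ.n<s[n/ℕd]*d i (suc d))) ⟩
    ℚᵘ.mkℚᵘ (+ suc (floorℕ p)) 0  ≃⟨ toℚᵘ-fromℕ (suc (floorℕ p)) ⟨
    ℚ.toℚᵘ (fromℕ (suc (floorℕ p))) ∎)
    where open ℚᵘ.≤-Reasoning

  -- The integer part of the square root.
  isqrt : ℕ → ℕ
  isqrt zero = zero
  isqrt (suc a) with suc (isqrt a) ℕ.* suc (isqrt a) ℕ.≤? suc a
  ... | yes _ = suc (isqrt a)
  ... | no  _ = isqrt a

  isqrt-spec : ∀ a → isqrt a ℕ.* isqrt a ℕ.≤ a × a ℕ.< suc (isqrt a) ℕ.* suc (isqrt a)
  isqrt-spec zero = ℕ.z≤n , ℕ.s≤s ℕ.z≤n
  isqrt-spec (suc a) with suc (isqrt a) ℕ.* suc (isqrt a) ℕ.≤? suc a | isqrt-spec a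
  ... | yes m²≤ | _ , a<m² =
    m²≤ , ℕ.≤-<-trans a<m² (ℕ.*-mono-< (ℕ.n<1+n (suc (isqrt a))) (ℕ.n<1+n (suc (isqrt a))))
  ... | no  m²≰ | m²≤a , _ = ℕ.m≤n⇒m≤1+n m²≤a , ℕ.≰⇒> m²≰

  -- max(p,0) · (k+1)²
  scaled : ℕ → ℚ → ℚ
  scaled k p = (p ℚ.⊔ 0ℚ) ℚ.* (fromℕ (suc k) ℚ.* fromℕ (suc k))

  0≤scaled : ∀ k p → 0ℚ ℚ.≤ scaled k p
  0≤scaled k p = *-nonNeg (ℚ.p≤q⊔p p 0ℚ) (*-nonNeg (0≤fromℕ (suc k)) (0≤fromℕ (suc k)))

  sqrtNum : ℕ → ℚ → ℕ
  sqrtNum k p = isqrt (floorℕ (scaled k p))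

  unscale : ∀ k q r → (q ℚ.* 1/suc k) ℚ.* (r ℚ.* 1/suc k) ℚ.* (fromℕ (suc k) ℚ.* fromℕ (suc k)) ≡ q ℚ.* r
  unscale k q r = trans
    (solve 4 (λ q r e d → (q :* e) :* (r :* e) :* (d :* d) := (q :* r) :* ((e :* d) :* (e :* d)))
       refl q r (1/suc k) (fromℕ (suc k)))
    (trans (cong (λ u → (q ℚ.* r) ℚ.* (u ℚ.* u)) (1/suc*suc k)) (ℚ.*-identityʳ (q ℚ.* r)))

  0<d² : ∀ k → 0ℚ ℚ.< fromℕ (suc k) ℚ.* fromℕ (suc k)
  0<d² k = *-pos (0<fromℕ-suc k) (0<fromℕ-suc k)

  -- The largest multiple of 1/(k+1) whose square is at most max(p,0).
  opaque
    sqrtApprox : ℕ → ℚ → ℚ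
    sqrtApprox k p = fromℕ (sqrtNum k p) ℚ.* 1/suc k

  opaque
    unfolding sqrtApprox

    0≤sqrtApprox : ∀ k p → 0ℚ ℚ.≤ sqrtApprox k p
    0≤sqrtApprox k p = *-nonNeg (0≤fromℕ (sqrtNum k p)) (ℚ.<⇒≤ (0<1/suc k))

    sqrtApprox²≤ : ∀ k p → sqrtApprox k p ℚ.* sqrtApprox k p ℚ.≤ p ℚ.⊔ 0ℚ
    sqrtApprox²≤ k p = ℚ.*-cancelʳ-≤-pos (d ℚ.* d) {{ℚ.positive (0<d² k)}} (begin
      sqrtApprox k p ℚ.* sqrtApprox k p ℚ.* (d ℚ.* d) ≡⟨ unscale k (fromℕ m) (fromℕ m) ⟩
      fromℕ m ℚ.* fromℕ m                            ≡⟨ fromℕ-* m m ⟩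
      fromℕ (m ℕ.* m)      ≤⟨ fromℕ-mono (proj₁ (isqrt-spec (floorℕ (scaled k p)))) ⟩
      fromℕ (floorℕ (scaled k p))                    ≤⟨ floor-≤ (0≤scaled k p) ⟩
      scaled k p                                     ∎)
      where
      open ℚ.≤-Reasoning
      d : ℚ
      d = fromℕ (suc k)
      m : ℕ
      m = sqrtNum k p

    <sqrtApprox² : ∀ k p → p ℚ.⊔ 0ℚ ℚ.< (sqrtApprox k p ℚ.+ 1/suc k) ℚ.* (sqrtApprox k p ℚ.+ 1/suc k)
    <sqrtApprox² k p = ℚ.*-cancelʳ-<-nonNeg (d ℚ.* d) {{ℚ.nonNegative (ℚ.<⇒≤ (0<d² k))}} (begin-strict
      scaled k p                                  <⟨ <-floor (0≤scaled k p) ⟩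
      fromℕ (suc (floorℕ (scaled k p)))
        ≤⟨ fromℕ-mono (proj₂ (isqrt-spec (floorℕ (scaled k p)))) ⟩
      fromℕ (suc m ℕ.* suc m)                     ≡⟨ fromℕ-* (suc m) (suc m) ⟨
      fromℕ (suc m) ℚ.* fromℕ (suc m)             ≡⟨ unscale k (fromℕ (suc m)) (fromℕ (suc m)) ⟨
      (fromℕ (suc m) ℚ.* e) ℚ.* (fromℕ (suc m) ℚ.* e) ℚ.* (d ℚ.* d)
        ≡⟨ cong (λ u → u ℚ.* u ℚ.* (d ℚ.* d)) (sym step) ⟩
      (sqrtApprox k p ℚ.+ e) ℚ.* (sqrtApprox k p ℚ.+ e) ℚ.* (d ℚ.* d) ∎)
      where
      open ℚ.≤-Reasoning
      d : ℚ
      d = fromℕ (suc k)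
      e : ℚ
      e = 1/suc k
      m : ℕ
      m = sqrtNum k p
      step : sqrtApprox k p ℚ.+ e ≡ fromℕ (suc m) ℚ.* e
      step = trans
        (solve 2 (λ m e → m :* e :+ e := (con 1ℚ :+ m) :* e) refl (fromℕ m) e)
        (cong (ℚ._* e) (fromℕ-+ 1 m))

  ⊔0-lipschitz : ∀ p q → p ℚ.⊔ 0ℚ ℚ.≤ (q ℚ.⊔ 0ℚ) ℚ.+ ℚ.∣ p ℚ.- q ∣
  ⊔0-lipschitz p q = ℚ.⊔-lub
    (begin
      p                              ≡⟨ solve 2 (λ p q → p := q :+ (p :- q)) refl p q ⟩
      q ℚ.+ (p ℚ.- q)                ≤⟨ ℚ.+-mono-≤ (ℚ.p≤p⊔q q 0ℚ) (p≤∣p∣ (p ℚ.- q)) ⟩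
      (q ℚ.⊔ 0ℚ) ℚ.+ ℚ.∣ p ℚ.- q ∣   ∎)
    (ℚ.≤-trans (ℚ.≤-reflexive (sym (ℚ.+-identityʳ 0ℚ)))
      (ℚ.+-mono-≤ (ℚ.p≤q⊔p q 0ℚ) (ℚ.0≤∣p∣ (p ℚ.- q))))
    where open ℚ.≤-Reasoning

  root-close : ∀ p q r s e {h} → 0ℚ ℚ.≤ s → 0ℚ ℚ.≤ e → 0ℚ ℚ.< h → e ℚ.≤ h →
               r ℚ.* r ℚ.≤ p ℚ.⊔ 0ℚ → q ℚ.⊔ 0ℚ ℚ.< (s ℚ.+ e) ℚ.* (s ℚ.+ e) →
               ℚ.∣ p ℚ.- q ∣ ℚ.< h ℚ.* h → r ℚ.- s ℚ.< h ℚ.+ h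
  root-close p q r s e {h} 0≤s 0≤e 0<h e≤h r²≤p q<t² p~q = ℚ.≰⇒> λ far →
    ℚ.<-irrefl refl (begin-strict
      p ℚ.⊔ 0ℚ                          ≤⟨ ⊔0-lipschitz p q ⟩
      (q ℚ.⊔ 0ℚ) ℚ.+ ℚ.∣ p ℚ.- q ∣      <⟨ ℚ.+-mono-< q<t² p~q ⟩
      t ℚ.* t ℚ.+ h ℚ.* h               ≡⟨ ℚ.+-identityʳ (t ℚ.* t ℚ.+ h ℚ.* h) ⟨
      t ℚ.* t ℚ.+ h ℚ.* h ℚ.+ 0ℚ
        ≤⟨ ℚ.+-monoʳ-≤ (t ℚ.* t ℚ.+ h ℚ.* h) (ℚ.+-mono-≤ (*-nonNeg 0≤t 0≤h) (*-nonNeg 0≤t 0≤h)) ⟩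
      t ℚ.* t ℚ.+ h ℚ.* h ℚ.+ (t ℚ.* h ℚ.+ t ℚ.* h)
        ≡⟨ solve 2 (λ t h → t :* t :+ h :* h :+ (t :* h :+ t :* h) := (t :+ h) :* (t :+ h)) refl t h ⟩
      (t ℚ.+ h) ℚ.* (t ℚ.+ h)           ≤⟨ sq-mono (ℚ.+-mono-≤ 0≤t 0≤h) (t+h≤r far) ⟩
      r ℚ.* r                           ≤⟨ r²≤p ⟩
      p ℚ.⊔ 0ℚ                          ∎)
    where
    open ℚ.≤-Reasoning
    t = s ℚ.+ e
    0≤h = ℚ.<⇒≤ 0<h
    0≤t : 0ℚ ℚ.≤ t
    0≤t = ℚ.+-mono-≤ 0≤s 0≤e
    t+h≤r : h ℚ.+ h ℚ.≤ r ℚ.- s → t ℚ.+ h ℚ.≤ r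
    t+h≤r far = begin
      s ℚ.+ e ℚ.+ h         ≤⟨ ℚ.+-monoˡ-≤ h (ℚ.+-monoʳ-≤ s e≤h) ⟩
      s ℚ.+ h ℚ.+ h         ≡⟨ ℚ.+-assoc s h h ⟩
      s ℚ.+ (h ℚ.+ h)       ≤⟨ ℚ.+-monoʳ-≤ s far ⟩
      s ℚ.+ (r ℚ.- s)       ≡⟨ solve 2 (λ r s → s :+ (r :- s) := r) refl r s ⟩
      r                     ∎

  sqrtApprox-close : ∀ j k p q {h} → 0ℚ ℚ.< h → 1/suc k ℚ.≤ h → ℚ.∣ p ℚ.- q ∣ ℚ.< h ℚ.* h →
                     sqrtApprox j p ℚ.- sqrtApprox k q ℚ.< h ℚ.+ h
  sqrtApprox-close j k p q 0<h e≤h = root-close p q (sqrtApprox j p) (sqrtApprox k q) (1/suc k)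
    (0≤sqrtApprox k q) (ℚ.<⇒≤ (0<1/suc k)) 0<h e≤h (sqrtApprox²≤ j p) (<sqrtApprox² k q)

  ∣p∣<q : ∀ {p q} → p ℚ.< q → ℚ.- p ℚ.< q → ℚ.∣ p ∣ ℚ.< q
  ∣p∣<q {p} {q} p<q -p<q with ℚ.∣p∣≡p∨∣p∣≡-p p
  ... | inj₁ eq = subst (ℚ._< q) (sym eq) p<q
  ... | inj₂ eq = subst (ℚ._< q) (sym eq) -p<q

  archimedean : ∀ {ε} → 0ℚ ℚ.< ε → ∃[ N ] (∀ n → N ℕ.≤ n → 1/suc n ℚ.≤ ε)
  archimedean {ε} 0<ε = N , λ n N≤n →
    ℚ.*-cancelʳ-≤-pos (fromℕ (suc n)) {{ℚ.positive (0<fromℕ-suc n)}} (begin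
      1/suc n ℚ.* fromℕ (suc n)   ≡⟨ 1/suc*suc n ⟩
      1ℚ                          ≡⟨ ℚ.*-inverseʳ ε ⟨
      ε ℚ.* (ℚ.1/ ε)              ≤⟨ ℚ.*-monoˡ-≤-nonNeg ε {{ε≥0}} (ℚ.<⇒≤ (<-floor 0≤1/ε)) ⟩
      ε ℚ.* fromℕ (suc N)         ≤⟨ ℚ.*-monoˡ-≤-nonNeg ε {{ε≥0}} (fromℕ-mono (ℕ.s≤s N≤n)) ⟩
      ε ℚ.* fromℕ (suc n)         ∎)
    where
    open ℚ.≤-Reasoning
    instance
      ε>0 : ℚ.Positive ε
      ε>0 = ℚ.positive 0<ε
      ε≢0 : ℚ.NonZero ε
      ε≢0 = ℚ.pos⇒nonZero ε
    ε≥0 : ℚ.NonNegative ε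
    ε≥0 = ℚ.pos⇒nonNeg ε
    0≤1/ε : 0ℚ ℚ.≤ ℚ.1/ ε
    0≤1/ε = ℚ.<⇒≤ (ℚ.positive⁻¹ (ℚ.1/ ε) {{ℚ.1/pos⇒pos ε}})
    N = floorℕ (ℚ.1/ ε)

open RationalLemmas

------------------------------------------------------------------------
-- Real numbers: Cauchy sequences of rationals, up to _≃ℝ_

IsCauchy : (ℕ → ℚ) → Set
IsCauchy x = ∀ ε → 0ℚ ℚ.< ε → ∃[ N ] (∀ m n → N ℕ.≤ m → N ℕ.≤ n → ℚ.∣ x m ℚ.- x n ∣ ℚ.< ε)

record ℝ : Set where
  constructor mkℝ
  field
    seq      : ℕ → ℚ
    isCauchy : IsCauchy seq
open ℝ public

infix 4 _≃ℝ_ _≤ℝ_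

_≃ℝ_ : ℝ → ℝ → Set
x ≃ℝ y = ∀ ε → 0ℚ ℚ.< ε → ∃[ N ] (∀ n → N ℕ.≤ n → ℚ.∣ seq x n ℚ.- seq y n ∣ ℚ.< ε)

-- The slack ε makes _≤ℝ_ respect _≃ℝ_ and makes it stable under double negation.
_≤ℝ_ : ℝ → ℝ → Set
x ≤ℝ y = ∀ ε → 0ℚ ℚ.< ε → ∃[ N ] (∀ n → N ℕ.≤ n → seq x n ℚ.≤ seq y n ℚ.+ ε)

module CauchyLemmas where

  opaque

    +-cauchy : ∀ x y → IsCauchy x → IsCauchy y → IsCauchy (λ n → x n ℚ.+ y n)
    +-cauchy x y cx cy ε 0<ε
      with cx (½ ℚ.* ε) (half-pos 0<ε) | cy (½ ℚ.* ε) (half-pos 0<ε)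
    ... | M , hx | N , hy = M ℕ.⊔ N , λ m n ≤m ≤n → begin-strict
      ℚ.∣ (x m ℚ.+ y m) ℚ.- (x n ℚ.+ y n) ∣
        ≡⟨ cong ℚ.∣_∣ (solve 4 (λ a b c d → (a :+ b) :- (c :+ d) := (a :- c) :+ (b :- d)) refl
                         (x m) (y m) (x n) (y n)) ⟩
      ℚ.∣ (x m ℚ.- x n) ℚ.+ (y m ℚ.- y n) ∣
        ≤⟨ ℚ.∣p+q∣≤∣p∣+∣q∣ (x m ℚ.- x n) (y m ℚ.- y n) ⟩
      ℚ.∣ x m ℚ.- x n ∣ ℚ.+ ℚ.∣ y m ℚ.- y n ∣
        <⟨ ℚ.+-mono-< (hx m n (ℕ.m⊔n≤o⇒m≤o M N ≤m) (ℕ.m⊔n≤o⇒m≤o M N ≤n))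
                      (hy m n (ℕ.m⊔n≤o⇒n≤o M N ≤m) (ℕ.m⊔n≤o⇒n≤o M N ≤n)) ⟩
      ½ ℚ.* ε ℚ.+ ½ ℚ.* ε               ≡⟨ halves ε ⟩
      ε                                 ∎
      where open ℚ.≤-Reasoning

    neg-cauchy : ∀ x → IsCauchy x → IsCauchy (λ n → ℚ.- x n)
    neg-cauchy x cx ε 0<ε with cx ε 0<ε
    ... | N , hx = N , λ m n ≤m ≤n → subst (ℚ._< ε)
      (trans (∣p-q∣≡∣q-p∣ (x m) (x n))
        (cong ℚ.∣_∣ (solve 2 (λ a b → b :- a := (:- a) :- (:- b)) refl (x m) (x n))))
      (hx m n ≤m ≤n)

    cauchy⇒bounded : ∀ {x} → IsCauchy x →
                     ∃[ B ] (0ℚ ℚ.< B × ∃[ N ] (∀ n → N ℕ.≤ n → ℚ.∣ x n ∣ ℚ.≤ B))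
    cauchy⇒bounded {x} cx with cx 1ℚ (ℚ.positive⁻¹ 1ℚ)
    ... | N , hx = 1ℚ ℚ.+ ℚ.∣ x N ∣ , ℚ.+-mono-<-≤ (ℚ.positive⁻¹ 1ℚ) (ℚ.0≤∣p∣ (x N)) , N , λ n ≤n → begin
      ℚ.∣ x n ∣
        ≡⟨ cong ℚ.∣_∣ (solve 2 (λ a b → a := (a :- b) :+ b) refl (x n) (x N)) ⟩
      ℚ.∣ (x n ℚ.- x N) ℚ.+ x N ∣             ≤⟨ ℚ.∣p+q∣≤∣p∣+∣q∣ (x n ℚ.- x N) (x N) ⟩
      ℚ.∣ x n ℚ.- x N ∣ ℚ.+ ℚ.∣ x N ∣
        ≤⟨ ℚ.+-monoˡ-≤ ℚ.∣ x N ∣ (ℚ.<⇒≤ (hx n N ≤n ℕ.≤-refl)) ⟩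
      1ℚ ℚ.+ ℚ.∣ x N ∣                        ∎
      where open ℚ.≤-Reasoning

    ∣∣*∣∣-< : ∀ {B} p q {δ} → 0ℚ ℚ.< B → ℚ.∣ p ∣ ℚ.≤ B → ℚ.∣ q ∣ ℚ.< δ →
             ℚ.∣ p ℚ.* q ∣ ℚ.< B ℚ.* δ
    ∣∣*∣∣-< {B} p q {δ} 0<B p≤B q<δ = begin-strict
      ℚ.∣ p ℚ.* q ∣           ≡⟨ ℚ.∣p*q∣≡∣p∣*∣q∣ p q ⟩
      ℚ.∣ p ∣ ℚ.* ℚ.∣ q ∣     ≤⟨ ℚ.*-monoʳ-≤-nonNeg ℚ.∣ q ∣ {{ℚ.∣-∣-nonNeg q}} p≤B ⟩
      B ℚ.* ℚ.∣ q ∣           <⟨ ℚ.*-monoʳ-<-pos B {{ℚ.positive 0<B}} q<δ ⟩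
      B ℚ.* δ                 ∎
      where open ℚ.≤-Reasoning

    divide : ∀ {B ε} → 0ℚ ℚ.< B → 0ℚ ℚ.< ε → ∃[ δ ] (0ℚ ℚ.< δ × B ℚ.* δ ≡ ε)
    divide {B} {ε} 0<B 0<ε =
      (ℚ.1/ B) ℚ.* ε ,
      *-pos (ℚ.positive⁻¹ (ℚ.1/ B) {{ℚ.1/pos⇒pos B}}) 0<ε ,
      trans (sym (ℚ.*-assoc B (ℚ.1/ B) ε))
        (trans (cong (ℚ._* ε) (ℚ.*-inverseʳ B)) (ℚ.*-identityˡ ε))
      where
      instance
        B>0 : ℚ.Positive B
        B>0 = ℚ.positive 0<B
        B≢0 : ℚ.NonZero B
        B≢0 = ℚ.pos⇒nonZero B

    ∣ab-cd∣< : ∀ a b c d {B C β γ} → 0ℚ ℚ.< B → 0ℚ ℚ.< C → ℚ.∣ a ∣ ℚ.≤ B → ℚ.∣ d ∣ ℚ.≤ C →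
               ℚ.∣ b ℚ.- d ∣ ℚ.< β → ℚ.∣ a ℚ.- c ∣ ℚ.< γ →
               ℚ.∣ a ℚ.* b ℚ.- c ℚ.* d ∣ ℚ.< B ℚ.* β ℚ.+ C ℚ.* γ
    ∣ab-cd∣< a b c d {B} {C} {β} {γ} 0<B 0<C a≤B d≤C b~d a~c = begin-strict
      ℚ.∣ a ℚ.* b ℚ.- c ℚ.* d ∣
        ≡⟨ cong ℚ.∣_∣ (solve 4 (λ a b c d → a :* b :- c :* d := a :* (b :- d) :+ d :* (a :- c)) refl a b c d) ⟩
      ℚ.∣ a ℚ.* (b ℚ.- d) ℚ.+ d ℚ.* (a ℚ.- c) ∣
        ≤⟨ ℚ.∣p+q∣≤∣p∣+∣q∣ (a ℚ.* (b ℚ.- d)) (d ℚ.* (a ℚ.- c)) ⟩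
      ℚ.∣ a ℚ.* (b ℚ.- d) ∣ ℚ.+ ℚ.∣ d ℚ.* (a ℚ.- c) ∣
        <⟨ ℚ.+-mono-< (∣∣*∣∣-< a (b ℚ.- d) 0<B a≤B b~d) (∣∣*∣∣-< d (a ℚ.- c) 0<C d≤C a~c) ⟩
      B ℚ.* β ℚ.+ C ℚ.* γ ∎
      where open ℚ.≤-Reasoning

    *-cauchy : ∀ x y → IsCauchy x → IsCauchy y → IsCauchy (λ n → x n ℚ.* y n)
    *-cauchy x y cx cy ε 0<ε =
      let (B , 0<B , N₁ , x≤B) = cauchy⇒bounded cx
          (C , 0<C , N₂ , y≤C) = cauchy⇒bounded cy
          (β , 0<β , Bβ≡)      = divide 0<B (half-pos 0<ε)
          (γ , 0<γ , Cγ≡)      = divide 0<C (half-pos 0<ε)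
          (N₃ , y~)            = cy β 0<β
          (N₄ , x~)            = cx γ 0<γ
          N₁₂ = N₁ ℕ.⊔ N₂
          N₃₄ = N₃ ℕ.⊔ N₄
          i₁₂ : ∀ {n} → N₁₂ ℕ.⊔ N₃₄ ℕ.≤ n → N₁₂ ℕ.≤ n
          i₁₂ = ℕ.m⊔n≤o⇒m≤o N₁₂ N₃₄
          i₃₄ : ∀ {n} → N₁₂ ℕ.⊔ N₃₄ ℕ.≤ n → N₃₄ ℕ.≤ n
          i₃₄ = ℕ.m⊔n≤o⇒n≤o N₁₂ N₃₄
      in N₁₂ ℕ.⊔ N₃₄ , λ m n ≤m ≤n →
        subst (ℚ.∣ x m ℚ.* y m ℚ.- x n ℚ.* y n ∣ ℚ.<_) (trans (cong₂ ℚ._+_ Bβ≡ Cγ≡) (halves ε))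
          (∣ab-cd∣< (x m) (y m) (x n) (y n) 0<B 0<C
            (x≤B m (ℕ.m⊔n≤o⇒m≤o N₁ N₂ (i₁₂ ≤m)))
            (y≤C n (ℕ.m⊔n≤o⇒n≤o N₁ N₂ (i₁₂ ≤n)))
            (y~ m n (ℕ.m⊔n≤o⇒m≤o N₃ N₄ (i₃₄ ≤m)) (ℕ.m⊔n≤o⇒m≤o N₃ N₄ (i₃₄ ≤n)))
            (x~ m n (ℕ.m⊔n≤o⇒n≤o N₃ N₄ (i₃₄ ≤m)) (ℕ.m⊔n≤o⇒n≤o N₃ N₄ (i₃₄ ≤n))))

    -- It suffices to bound the differences from above, by symmetry in m and n.
    one-sided⇒cauchy : ∀ (x : ℕ → ℚ) →
      (∀ h → 0ℚ ℚ.< h → ∃[ N ] (∀ m n → N ℕ.≤ m → N ℕ.≤ n → x m ℚ.- x n ℚ.< h ℚ.+ h)) →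
      IsCauchy x
    one-sided⇒cauchy x close ε 0<ε with close (½ ℚ.* ε) (half-pos 0<ε)
    ... | N , x~ = N , λ m n ≤m ≤n → ∣p∣<q
      (subst (x m ℚ.- x n ℚ.<_) (halves ε) (x~ m n ≤m ≤n))
      (subst₂ ℚ._<_ (solve 2 (λ r s → s :- r := :- (r :- s)) refl (x m) (x n)) (halves ε)
        (x~ n m ≤n ≤m))

    √-cauchy : ∀ x → IsCauchy x → IsCauchy (λ n → sqrtApprox n (x n))
    √-cauchy x cx = one-sided⇒cauchy (λ n → sqrtApprox n (x n)) λ h 0<h →
      let (M , 1/suc≤h) = archimedean 0<h
          (N , x~)      = cx (h ℚ.* h) (*-pos 0<h 0<h)
      in M ℕ.⊔ N , λ m n ≤m ≤n →
        sqrtApprox-close m n (x m) (x n) 0<h (1/suc≤h n (ℕ.m⊔n≤o⇒m≤o M N ≤n))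
          (x~ m n (ℕ.m⊔n≤o⇒n≤o M N ≤m) (ℕ.m⊔n≤o⇒n≤o M N ≤n))

    const-cauchy : ∀ p → IsCauchy (λ _ → p)
    const-cauchy p ε 0<ε = 0 , λ _ _ _ _ →
      subst (ℚ._< ε) (sym (cong ℚ.∣_∣ (ℚ.+-inverseʳ p))) 0<ε

open CauchyLemmas

fromℚ : ℚ → ℝ
fromℚ p = mkℝ (λ _ → p) (const-cauchy p)

0ℝ 1ℝ : ℝ
0ℝ = fromℚ 0ℚ
1ℝ = fromℚ 1ℚ

infixl 6 _+ℝ_ _-ℝ_
infixl 7 _*ℝ_
infix  8 -ℝ_

_+ℝ_ : ℝ → ℝ → ℝ
x +ℝ y = mkℝ (λ n → seq x n ℚ.+ seq y n) (+-cauchy (seq x) (seq y) (isCauchy x) (isCauchy y))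

-ℝ_ : ℝ → ℝ
-ℝ x = mkℝ (λ n → ℚ.- seq x n) (neg-cauchy (seq x) (isCauchy x))

_-ℝ_ : ℝ → ℝ → ℝ
x -ℝ y = x +ℝ (-ℝ y)

_*ℝ_ : ℝ → ℝ → ℝ
x *ℝ y = mkℝ (λ n → seq x n ℚ.* seq y n) (*-cauchy (seq x) (seq y) (isCauchy x) (isCauchy y))

-- √ x is the square root of max(x,0): its n-th term is within 1/(n+1) of the
-- square root of the n-th term of x, truncated below at 0.
√_ : ℝ → ℝ
√ x = mkℝ (λ n → sqrtApprox n (seq x n)) (√-cauchy (seq x) (isCauchy x))

------------------------------------------------------------------------
-- Complex numbers

record ℂ : Set where
  constructor _+i_
  field
    re im : ℝ
open ℂ public

infix 4 _≃ℂ_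

_≃ℂ_ : ℂ → ℂ → Set
z ≃ℂ w = (re z ≃ℝ re w) × (im z ≃ℝ im w)

0ℂ : ℂ
0ℂ = 0ℝ +i 0ℝ

infixl 6 _+ℂ_
infixl 7 _*ℂ_

_+ℂ_ : ℂ → ℂ → ℂ
z +ℂ w = (re z +ℝ re w) +i (im z +ℝ im w)

_*ℂ_ : ℂ → ℂ → ℂ
z *ℂ w = (re z *ℝ re w -ℝ im z *ℝ im w) +i (re z *ℝ im w +ℝ im z *ℝ re w)

conj : ℂ → ℂ
conj z = re z +i (-ℝ im z)

∣_∣ : ℂ → ℝ
∣ z ∣ = √ (re z *ℝ re z +ℝ im z *ℝ im z)

𝕋 : Set
𝕋 = Σ ℂ λ z → ∣ z ∣ ≃ℝ 1ℝ

------------------------------------------------------------------------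
-- Square complex matrices, eigenvalues and the spectral radius

Matrix : ℕ → Set
Matrix n = Fin n → Fin n → ℂ

∑ : ∀ {n} → Vector ℂ n → ℂ
∑ = foldr _+ℂ_ 0ℂ

infixr 7 _·_

_·_ : ∀ {n} → Matrix n → Vector ℂ n → Vector ℂ n
(M · v) i = ∑ λ j → M i j *ℂ v j

IsEigenvalue : ∀ {n} → Matrix n → ℂ → Set
IsEigenvalue {n} M μ =
  Σ (Vector ℂ n) λ v → ¬ (∀ i → v i ≃ℂ 0ℂ) × (∀ i → (M · v) i ≃ℂ μ *ℂ v i)

-- ρ is the maximum of the moduli of the eigenvalues of M.
record IsSpectralRadius {n : ℕ} (M : Matrix n) (ρ : ℝ) : Set where
  field
    attained   : ∃[ μ ] (IsEigenvalue M μ × ∣ μ ∣ ≃ℝ ρ)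
    upperBound : ∀ μ → IsEigenvalue M μ → ∣ μ ∣ ≤ℝ ρ

------------------------------------------------------------------------
-- Gain digraphs

-- The arc set is given by its characteristic function on ordered pairs.
record Digraph (n : ℕ) : Set where
  field
    arc    : Fin n → Fin n → Bool
    noLoop : ∀ i → ¬ T (arc i i)

  Arc : Fin n → Fin n → Set
  Arc i j = T (arc i j)

  IsDigon : Fin n → Fin n → Set
  IsDigon i j = Arc i j × Arc j i

  isDigon? : ∀ i j → Dec (IsDigon i j)
  isDigon? i j = T? (arc i j) ×-dec T? (arc j i)

  -- The unordered pair {vᵢ , vⱼ} is listed once, as (i , j) with i < j.
  digons : List (Fin n × Fin n)
  digons = filter (λ (i , j) → (i Fin.<? j) ×-dec isDigon? i j)
                  (cartesianProduct (allFin n) (allFin n))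

  numDigons : ℕ
  numDigons = length digons

record GainDigraph (n : ℕ) : Set where
  field
    digraph : Digraph n
  open Digraph digraph public
  field
    gain : ∀ i j → Arc i j → 𝕋

  gainℂ : ∀ i j → Arc i j → ℂ
  gainℂ i j a = proj₁ (gain i j a)

  HasConjugateDigons : Set
  HasConjugateDigons = ∀ i j (a : Arc i j) (b : Arc j i) → gainℂ j i b ≃ℂ conj (gainℂ i j a)

  adjacency : Matrix n
  adjacency i j = entry (arc i j) (gainℂ i j)
    where
    entry : (b : Bool) → (T b → ℂ) → ℂ
    entry true  g = g tt
    entry false _ = 0ℂ

{-# OPTIONS --safe #-}

-- Since opposite gains are conjugate, tr A² = 2q; on the other hand tr A² = Σ λᵢ², whose real part is
-- at most Σ |λᵢ|² ≤ n ρ². As _≤ℝ_ is stable under double negation, one may argue classically.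
--
-- To have eigenvalues one needs exact complex roots of polynomials. A monic p over ℚ(i) has
-- approximate roots in ℚ(i): if |p| ≥ ε on a fine grid in a large square, the trapezoid sums of
-- f(z) = zⁿ⁻¹/p(z) around the cells of the grid are tiny and add up to the one around the square,
-- where f(z) ≈ 1/z; but ∮ dz/z ≠ 0. Splitting off approximate roots, one finds an approximate root
-- near any point where |p| is small, and iterating this over better and better approximations of a
-- complex polynomial yields a Cauchy sequence.
--
-- An eigenvector of A comes from a root of a polynomial annihilating a Krylov sequence v, Av, A²v, …;
-- passing to the quotient by the eigenvector splits the square λ² off from tr A².

module Submission where

open import Algebra.Bundles using (CommutativeRing)
import Algebra.Properties.CommutativeMonoid.Sum as MonoidSum
import Algebra.Properties.Ring as RingProperties
import Algebra.Properties.Semiring.Sum as SemiringSum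
import Algebra.Solver.Ring.AlmostCommutativeRing as ACR
import Algebra.Solver.Ring.NaturalCoefficients.Default as NaturalCoefficients
import Algebra.Solver.Ring.Simple
open import Data.Bool.Base using (true; false)
open import Data.Bool.Properties using (T?)
open import Data.Fin.Base as Fin using (Fin; zero; suc; punchIn; punchOut)
import Data.Fin.Properties as Fin
open import Data.Integer.Base as ℤ using (+_)
import Data.Integer.Properties as ℤ
open import Data.List.Base using (length; filter; cartesianProduct; allFin; tabulate; map; _++_)
import Data.List.Properties as List
open import Data.Nat.Base as ℕ using (ℕ; zero; suc; NonZero)
import Data.Nat.Properties as ℕ
open import Data.Product.Base using (Σ; ∃-syntax; _×_; _,_; proj₁; proj₂)
open import Data.Rational.Base as ℚ using (ℚ; 0ℚ; 1ℚ; ½; _/_)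
import Data.Rational.Properties as ℚ
open import Data.Rational.Solver using (module +-*-Solver)
import Data.Rational.Unnormalised.Base as ℚᵘ
import Data.Rational.Unnormalised.Properties as ℚᵘ
open import Data.Sum.Base using (_⊎_; inj₁; inj₂)
open import Data.Vec.Base as Vec using (Vec; []; _∷_)
open import Data.Vec.Functional using (Vector; insertAt) renaming (_∷_ to _◂_)
open import Data.Vec.Functional.Properties using (insertAt-lookup; insertAt-punchIn)
open import Level using (0ℓ; _⊔_)
open import Relation.Binary.Definitions using (DecidableEquality; tri<; tri≈; tri>)
open import Relation.Binary.PropositionalEquality
  using (_≡_; refl; sym; trans; cong; cong₂; subst; subst₂; isEquivalence; module ≡-Reasoning)
open import Relation.Nullary using (¬_; yes; no; Dec)
open import Relation.Nullary.Decidable using (map′; _×-dec_; ¬¬-excluded-middle)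
open import Relation.Nullary.Negation using (contradiction; ¬¬-map)
open import Relation.Unary using (Decidable)
open import Defs
open RationalLemmas
open CauchyLemmas using (divide; cauchy⇒bounded)

-- Order and equality are decidable in ℚ(i) but not in ℂ, so every search and every choice that must
-- produce data happens in ℚ(i), and ℂ is reached only through limits. Double negation does not
-- commute with infinitely many choices; the Cauchy sequence defining a root is therefore
-- constructed outright, whereas the finitely many classical steps of linear algebra (finding a
-- pivot, testing a vector for zero) may stay under double negation.
--
-- Approximate roots found independently for each tolerance need not converge, as they could jump
-- between different roots. This is why a version with a quantitative distance to a given point is
-- needed.
--
-- The trapezoid sums are taken without their factor h/2. A cell then contributes O(h²), so all m²
-- cells together stay bounded, while the boundary contributes on the order of 1/h; a small h
-- separates the two.
--
-- No determinant or characteristic polynomial occurs: the eigenvalues are collected by repeated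
-- deflation, and tr M² is followed through each deflation by a direct computation.

module ℚS = +-*-Solver

-- Rational inequalities

-- Nonlinear inequalities are reduced to ring identities: exhibit the difference as a visibly
-- nonnegative expression and leave the rest to the solver.
≤-witness : ∀ {p q} d → 0ℚ ℚ.≤ d → q ≡ p ℚ.+ d → p ℚ.≤ q
≤-witness {p} {q} d 0≤d eq = begin
  p           ≡⟨ ℚ.+-identityʳ p ⟨
  p ℚ.+ 0ℚ    ≤⟨ ℚ.+-monoʳ-≤ p 0≤d ⟩
  p ℚ.+ d     ≡⟨ eq ⟨
  q           ∎
  where open ℚ.≤-Reasoning

<-witness : ∀ {p q} d → 0ℚ ℚ.< d → q ≡ p ℚ.+ d → p ℚ.< q
<-witness {p} {q} d 0<d eq = begin-strict
  p           ≡⟨ ℚ.+-identityʳ p ⟨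
  p ℚ.+ 0ℚ    <⟨ ℚ.+-monoʳ-< p 0<d ⟩
  p ℚ.+ d     ≡⟨ eq ⟨
  q           ∎
  where open ℚ.≤-Reasoning

0≤q-p : ∀ {p q} → p ℚ.≤ q → 0ℚ ℚ.≤ q ℚ.- p
0≤q-p {p} {q} p≤q = subst (ℚ._≤ q ℚ.- p) (ℚ.+-inverseʳ p) (ℚ.+-monoˡ-≤ (ℚ.- p) p≤q)

0<q-p : ∀ {p q} → p ℚ.< q → 0ℚ ℚ.< q ℚ.- p
0<q-p {p} {q} p<q = subst (ℚ._< q ℚ.- p) (ℚ.+-inverseʳ p) (ℚ.+-monoˡ-< (ℚ.- p) p<q)

0≤p+q : ∀ {p q} → 0ℚ ℚ.≤ p → 0ℚ ℚ.≤ q → 0ℚ ℚ.≤ p ℚ.+ q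
0≤p+q = ℚ.+-mono-≤ {0ℚ} {_} {0ℚ}

0≤p*p : ∀ p → 0ℚ ℚ.≤ p ℚ.* p
0≤p*p p with ℚ.≤-total 0ℚ p
... | inj₁ 0≤p = *-nonNeg 0≤p 0≤p
... | inj₂ p≤0 = subst (0ℚ ℚ.≤_) (ℚS.solve 1 (λ p → (ℚS.:- p) ℚS.:* (ℚS.:- p) ℚS.:= p ℚS.:* p) refl p)
                   (*-nonNeg 0≤-p 0≤-p)
  where
  0≤-p : 0ℚ ℚ.≤ ℚ.- p
  0≤-p = ℚ.neg-antimono-≤ p≤0

0≤1 : 0ℚ ℚ.≤ 1ℚ
0≤1 = 0≤fromℕ 1

*-mono-≤ : ∀ {p q r s} → 0ℚ ℚ.≤ p → p ℚ.≤ q → 0ℚ ℚ.≤ r → r ℚ.≤ s → p ℚ.* r ℚ.≤ q ℚ.* s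
*-mono-≤ {p} {q} {r} {s} 0≤p p≤q 0≤r r≤s = ℚ.≤-trans
  (ℚ.*-monoʳ-≤-nonNeg r {{ℚ.nonNegative 0≤r}} p≤q)
  (ℚ.*-monoˡ-≤-nonNeg q {{ℚ.nonNegative (ℚ.≤-trans 0≤p p≤q)}} r≤s)

∣p∣*∣p∣ : ∀ p → ℚ.∣ p ∣ ℚ.* ℚ.∣ p ∣ ≡ p ℚ.* p
∣p∣*∣p∣ p = trans (sym (ℚ.∣p*q∣≡∣p∣*∣q∣ p p)) (ℚ.0≤p⇒∣p∣≡p (0≤p*p p))

-- The field of Gaussian rationals

record ℚ[i] : Set where
  constructor gauss
  field
    real imag : ℚ
open ℚ[i] public

infixl 6 _+ᴳ_ _-ᴳ_
infixl 7 _*ᴳ_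
infix  8 -ᴳ_

_+ᴳ_ _*ᴳ_ : ℚ[i] → ℚ[i] → ℚ[i]
z +ᴳ w = gauss (real z ℚ.+ real w) (imag z ℚ.+ imag w)
z *ᴳ w = gauss (real z ℚ.* real w ℚ.- imag z ℚ.* imag w) (real z ℚ.* imag w ℚ.+ imag z ℚ.* real w)

-ᴳ_ : ℚ[i] → ℚ[i]
-ᴳ z = gauss (ℚ.- real z) (ℚ.- imag z)

_-ᴳ_ : ℚ[i] → ℚ[i] → ℚ[i]
z -ᴳ w = z +ᴳ (-ᴳ w)

fromReal : ℚ → ℚ[i]
fromReal p = gauss p 0ℚ

0ᴳ 1ᴳ iᴳ : ℚ[i]
0ᴳ = fromReal 0ℚ
1ᴳ = fromReal 1ℚ
iᴳ = gauss 0ℚ 1ℚ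

infix 4 _≟ᴳ_

_≟ᴳ_ : DecidableEquality ℚ[i]
z ≟ᴳ w = map′ (λ (p , q) → cong₂ gauss p q) (λ eq → cong real eq , cong imag eq)
  ((real z ℚ.≟ real w) ×-dec (imag z ℚ.≟ imag w))

+ᴳ-*ᴳ-commutativeRing : CommutativeRing 0ℓ 0ℓ
+ᴳ-*ᴳ-commutativeRing = record
  { Carrier = ℚ[i] ; _≈_ = _≡_ ; _+_ = _+ᴳ_ ; _*_ = _*ᴳ_ ; -_ = λ z → -ᴳ z ; 0# = 0ᴳ ; 1# = 1ᴳ
  ; isCommutativeRing = record
    { isRing = record
      { +-isAbelianGroup = record
        { isGroup = record
          { isMonoid = record
            { isSemigroup = record
              { isMagma = record { isEquivalence = isEquivalence ; ∙-cong = cong₂ _+ᴳ_ }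
              ; assoc = λ z w v → cong₂ gauss (ℚ.+-assoc (real z) _ _) (ℚ.+-assoc (imag z) _ _) }
            ; identity = (λ z → cong₂ gauss (ℚ.+-identityˡ _) (ℚ.+-identityˡ _))
                       , (λ z → cong₂ gauss (ℚ.+-identityʳ _) (ℚ.+-identityʳ _)) }
          ; inverse = (λ z → cong₂ gauss (ℚ.+-inverseˡ (real z)) (ℚ.+-inverseˡ (imag z)))
                    , (λ z → cong₂ gauss (ℚ.+-inverseʳ (real z)) (ℚ.+-inverseʳ (imag z)))
          ; ⁻¹-cong = cong (λ z → -ᴳ z) }
        ; comm = λ z w → cong₂ gauss (ℚ.+-comm (real z) _) (ℚ.+-comm (imag z) _) }
      ; *-cong = cong₂ _*ᴳ_
      ; *-assoc = λ z w v → cong₂ gauss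
          (solve 6 (λ a b c d e f → (a :* c :- b :* d) :* e :- (a :* d :+ b :* c) :* f
                                 := a :* (c :* e :- d :* f) :- b :* (c :* f :+ d :* e)) refl
             (real z) (imag z) (real w) (imag w) (real v) (imag v))
          (solve 6 (λ a b c d e f → (a :* c :- b :* d) :* f :+ (a :* d :+ b :* c) :* e
                                 := a :* (c :* f :+ d :* e) :+ b :* (c :* e :- d :* f)) refl
             (real z) (imag z) (real w) (imag w) (real v) (imag v))
      ; *-identity = *-identityˡ , λ z → trans (*-comm z 1ᴳ) (*-identityˡ z)
      ; distrib = distribˡ , λ z w v →
          trans (*-comm (w +ᴳ v) z) (trans (distribˡ z w v) (cong₂ _+ᴳ_ (*-comm z w) (*-comm z v))) }
    ; *-comm = *-comm } }
  where
  open ℚS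
  *-comm : ∀ z w → z *ᴳ w ≡ w *ᴳ z
  *-comm z w = cong₂ gauss
    (solve 4 (λ a b c d → a :* c :- b :* d := c :* a :- d :* b) refl (real z) (imag z) (real w) (imag w))
    (solve 4 (λ a b c d → a :* d :+ b :* c := c :* b :+ d :* a) refl (real z) (imag z) (real w) (imag w))
  *-identityˡ : ∀ z → 1ᴳ *ᴳ z ≡ z
  *-identityˡ z = cong₂ gauss
    (solve 2 (λ a b → con 1ℚ :* a :- con 0ℚ :* b := a) refl (real z) (imag z))
    (solve 2 (λ a b → con 1ℚ :* b :+ con 0ℚ :* a := b) refl (real z) (imag z))
  distribˡ : ∀ z w v → z *ᴳ (w +ᴳ v) ≡ z *ᴳ w +ᴳ z *ᴳ v
  distribˡ z w v = cong₂ gauss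
    (solve 6 (λ a b c d e f → a :* (c :+ e) :- b :* (d :+ f) := (a :* c :- b :* d) :+ (a :* e :- b :* f)) refl
       (real z) (imag z) (real w) (imag w) (real v) (imag v))
    (solve 6 (λ a b c d e f → a :* (d :+ f) :+ b :* (c :+ e) := (a :* d :+ b :* c) :+ (a :* f :+ b :* e)) refl
       (real z) (imag z) (real w) (imag w) (real v) (imag v))

module ᴳ = CommutativeRing +ᴳ-*ᴳ-commutativeRing
module ᴳS = Algebra.Solver.Ring.Simple (ACR.fromCommutativeRing +ᴳ-*ᴳ-commutativeRing) _≟ᴳ_

-- The norm |x| + |y| is rational valued and submultiplicative.
‖_‖ : ℚ[i] → ℚ
‖ z ‖ = ℚ.∣ real z ∣ ℚ.+ ℚ.∣ imag z ∣

0≤‖_‖ : ∀ z → 0ℚ ℚ.≤ ‖ z ‖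
0≤‖ z ‖ = 0≤p+q (ℚ.0≤∣p∣ (real z)) (ℚ.0≤∣p∣ (imag z))

‖-z‖ : ∀ z → ‖ -ᴳ z ‖ ≡ ‖ z ‖
‖-z‖ z = cong₂ ℚ._+_ (ℚ.∣-p∣≡∣p∣ (real z)) (ℚ.∣-p∣≡∣p∣ (imag z))

‖z+w‖≤ : ∀ z w → ‖ z +ᴳ w ‖ ℚ.≤ ‖ z ‖ ℚ.+ ‖ w ‖
‖z+w‖≤ z w = begin
  ‖ z +ᴳ w ‖
    ≤⟨ ℚ.+-mono-≤ (ℚ.∣p+q∣≤∣p∣+∣q∣ (real z) (real w)) (ℚ.∣p+q∣≤∣p∣+∣q∣ (imag z) (imag w)) ⟩
  (ℚ.∣ real z ∣ ℚ.+ ℚ.∣ real w ∣) ℚ.+ (ℚ.∣ imag z ∣ ℚ.+ ℚ.∣ imag w ∣)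
    ≡⟨ ℚS.solve 4 (λ a b c d → (a ℚS.:+ b) ℚS.:+ (c ℚS.:+ d) ℚS.:= (a ℚS.:+ c) ℚS.:+ (b ℚS.:+ d)) refl
         (ℚ.∣ real z ∣) (ℚ.∣ real w ∣) (ℚ.∣ imag z ∣) (ℚ.∣ imag w ∣) ⟩
  ‖ z ‖ ℚ.+ ‖ w ‖ ∎
  where open ℚ.≤-Reasoning

‖z*w‖≤ : ∀ z w → ‖ z *ᴳ w ‖ ℚ.≤ ‖ z ‖ ℚ.* ‖ w ‖
‖z*w‖≤ (gauss a b) (gauss c d) = begin
  ‖ gauss a b *ᴳ gauss c d ‖
    ≤⟨ ℚ.+-mono-≤ (ℚ.∣p-q∣≤∣p∣+∣q∣ (a ℚ.* c) (b ℚ.* d)) (ℚ.∣p+q∣≤∣p∣+∣q∣ (a ℚ.* d) (b ℚ.* c)) ⟩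
  (ℚ.∣ a ℚ.* c ∣ ℚ.+ ℚ.∣ b ℚ.* d ∣) ℚ.+ (ℚ.∣ a ℚ.* d ∣ ℚ.+ ℚ.∣ b ℚ.* c ∣)
    ≡⟨ cong₂ ℚ._+_ (cong₂ ℚ._+_ (ℚ.∣p*q∣≡∣p∣*∣q∣ a c) (ℚ.∣p*q∣≡∣p∣*∣q∣ b d))
                   (cong₂ ℚ._+_ (ℚ.∣p*q∣≡∣p∣*∣q∣ a d) (ℚ.∣p*q∣≡∣p∣*∣q∣ b c)) ⟩
  (ℚ.∣ a ∣ ℚ.* ℚ.∣ c ∣ ℚ.+ ℚ.∣ b ∣ ℚ.* ℚ.∣ d ∣) ℚ.+ (ℚ.∣ a ∣ ℚ.* ℚ.∣ d ∣ ℚ.+ ℚ.∣ b ∣ ℚ.* ℚ.∣ c ∣)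
    ≡⟨ ℚS.solve 4 (λ a b c d → (a ℚS.:* c ℚS.:+ b ℚS.:* d) ℚS.:+ (a ℚS.:* d ℚS.:+ b ℚS.:* c)
                        ℚS.:= (a ℚS.:+ b) ℚS.:* (c ℚS.:+ d)) refl
         ℚ.∣ a ∣ ℚ.∣ b ∣ ℚ.∣ c ∣ ℚ.∣ d ∣ ⟩
  (ℚ.∣ a ∣ ℚ.+ ℚ.∣ b ∣) ℚ.* (ℚ.∣ c ∣ ℚ.+ ℚ.∣ d ∣) ∎
  where open ℚ.≤-Reasoning

∣re∣≤‖_‖ : ∀ z → ℚ.∣ real z ∣ ℚ.≤ ‖ z ‖
∣re∣≤‖ z ‖ = ≤-witness ℚ.∣ imag z ∣ (ℚ.0≤∣p∣ (imag z)) refl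

∣im∣≤‖_‖ : ∀ z → ℚ.∣ imag z ∣ ℚ.≤ ‖ z ‖
∣im∣≤‖ z ‖ = ≤-witness ℚ.∣ real z ∣ (ℚ.0≤∣p∣ (real z)) (ℚ.+-comm ℚ.∣ real z ∣ ℚ.∣ imag z ∣)

-- Monic polynomials

-- The vector (c₀ , … , cₙ₋₁) stands for the monic polynomial c₀ + … + cₙ₋₁ Xⁿ⁻¹ + Xⁿ.
module Monic {c ℓ} (R : CommutativeRing c ℓ) where
  open CommutativeRing R hiding (sym; trans) renaming (Carrier to A; refl to ≈-refl)
  open import Relation.Binary.Reasoning.Setoid setoid
  private module S = NaturalCoefficients commutativeSemiring

  eval : ∀ {n} → Vec A n → A → A
  eval []       z = 1#
  eval (c ∷ cs) z = c + z * eval cs z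

  -- Horner's scheme: the coefficients of the quotient by X - a are the values at a of the truncations.
  quotient : ∀ {n} → A → Vec A (suc n) → Vec A n
  quotient a (c ∷ [])          = []
  quotient a (c ∷ cs@(_ ∷ _)) = eval cs a ∷ quotient a cs

  -- The value c₀ x₀ + … + cₙ₋₁ xₙ₋₁ + xₙ of the linear functional Xⁱ ↦ xᵢ.
  combine : ∀ {n} → Vec A n → (ℕ → A) → A
  combine []       x = x 0
  combine (c ∷ cs) x = c * x 0 + combine cs (λ i → x (suc i))

  -- This is P(z) - P(a) = (z - a) Q(z), with the negative terms moved across so that it is an
  -- identity of commutative semirings.
  eval-quotient : ∀ {n} a (cs : Vec A (suc n)) z →
    eval cs z + a * eval (quotient a cs) z ≈ eval cs a + z * eval (quotient a cs) z
  eval-quotient a (c ∷ []) z =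
    S.solve 3 (λ a c z → (c :+ z :* con 1) :+ a :* con 1 := (c :+ a :* con 1) :+ z :* con 1) ≈-refl a c z
    where open S
  eval-quotient a (c ∷ cs@(_ ∷ _)) z = begin
    (c + z * P z) + a * (P a + z * Q)
      ≈⟨ solve 6 (λ a c z p pa q → (c :+ z :* p) :+ a :* (pa :+ z :* q) := c :+ a :* pa :+ z :* (p :+ a :* q)) ≈-refl
           a c z (P z) (P a) Q ⟩
    c + a * P a + z * (P z + a * Q)
      ≈⟨ +-congˡ (*-congˡ (eval-quotient a cs z)) ⟩
    c + a * P a + z * (P a + z * Q) ∎
    where
    open S
    P : A → A
    P = eval cs
    Q : A
    Q = eval (quotient a cs) z

  -- The polynomial identity P = P(a) + (X - a) Q, read through the functional Xⁱ ↦ xᵢ;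
  -- multiplication by X becomes the shift of `x`.
  combine-quotient : ∀ {n} a (cs : Vec A (suc n)) x →
    combine cs x + a * combine (quotient a cs) x ≈
    eval cs a * x 0 + combine (quotient a cs) (λ i → x (suc i))
  combine-quotient a (c ∷ []) x =
    S.solve 4 (λ a c x y → (c :* x :+ y) :+ a :* x := (c :+ a :* con 1) :* x :+ y) ≈-refl a c (x 0) (x 1)
    where open S
  combine-quotient a (c ∷ cs@(_ ∷ _)) x = begin
    (c * x 0 + combine cs x⁺) + a * (P * x 0 + Q)
      ≈⟨ solve 6 (λ a c x p q s → (c :* x :+ s) :+ a :* (p :* x :+ q) := (c :+ a :* p) :* x :+ (s :+ a :* q)) ≈-refl
           a c (x 0) P Q (combine cs x⁺) ⟩
    (c + a * P) * x 0 + (combine cs x⁺ + a * Q)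
      ≈⟨ +-congˡ (combine-quotient a cs x⁺) ⟩
    (c + a * P) * x 0 + (P * x 1 + combine (quotient a cs) (λ i → x (suc (suc i)))) ∎
    where
    open S
    x⁺ : ℕ → A
    x⁺ i = x (suc i)
    P Q : A
    P = eval cs a
    Q = combine (quotient a cs) x⁺

open Monic +ᴳ-*ᴳ-commutativeRing using ()
  renaming (eval to evalᴳ; quotient to quotientᴳ; eval-quotient to evalᴳ-quotientᴳ)

-- Inverses of Gaussian rationals

-- The default value 0 at 0 makes `inv` a total function, so sequences and integrands can be written
-- down before their denominators are known to be nonzero.
recip : ℚ → ℚ
recip p with p ℚ.≟ 0ℚ
... | yes _  = 0ℚ
... | no p≢0 = ℚ.1/_ p {{ℚ.≢-nonZero p≢0}}

*-recip : ∀ {p} → 0ℚ ℚ.< p → p ℚ.* recip p ≡ 1ℚ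
*-recip {p} 0<p with p ℚ.≟ 0ℚ
... | yes p≡0 = contradiction 0<p (ℚ.<-irrefl (sym p≡0))
... | no p≢0  = ℚ.*-inverseʳ p {{ℚ.≢-nonZero p≢0}}

0<recip : ∀ {p} → 0ℚ ℚ.< p → 0ℚ ℚ.< recip p
0<recip {p} 0<p = ℚ.*-cancelˡ-<-nonNeg p {{ℚ.nonNegative (ℚ.<⇒≤ 0<p)}}
  (subst₂ ℚ._<_ (sym (ℚ.*-zeroʳ p)) (sym (*-recip 0<p)) (ℚ.positive⁻¹ 1ℚ))

normSq : ℚ[i] → ℚ
normSq z = real z ℚ.* real z ℚ.+ imag z ℚ.* imag z

0≤normSq : ∀ z → 0ℚ ℚ.≤ normSq z
0≤normSq z = 0≤p+q (0≤p*p (real z)) (0≤p*p (imag z))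

normSq-* : ∀ z w → normSq (z *ᴳ w) ≡ normSq z ℚ.* normSq w
normSq-* (gauss a b) (gauss c d) = solve 4
  (λ a b c d → (a :* c :- b :* d) :* (a :* c :- b :* d) :+ (a :* d :+ b :* c) :* (a :* d :+ b :* c)
            := (a :* a :+ b :* b) :* (c :* c :+ d :* d)) refl a b c d
  where open ℚS

2ℚ : ℚ
2ℚ = fromℕ 2

‖z‖²≤2normSq : ∀ z → ‖ z ‖ ℚ.* ‖ z ‖ ℚ.≤ 2ℚ ℚ.* normSq z
‖z‖²≤2normSq (gauss x y) = ≤-witness ((∣x∣ ℚ.- ∣y∣) ℚ.* (∣x∣ ℚ.- ∣y∣)) (0≤p*p (∣x∣ ℚ.- ∣y∣))
  (trans (cong (2ℚ ℚ.*_) (sym (cong₂ ℚ._+_ (∣p∣*∣p∣ x) (∣p∣*∣p∣ y))))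
    (solve 2 (λ x y → con 2ℚ :* (x :* x :+ y :* y) := (x :+ y) :* (x :+ y) :+ (x :- y) :* (x :- y)) refl ∣x∣ ∣y∣))
  where
  open ℚS
  ∣x∣ ∣y∣ : ℚ
  ∣x∣ = ℚ.∣ x ∣
  ∣y∣ = ℚ.∣ y ∣

normSq≤‖z‖² : ∀ z → normSq z ℚ.≤ ‖ z ‖ ℚ.* ‖ z ‖
normSq≤‖z‖² (gauss x y) = ≤-witness (2ℚ ℚ.* (∣x∣ ℚ.* ∣y∣)) (*-nonNeg (0≤fromℕ 2) (*-nonNeg (ℚ.0≤∣p∣ x) (ℚ.0≤∣p∣ y)))
  (trans (solve 2 (λ x y → (x :+ y) :* (x :+ y) := (x :* x :+ y :* y) :+ con 2ℚ :* (x :* y)) refl ∣x∣ ∣y∣)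
    (cong (ℚ._+ 2ℚ ℚ.* (∣x∣ ℚ.* ∣y∣)) (cong₂ ℚ._+_ (∣p∣*∣p∣ x) (∣p∣*∣p∣ y))))
  where
  open ℚS
  ∣x∣ ∣y∣ : ℚ
  ∣x∣ = ℚ.∣ x ∣
  ∣y∣ = ℚ.∣ y ∣

0<‖z‖⇒0<normSq : ∀ {z} → 0ℚ ℚ.< ‖ z ‖ → 0ℚ ℚ.< normSq z
0<‖z‖⇒0<normSq {z} 0<‖z‖ = ℚ.*-cancelˡ-<-nonNeg 2ℚ
  (ℚ.<-≤-trans (*-pos 0<‖z‖ 0<‖z‖) (‖z‖²≤2normSq z))

inv : ℚ[i] → ℚ[i]
inv z = gauss (real z ℚ.* recip (normSq z)) (ℚ.- (imag z ℚ.* recip (normSq z)))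

*-inv : ∀ {z} → 0ℚ ℚ.< ‖ z ‖ → z *ᴳ inv z ≡ 1ᴳ
*-inv {z@(gauss x y)} 0<‖z‖ = cong₂ gauss
  (trans (solve 3 (λ x y r → x :* (x :* r) :- y :* (:- (y :* r)) := (x :* x :+ y :* y) :* r) refl x y (recip (normSq z)))
    (*-recip (0<‖z‖⇒0<normSq {z} 0<‖z‖)))
  (solve 3 (λ x y r → x :* (:- (y :* r)) :+ y :* (x :* r) := con 0ℚ) refl x y (recip (normSq z)))
  where open ℚS

-- For the modulus the product would be 1. The factor 2 is the price of the norm |x| + |y|, whose
-- square can be twice `normSq`.
‖inv‖*‖z‖≤2 : ∀ {z} → 0ℚ ℚ.< ‖ z ‖ → ‖ inv z ‖ ℚ.* ‖ z ‖ ℚ.≤ 2ℚ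
‖inv‖*‖z‖≤2 {z@(gauss x y)} 0<‖z‖ = begin
  ‖ inv z ‖ ℚ.* ‖ z ‖
    ≡⟨ cong (ℚ._* ‖ z ‖) (cong₂ ℚ._+_ (∣ x r∣) (trans (ℚ.∣-p∣≡∣p∣ (y ℚ.* r)) (∣ y r∣))) ⟩
  (ℚ.∣ x ∣ ℚ.* r ℚ.+ ℚ.∣ y ∣ ℚ.* r) ℚ.* ‖ z ‖
    ≡⟨ solve 3 (λ x y r → (x :* r :+ y :* r) :* (x :+ y) := ((x :+ y) :* (x :+ y)) :* r) refl ℚ.∣ x ∣ ℚ.∣ y ∣ r ⟩
  (‖ z ‖ ℚ.* ‖ z ‖) ℚ.* r
    ≤⟨ ℚ.*-monoʳ-≤-nonNeg r {{ℚ.nonNegative 0≤r}} (‖z‖²≤2normSq z) ⟩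
  (2ℚ ℚ.* normSq z) ℚ.* r
    ≡⟨ trans (ℚ.*-assoc 2ℚ (normSq z) r) (cong (2ℚ ℚ.*_) (*-recip 0<N)) ⟩
  2ℚ ℚ.* 1ℚ  ≡⟨ ℚ.*-identityʳ 2ℚ ⟩
  2ℚ ∎
  where
  open ℚ.≤-Reasoning
  open ℚS
  r : ℚ
  r = recip (normSq z)
  0<N : 0ℚ ℚ.< normSq z
  0<N = 0<‖z‖⇒0<normSq {z} 0<‖z‖
  0≤r : 0ℚ ℚ.≤ r
  0≤r = ℚ.<⇒≤ (0<recip 0<N)
  ∣_r∣ : ∀ t → ℚ.∣ t ℚ.* r ∣ ≡ ℚ.∣ t ∣ ℚ.* r
  ∣ t r∣ = trans (ℚ.∣p*q∣≡∣p∣*∣q∣ t r) (cong (ℚ.∣ t ∣ ℚ.*_) (ℚ.0≤p⇒∣p∣≡p 0≤r))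

‖inv‖≤ : ∀ {z δ D} → 0ℚ ℚ.< δ → δ ℚ.≤ ‖ z ‖ → δ ℚ.* D ≡ 2ℚ → ‖ inv z ‖ ℚ.≤ D
‖inv‖≤ {z} {δ} {D} 0<δ δ≤‖z‖ δD≡2 = ℚ.*-cancelˡ-≤-pos δ {{ℚ.positive 0<δ}} (begin
  δ ℚ.* ‖ inv z ‖      ≤⟨ ℚ.*-monoʳ-≤-nonNeg ‖ inv z ‖ {{ℚ.nonNegative 0≤‖ inv z ‖}} δ≤‖z‖ ⟩
  ‖ z ‖ ℚ.* ‖ inv z ‖  ≡⟨ ℚ.*-comm ‖ z ‖ ‖ inv z ‖ ⟩
  ‖ inv z ‖ ℚ.* ‖ z ‖  ≤⟨ ‖inv‖*‖z‖≤2 {z} (ℚ.<-≤-trans 0<δ δ≤‖z‖) ⟩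
  2ℚ                   ≡⟨ δD≡2 ⟨
  δ ℚ.* D              ∎)
  where open ℚ.≤-Reasoning

‖+‖≤ : ∀ {z w p q} → ‖ z ‖ ℚ.≤ p → ‖ w ‖ ℚ.≤ q → ‖ z +ᴳ w ‖ ℚ.≤ p ℚ.+ q
‖+‖≤ {z} {w} z≤ w≤ = ℚ.≤-trans (‖z+w‖≤ z w) (ℚ.+-mono-≤ z≤ w≤)

‖-‖≤ : ∀ {z w p q} → ‖ z ‖ ℚ.≤ p → ‖ w ‖ ℚ.≤ q → ‖ z -ᴳ w ‖ ℚ.≤ p ℚ.+ q
‖-‖≤ {z} {w} z≤ w≤ = ‖+‖≤ {z} {(-ᴳ w)} z≤ (subst (ℚ._≤ _) (sym (‖-z‖ w)) w≤)

‖*‖≤ : ∀ {z w p q} → ‖ z ‖ ℚ.≤ p → ‖ w ‖ ℚ.≤ q → ‖ z *ᴳ w ‖ ℚ.≤ p ℚ.* q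
‖*‖≤ {z} {w} z≤ w≤ = ℚ.≤-trans (‖z*w‖≤ z w) (*-mono-≤ 0≤‖ z ‖ z≤ 0≤‖ w ‖ w≤)

-- Quantitatively differentiable functions

-- The Lipschitz bound is a field of its own: over ℚ(i), on an arbitrary set `P`, there is no mean
-- value theorem to derive it from a bound on `f′`. A single constant for all four estimates keeps
-- the closure rules short.
record SmoothOn (P : ℚ[i] → Set) (f : ℚ[i] → ℚ[i]) : Set where
  field
    C         : ℚ
    0≤C       : 0ℚ ℚ.≤ C
    f′        : ℚ[i] → ℚ[i]
    bound     : ∀ {z} → P z → ‖ f z ‖ ℚ.≤ C
    bound′    : ∀ {z} → P z → ‖ f′ z ‖ ℚ.≤ C
    lipschitz : ∀ {z w} → P z → P w → ‖ f w -ᴳ f z ‖ ℚ.≤ C ℚ.* ‖ w -ᴳ z ‖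
    expansion : ∀ {z w} → P z → P w →
                ‖ f w -ᴳ f z -ᴳ (w -ᴳ z) *ᴳ f′ z ‖ ℚ.≤ C ℚ.* (‖ w -ᴳ z ‖ ℚ.* ‖ w -ᴳ z ‖)

module _ {P : ℚ[i] → Set} where

  open ℚ.≤-Reasoning

  smooth-const : ∀ c → SmoothOn P (λ _ → c)
  smooth-const c = record
    { C = ‖ c ‖ ; 0≤C = 0≤‖ c ‖ ; f′ = λ _ → 0ᴳ
    ; bound = λ _ → ℚ.≤-refl
    ; bound′ = λ _ → 0≤‖ c ‖
    ; lipschitz = λ {z} {w} _ _ → subst (ℚ._≤ ‖ c ‖ ℚ.* ‖ w -ᴳ z ‖)
        (cong ‖_‖ (solve 1 (λ c → con 0ᴳ := c :- c) refl c)) (*-nonNeg 0≤‖ c ‖ 0≤‖ w -ᴳ z ‖)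
    ; expansion = λ {z} {w} _ _ → subst (ℚ._≤ ‖ c ‖ ℚ.* (‖ w -ᴳ z ‖ ℚ.* ‖ w -ᴳ z ‖))
        (cong ‖_‖ (solve 2 (λ c d → con 0ᴳ := c :- c :- d :* con 0ᴳ) refl c (w -ᴳ z)))
        (*-nonNeg 0≤‖ c ‖ (*-nonNeg 0≤‖ w -ᴳ z ‖ 0≤‖ w -ᴳ z ‖))
    }
    where open ᴳS

  smooth-id : ∀ {K} → 0ℚ ℚ.≤ K → (∀ {z} → P z → ‖ z ‖ ℚ.≤ K) → SmoothOn P (λ z → z)
  smooth-id {K} 0≤K ‖z‖≤K = record
    { C = K ℚ.+ 1ℚ ; 0≤C = 0≤K+1 ; f′ = λ _ → 1ᴳ
    ; bound = λ Pz → ℚ.≤-trans (‖z‖≤K Pz) (≤-witness 1ℚ 0≤1 refl)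
    ; bound′ = λ _ → ≤-witness K 0≤K (ℚ.+-comm K 1ℚ)
    ; lipschitz = λ {z} {w} _ _ → ≤-witness (K ℚ.* ‖ w -ᴳ z ‖) (*-nonNeg 0≤K 0≤‖ w -ᴳ z ‖)
        (ℚS.solve 2 (λ k d → (k ℚS.:+ ℚS.con 1ℚ) ℚS.:* d ℚS.:= d ℚS.:+ k ℚS.:* d) refl K ‖ w -ᴳ z ‖)
    ; expansion = λ {z} {w} _ _ → subst (ℚ._≤ (K ℚ.+ 1ℚ) ℚ.* (‖ w -ᴳ z ‖ ℚ.* ‖ w -ᴳ z ‖))
        (cong ‖_‖ (solve 2 (λ z w → con 0ᴳ := w :- z :- (w :- z) :* con 1ᴳ) refl z w))
        (*-nonNeg 0≤K+1 (*-nonNeg 0≤‖ w -ᴳ z ‖ 0≤‖ w -ᴳ z ‖))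
    }
    where
    open ᴳS
    0≤K+1 : 0ℚ ℚ.≤ K ℚ.+ 1ℚ
    0≤K+1 = 0≤p+q 0≤K 0≤1

  module _ {f g : ℚ[i] → ℚ[i]} (sf : SmoothOn P f) (sg : SmoothOn P g) where
    private
      module F = SmoothOn sf
      module G = SmoothOn sg

    smooth-+ : SmoothOn P (λ z → f z +ᴳ g z)
    smooth-+ = record
      { C = F.C ℚ.+ G.C ; 0≤C = 0≤p+q F.0≤C G.0≤C ; f′ = λ z → F.f′ z +ᴳ G.f′ z
      ; bound = λ {z} Pz → ‖+‖≤ {f z} {g z} (F.bound Pz) (G.bound Pz)
      ; bound′ = λ {z} Pz → ‖+‖≤ {F.f′ z} {G.f′ z} (F.bound′ Pz) (G.bound′ Pz)
      ; lipschitz = λ {z} {w} Pz Pw → begin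
          ‖ (f w +ᴳ g w) -ᴳ (f z +ᴳ g z) ‖
            ≡⟨ cong ‖_‖ (solve 4 (λ a b c d → (a :+ b) :- (c :+ d) := (a :- c) :+ (b :- d)) refl (f w) (g w) (f z) (g z)) ⟩
          ‖ (f w -ᴳ f z) +ᴳ (g w -ᴳ g z) ‖
            ≤⟨ ‖+‖≤ {f w -ᴳ f z} {g w -ᴳ g z} (F.lipschitz Pz Pw) (G.lipschitz Pz Pw) ⟩
          F.C ℚ.* ‖ w -ᴳ z ‖ ℚ.+ G.C ℚ.* ‖ w -ᴳ z ‖
            ≡⟨ ℚ.*-distribʳ-+ ‖ w -ᴳ z ‖ F.C G.C ⟨
          (F.C ℚ.+ G.C) ℚ.* ‖ w -ᴳ z ‖ ∎
      ; expansion = λ {z} {w} Pz Pw → begin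
          ‖ (f w +ᴳ g w) -ᴳ (f z +ᴳ g z) -ᴳ (w -ᴳ z) *ᴳ (F.f′ z +ᴳ G.f′ z) ‖
            ≡⟨ cong ‖_‖ (solve 7 (λ a b c d e p q → (a :+ b) :- (c :+ d) :- e :* (p :+ q)
                                  := (a :- c :- e :* p) :+ (b :- d :- e :* q)) refl
                           (f w) (g w) (f z) (g z) (w -ᴳ z) (F.f′ z) (G.f′ z)) ⟩
          ‖ (f w -ᴳ f z -ᴳ (w -ᴳ z) *ᴳ F.f′ z) +ᴳ (g w -ᴳ g z -ᴳ (w -ᴳ z) *ᴳ G.f′ z) ‖
            ≤⟨ ‖+‖≤ {f w -ᴳ f z -ᴳ (w -ᴳ z) *ᴳ F.f′ z} {g w -ᴳ g z -ᴳ (w -ᴳ z) *ᴳ G.f′ z}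
                 (F.expansion Pz Pw) (G.expansion Pz Pw) ⟩
          F.C ℚ.* (‖ w -ᴳ z ‖ ℚ.* ‖ w -ᴳ z ‖) ℚ.+ G.C ℚ.* (‖ w -ᴳ z ‖ ℚ.* ‖ w -ᴳ z ‖)
            ≡⟨ ℚ.*-distribʳ-+ (‖ w -ᴳ z ‖ ℚ.* ‖ w -ᴳ z ‖) F.C G.C ⟨
          (F.C ℚ.+ G.C) ℚ.* (‖ w -ᴳ z ‖ ℚ.* ‖ w -ᴳ z ‖) ∎
      }
      where open ᴳS

    smooth-* : SmoothOn P (λ z → f z *ᴳ g z)
    smooth-* = record
      -- The remainder of the product rule splits into three products, each at most `FG` times the
      -- squared distance.
      { C = 3ℚ ℚ.* FG ; 0≤C = *-nonNeg (0≤fromℕ 3) 0≤FG ; f′ = λ z → F.f′ z *ᴳ g z +ᴳ f z *ᴳ G.f′ z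
      ; bound = λ {z} Pz → ℚ.≤-trans (‖*‖≤ {f z} {g z} (F.bound Pz) (G.bound Pz))
          (≤-witness (2ℚ ℚ.* FG) (*-nonNeg (0≤fromℕ 2) 0≤FG)
            (ℚS.solve 1 (λ x → ℚS.con 3ℚ ℚS.:* x ℚS.:= x ℚS.:+ ℚS.con 2ℚ ℚS.:* x) refl FG))
      ; bound′ = λ {z} Pz → ℚ.≤-trans
          (‖+‖≤ {F.f′ z *ᴳ g z} {f z *ᴳ G.f′ z}
            (‖*‖≤ {F.f′ z} {g z} (F.bound′ Pz) (G.bound Pz)) (‖*‖≤ {f z} {G.f′ z} (F.bound Pz) (G.bound′ Pz)))
          (≤-witness FG 0≤FG (ℚS.solve 1 (λ x → ℚS.con 3ℚ ℚS.:* x ℚS.:= (x ℚS.:+ x) ℚS.:+ x) refl FG))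
      ; lipschitz = λ {z} {w} Pz Pw → let d = ‖ w -ᴳ z ‖ in begin
          ‖ f w *ᴳ g w -ᴳ f z *ᴳ g z ‖
            ≡⟨ cong ‖_‖ (solve 4 (λ a b c d → a :* b :- c :* d := a :* (b :- d) :+ d :* (a :- c)) refl
                 (f w) (g w) (f z) (g z)) ⟩
          ‖ f w *ᴳ (g w -ᴳ g z) +ᴳ g z *ᴳ (f w -ᴳ f z) ‖
            ≤⟨ ‖+‖≤ {f w *ᴳ (g w -ᴳ g z)} {g z *ᴳ (f w -ᴳ f z)}
                 (‖*‖≤ {f w} {g w -ᴳ g z} (F.bound Pw) (G.lipschitz Pz Pw))
                 (‖*‖≤ {g z} {f w -ᴳ f z} (G.bound Pz) (F.lipschitz Pz Pw)) ⟩
          F.C ℚ.* (G.C ℚ.* d) ℚ.+ G.C ℚ.* (F.C ℚ.* d)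
            ≤⟨ ≤-witness (FG ℚ.* d) (*-nonNeg 0≤FG 0≤‖ w -ᴳ z ‖)
                 (ℚS.solve 3 (λ a b d → (ℚS.con 3ℚ ℚS.:* (a ℚS.:* b)) ℚS.:* d
                    ℚS.:= (a ℚS.:* (b ℚS.:* d) ℚS.:+ b ℚS.:* (a ℚS.:* d)) ℚS.:+ (a ℚS.:* b) ℚS.:* d) refl F.C G.C d) ⟩
          (3ℚ ℚ.* FG) ℚ.* d ∎
      ; expansion = λ {z} {w} Pz Pw → let Δ = w -ᴳ z ; d = ‖ w -ᴳ z ‖ in begin
          ‖ f w *ᴳ g w -ᴳ f z *ᴳ g z -ᴳ Δ *ᴳ (F.f′ z *ᴳ g z +ᴳ f z *ᴳ G.f′ z) ‖
            ≡⟨ cong ‖_‖ (solve 7 (λ fw gw fz gz e f′ g′ →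
                   fw :* gw :- fz :* gz :- e :* (f′ :* gz :+ fz :* g′)
                 := fw :* (gw :- gz :- e :* g′) :+ gz :* (fw :- fz :- e :* f′) :+ (e :* g′) :* (fw :- fz)) refl
                 (f w) (g w) (f z) (g z) Δ (F.f′ z) (G.f′ z)) ⟩
          ‖ f w *ᴳ (g w -ᴳ g z -ᴳ Δ *ᴳ G.f′ z) +ᴳ g z *ᴳ (f w -ᴳ f z -ᴳ Δ *ᴳ F.f′ z) +ᴳ (Δ *ᴳ G.f′ z) *ᴳ (f w -ᴳ f z) ‖
            ≤⟨ ‖+‖≤ {f w *ᴳ (g w -ᴳ g z -ᴳ Δ *ᴳ G.f′ z) +ᴳ g z *ᴳ (f w -ᴳ f z -ᴳ Δ *ᴳ F.f′ z)} {(Δ *ᴳ G.f′ z) *ᴳ (f w -ᴳ f z)}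
                 (‖+‖≤ {f w *ᴳ (g w -ᴳ g z -ᴳ Δ *ᴳ G.f′ z)} {g z *ᴳ (f w -ᴳ f z -ᴳ Δ *ᴳ F.f′ z)}
                   (‖*‖≤ {f w} {g w -ᴳ g z -ᴳ Δ *ᴳ G.f′ z} (F.bound Pw) (G.expansion Pz Pw))
                   (‖*‖≤ {g z} {f w -ᴳ f z -ᴳ Δ *ᴳ F.f′ z} (G.bound Pz) (F.expansion Pz Pw)))
                 (‖*‖≤ {Δ *ᴳ G.f′ z} {f w -ᴳ f z} (‖*‖≤ {Δ} {G.f′ z} ℚ.≤-refl (G.bound′ Pz)) (F.lipschitz Pz Pw)) ⟩
          (F.C ℚ.* (G.C ℚ.* (d ℚ.* d)) ℚ.+ G.C ℚ.* (F.C ℚ.* (d ℚ.* d))) ℚ.+ (d ℚ.* G.C) ℚ.* (F.C ℚ.* d)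
            ≡⟨ ℚS.solve 3 (λ a b d → (a ℚS.:* (b ℚS.:* (d ℚS.:* d)) ℚS.:+ b ℚS.:* (a ℚS.:* (d ℚS.:* d))) ℚS.:+ (d ℚS.:* b) ℚS.:* (a ℚS.:* d)
                    ℚS.:= (ℚS.con 3ℚ ℚS.:* (a ℚS.:* b)) ℚS.:* (d ℚS.:* d)) refl F.C G.C d ⟩
          (3ℚ ℚ.* FG) ℚ.* (d ℚ.* d) ∎
      }
      where
      open ᴳS
      3ℚ FG : ℚ
      3ℚ = fromℕ 3
      FG = F.C ℚ.* G.C
      0≤FG : 0ℚ ℚ.≤ FG
      0≤FG = *-nonNeg F.0≤C G.0≤C

  smooth-inv : ∀ {p δ} → SmoothOn P p → 0ℚ ℚ.< δ → (∀ {z} → P z → δ ℚ.≤ ‖ p z ‖) → SmoothOn P (λ z → inv (p z))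
  smooth-inv {p} {δ} sp 0<δ δ≤p = record
    -- `D` bounds 1/p and `D²C` bounds its derivative and its Lipschitz constant. The quadratic
    -- remainder costs `D²C` for the remainder of p and `D³C²` for replacing u(w) by u(z).
    { C = D ℚ.+ D²C ℚ.+ D³C² ; 0≤C = 0≤p+q (0≤p+q 0≤D 0≤D²C) 0≤D³C²
    ; f′ = λ z → -ᴳ ((u z *ᴳ u z) *ᴳ S.f′ z)
    ; bound = λ Pz → ℚ.≤-trans (u≤D Pz) (≤-witness (D²C ℚ.+ D³C²) (0≤p+q 0≤D²C 0≤D³C²) (ℚ.+-assoc D D²C D³C²))
    ; bound′ = λ {z} Pz → ℚ.≤-trans
        (subst (ℚ._≤ D²C) (sym (‖-z‖ ((u z *ᴳ u z) *ᴳ S.f′ z)))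
          (‖*‖≤ {u z *ᴳ u z} {S.f′ z} (‖*‖≤ {u z} {u z} (u≤D Pz) (u≤D Pz)) (S.bound′ Pz)))
        D²C≤
    ; lipschitz = λ {z} {w} Pz Pw → ℚ.≤-trans (lip Pz Pw)
        (ℚ.*-monoʳ-≤-nonNeg ‖ w -ᴳ z ‖ {{ℚ.nonNegative 0≤‖ w -ᴳ z ‖}} D²C≤)
    ; expansion = λ {z} {w} Pz Pw → let Δ = w -ᴳ z ; d = ‖ w -ᴳ z ‖ ; Δp = p w -ᴳ p z in begin
        ‖ u w -ᴳ u z -ᴳ Δ *ᴳ (-ᴳ ((u z *ᴳ u z) *ᴳ S.f′ z)) ‖
          ≡⟨ cong (λ t → ‖ t -ᴳ Δ *ᴳ (-ᴳ ((u z *ᴳ u z) *ᴳ S.f′ z)) ‖) (diff Pz Pw) ⟩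
        ‖ -ᴳ ((u w *ᴳ u z) *ᴳ Δp) -ᴳ Δ *ᴳ (-ᴳ ((u z *ᴳ u z) *ᴳ S.f′ z)) ‖
          ≡⟨ cong ‖_‖ (solve 5 (λ uw uz dp e p′ →
                 :- ((uw :* uz) :* dp) :- e :* (:- ((uz :* uz) :* p′))
              := :- (((uz :* uz) :* (dp :- e :* p′)) :+ (uw :- uz) :* (uz :* dp))) refl
               (u w) (u z) Δp Δ (S.f′ z)) ⟩
        ‖ -ᴳ ((u z *ᴳ u z) *ᴳ (Δp -ᴳ Δ *ᴳ S.f′ z) +ᴳ (u w -ᴳ u z) *ᴳ (u z *ᴳ Δp)) ‖
          ≡⟨ ‖-z‖ ((u z *ᴳ u z) *ᴳ (Δp -ᴳ Δ *ᴳ S.f′ z) +ᴳ (u w -ᴳ u z) *ᴳ (u z *ᴳ Δp)) ⟩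
        ‖ (u z *ᴳ u z) *ᴳ (Δp -ᴳ Δ *ᴳ S.f′ z) +ᴳ (u w -ᴳ u z) *ᴳ (u z *ᴳ Δp) ‖
          ≤⟨ ‖+‖≤ {(u z *ᴳ u z) *ᴳ (Δp -ᴳ Δ *ᴳ S.f′ z)} {(u w -ᴳ u z) *ᴳ (u z *ᴳ Δp)}
               (‖*‖≤ {u z *ᴳ u z} {Δp -ᴳ Δ *ᴳ S.f′ z} (‖*‖≤ {u z} {u z} (u≤D Pz) (u≤D Pz)) (S.expansion Pz Pw))
               (‖*‖≤ {u w -ᴳ u z} {u z *ᴳ Δp} (lip Pz Pw) (‖*‖≤ {u z} {Δp} (u≤D Pz) (S.lipschitz Pz Pw))) ⟩
        (D ℚ.* D) ℚ.* (S.C ℚ.* (d ℚ.* d)) ℚ.+ (D²C ℚ.* d) ℚ.* (D ℚ.* (S.C ℚ.* d))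
          ≤⟨ ≤-witness (D ℚ.* (d ℚ.* d)) (*-nonNeg 0≤D (*-nonNeg 0≤‖ w -ᴳ z ‖ 0≤‖ w -ᴳ z ‖))
               (ℚS.solve 3 (λ D C d →
                    (D ℚS.:+ (D ℚS.:* D) ℚS.:* C ℚS.:+ ((D ℚS.:* D) ℚS.:* C) ℚS.:* (D ℚS.:* C)) ℚS.:* (d ℚS.:* d)
                    ℚS.:= ((D ℚS.:* D) ℚS.:* (C ℚS.:* (d ℚS.:* d)) ℚS.:+ (((D ℚS.:* D) ℚS.:* C) ℚS.:* d) ℚS.:* (D ℚS.:* (C ℚS.:* d)))
                       ℚS.:+ D ℚS.:* (d ℚS.:* d)) refl D S.C d) ⟩
        (D ℚ.+ D²C ℚ.+ D³C²) ℚ.* (d ℚ.* d) ∎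
    }
    where
    open ᴳS
    module S = SmoothOn sp
    u : ℚ[i] → ℚ[i]
    u z = inv (p z)
    D D²C D³C² : ℚ
    D = proj₁ (divide 0<δ (0<fromℕ-suc 1))
    D²C = (D ℚ.* D) ℚ.* S.C
    D³C² = D²C ℚ.* (D ℚ.* S.C)
    0≤D : 0ℚ ℚ.≤ D
    0≤D = ℚ.<⇒≤ (proj₁ (proj₂ (divide 0<δ (0<fromℕ-suc 1))))
    0≤D²C : 0ℚ ℚ.≤ D²C
    0≤D²C = *-nonNeg (*-nonNeg 0≤D 0≤D) S.0≤C
    0≤D³C² : 0ℚ ℚ.≤ D³C²
    0≤D³C² = *-nonNeg 0≤D²C (*-nonNeg 0≤D S.0≤C)
    D²C≤ : D²C ℚ.≤ D ℚ.+ D²C ℚ.+ D³C²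
    D²C≤ = ≤-witness (D ℚ.+ D³C²) (0≤p+q 0≤D 0≤D³C²)
      (ℚS.solve 3 (λ a b c → a ℚS.:+ b ℚS.:+ c ℚS.:= b ℚS.:+ (a ℚS.:+ c)) refl D D²C D³C²)
    u≤D : ∀ {z} → P z → ‖ u z ‖ ℚ.≤ D
    u≤D {z} Pz = ‖inv‖≤ {p z} 0<δ (δ≤p Pz) (proj₂ (proj₂ (divide 0<δ (0<fromℕ-suc 1))))
    pu : ∀ {z} → P z → p z *ᴳ u z ≡ 1ᴳ
    pu {z} Pz = *-inv {p z} (ℚ.<-≤-trans 0<δ (δ≤p Pz))
    diff : ∀ {z w} → P z → P w → u w -ᴳ u z ≡ -ᴳ ((u w *ᴳ u z) *ᴳ (p w -ᴳ p z))
    diff {z} {w} Pz Pw = trans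
      (solve 2 (λ a b → a :- b := con 1ᴳ :* a :- con 1ᴳ :* b) refl (u w) (u z))
      (trans (cong₂ (λ s t → s *ᴳ u w -ᴳ t *ᴳ u z) (sym (pu Pz)) (sym (pu Pw)))
        (solve 4 (λ pz uz pw uw → (pz :* uz) :* uw :- (pw :* uw) :* uz := :- ((uw :* uz) :* (pw :- pz))) refl
          (p z) (u z) (p w) (u w)))
    lip : ∀ {z w} → P z → P w → ‖ u w -ᴳ u z ‖ ℚ.≤ D²C ℚ.* ‖ w -ᴳ z ‖
    lip {z} {w} Pz Pw = begin
      ‖ u w -ᴳ u z ‖                               ≡⟨ cong ‖_‖ (diff Pz Pw) ⟩
      ‖ -ᴳ ((u w *ᴳ u z) *ᴳ (p w -ᴳ p z)) ‖        ≡⟨ ‖-z‖ ((u w *ᴳ u z) *ᴳ (p w -ᴳ p z)) ⟩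
      ‖ (u w *ᴳ u z) *ᴳ (p w -ᴳ p z) ‖
        ≤⟨ ‖*‖≤ {u w *ᴳ u z} {p w -ᴳ p z} (‖*‖≤ {u w} {u z} (u≤D Pw) (u≤D Pz)) (S.lipschitz Pz Pw) ⟩
      (D ℚ.* D) ℚ.* (S.C ℚ.* ‖ w -ᴳ z ‖)           ≡⟨ ℚ.*-assoc (D ℚ.* D) S.C ‖ w -ᴳ z ‖ ⟨
      D²C ℚ.* ‖ w -ᴳ z ‖ ∎

  smooth-eval : ∀ {K n} → 0ℚ ℚ.≤ K → (∀ {z} → P z → ‖ z ‖ ℚ.≤ K) → (cs : Vec ℚ[i] n) → SmoothOn P (evalᴳ cs)
  smooth-eval 0≤K ≤K []       = smooth-const 1ᴳ
  smooth-eval 0≤K ≤K (c ∷ cs) = smooth-+ (smooth-const c) (smooth-* (smooth-id 0≤K ≤K) (smooth-eval 0≤K ≤K cs))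

-- A discrete Cauchy theorem on a square grid

∑< : ℕ → (ℕ → ℚ) → ℚ
∑< zero    f = 0ℚ
∑< (suc m) f = ∑< m f ℚ.+ f m

∑<-mono : ∀ m {f g} → (∀ a → a ℕ.< m → f a ℚ.≤ g a) → ∑< m f ℚ.≤ ∑< m g
∑<-mono zero    f≤g = ℚ.≤-refl
∑<-mono (suc m) f≤g = ℚ.+-mono-≤ (∑<-mono m λ a a<m → f≤g a (ℕ.m<n⇒m<1+n a<m)) (f≤g m ℕ.≤-refl)

∑<-const : ∀ m p → ∑< m (λ _ → p) ≡ fromℕ m ℚ.* p
∑<-const zero    p = sym (ℚ.*-zeroˡ p)
∑<-const (suc m) p = trans (cong (ℚ._+ p) (∑<-const m p))
  (trans (solve 2 (λ m p → m :* p :+ p := (con 1ℚ :+ m) :* p) refl (fromℕ m) p)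
    (cong (ℚ._* p) (fromℕ-+ 1 m)))
  where open ℚS

∑<-+ : ∀ m f g → ∑< m (λ a → f a ℚ.+ g a) ≡ ∑< m f ℚ.+ ∑< m g
∑<-+ zero    f g = refl
∑<-+ (suc m) f g = trans (cong (ℚ._+ (f m ℚ.+ g m)) (∑<-+ m f g))
  (solve 4 (λ a b c d → (a :+ b) :+ (c :+ d) := (a :+ c) :+ (b :+ d)) refl (∑< m f) (∑< m g) (f m) (g m))
  where open ℚS

∑<-telescope : ∀ m (f : ℕ → ℚ) → ∑< m (λ a → f (suc a) ℚ.- f a) ≡ f m ℚ.- f 0
∑<-telescope zero    f = sym (ℚ.+-inverseʳ (f 0))
∑<-telescope (suc m) f = trans (cong (ℚ._+ (f (suc m) ℚ.- f m)) (∑<-telescope m f))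
  (solve 3 (λ a b c → (b :- a) :+ (c :- b) := c :- a) refl (f 0) (f m) (f (suc m)))
  where open ℚS

-- Up to a factor 2/h, the trapezoid rule for the contour integral around a square cell of side h,
-- given the values of the integrand at its corners.
cell : (sw se nw ne : ℚ[i]) → ℚ[i]
cell sw se nw ne = (1ᴳ -ᴳ iᴳ) *ᴳ (sw -ᴳ ne) +ᴳ (1ᴳ +ᴳ iᴳ) *ᴳ (se -ᴳ nw)

-- The imaginary part suffices, since ∮ dz/z = 2πi. Grouped into horizontal and vertical edges it
-- becomes a sum of two differences, one in each grid direction, ready to telescope.
imag-cell : ∀ sw se nw ne → imag (cell sw se nw ne) ≡
  ((ℚ.- (imag nw ℚ.+ imag ne)) ℚ.- (ℚ.- (imag sw ℚ.+ imag se))) ℚ.+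
  ((real se ℚ.+ real ne) ℚ.- (real sw ℚ.+ real nw))
imag-cell (gauss a a′) (gauss b b′) (gauss c c′) (gauss d d′) = solve 8
  (λ a a′ b b′ c c′ d d′ →
     ((con 1ℚ :- con 0ℚ) :* (a′ :- d′) :+ (con 0ℚ :- con 1ℚ) :* (a :- d))
       :+ ((con 1ℚ :+ con 0ℚ) :* (b′ :- c′) :+ (con 0ℚ :+ con 1ℚ) :* (b :- c))
  := ((:- (c′ :+ d′)) :- (:- (a′ :+ b′))) :+ ((b :+ d) :- (a :+ c))) refl a a′ b b′ c c′ d d′
  where open ℚS

grid-sum : (F : ℕ → ℕ → ℚ[i]) → ℕ → ℚ
grid-sum F m = ∑< m λ a → ∑< m λ b → imag (cell (F a b) (F (suc a) b) (F a (suc b)) (F (suc a) (suc b)))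

∑<-cong : ∀ m {f g} → (∀ a → f a ≡ g a) → ∑< m f ≡ ∑< m g
∑<-cong zero    f≗g = refl
∑<-cong (suc m) f≗g = cong₂ ℚ._+_ (∑<-cong m f≗g) (f≗g m)

∑<-- : ∀ m f g → ∑< m (λ a → f a ℚ.- g a) ≡ ∑< m f ℚ.- ∑< m g
∑<-- zero    f g = refl
∑<-- (suc m) f g = trans (cong (ℚ._+ (f m ℚ.- g m)) (∑<-- m f g))
  (solve 4 (λ a b c d → (a :- b) :+ (c :- d) := (a :+ c) :- (b :+ d)) refl (∑< m f) (∑< m g) (f m) (g m))
  where open ℚS

-- An interior edge is traversed once in each direction and cancels: `Φ` telescopes upwards within a
-- column, `Ψ` from one column to the next.
grid-sum-boundary : ∀ F m → grid-sum F m ≡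
  ∑< m (λ a → (ℚ.- (imag (F a m) ℚ.+ imag (F (suc a) m))) ℚ.- (ℚ.- (imag (F a 0) ℚ.+ imag (F (suc a) 0))))
  ℚ.+ ∑< m (λ b → (real (F m b) ℚ.+ real (F m (suc b))) ℚ.- (real (F 0 b) ℚ.+ real (F 0 (suc b))))
grid-sum-boundary F m = begin
  grid-sum F m
    ≡⟨ ∑<-cong m (λ a → trans
         (∑<-cong m λ b → imag-cell (F a b) (F (suc a) b) (F a (suc b)) (F (suc a) (suc b)))
         (∑<-+ m (λ b → Φ a (suc b) ℚ.- Φ a b) (λ b → Ψ (suc a) b ℚ.- Ψ a b))) ⟩
  ∑< m (λ a → ∑< m (λ b → Φ a (suc b) ℚ.- Φ a b) ℚ.+ ∑< m (λ b → Ψ (suc a) b ℚ.- Ψ a b))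
    ≡⟨ ∑<-+ m (λ a → ∑< m (λ b → Φ a (suc b) ℚ.- Φ a b)) (λ a → ∑< m (λ b → Ψ (suc a) b ℚ.- Ψ a b)) ⟩
  ∑< m (λ a → ∑< m (λ b → Φ a (suc b) ℚ.- Φ a b)) ℚ.+ ∑< m (λ a → ∑< m (λ b → Ψ (suc a) b ℚ.- Ψ a b))
    ≡⟨ cong₂ ℚ._+_ (∑<-cong m (λ a → ∑<-telescope m (Φ a)))
                   (∑<-cong m (λ a → ∑<-- m (Ψ (suc a)) (Ψ a))) ⟩
  ∑< m (λ a → Φ a m ℚ.- Φ a 0) ℚ.+ ∑< m (λ a → ∑< m (Ψ (suc a)) ℚ.- ∑< m (Ψ a))
    ≡⟨ cong (∑< m (λ a → Φ a m ℚ.- Φ a 0) ℚ.+_)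
         (trans (∑<-telescope m (λ a → ∑< m (Ψ a))) (sym (∑<-- m (Ψ m) (Ψ 0)))) ⟩
  ∑< m (λ a → Φ a m ℚ.- Φ a 0) ℚ.+ ∑< m (λ b → Ψ m b ℚ.- Ψ 0 b) ∎
  where
  open ≡-Reasoning
  Φ Ψ : ℕ → ℕ → ℚ
  Φ a b = ℚ.- (imag (F a b) ℚ.+ imag (F (suc a) b))
  Ψ a b = real (F a b) ℚ.+ real (F a (suc b))

-- The trapezoid rule is exact on affine functions.
smooth-cell : ∀ {P f} (sf : SmoothOn P f) {z h} → 0ℚ ℚ.≤ h →
  let se = z +ᴳ fromReal h ; nw = z +ᴳ iᴳ *ᴳ fromReal h ; ne = z +ᴳ (1ᴳ +ᴳ iᴳ) *ᴳ fromReal h in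
  P z → P se → P nw → P ne →
  ‖ cell (f z) (f se) (f nw) (f ne) ‖ ℚ.≤ fromℕ 12 ℚ.* SmoothOn.C sf ℚ.* (h ℚ.* h)
smooth-cell {P} {f} sf {z} {h} 0≤h Pz Pse Pnw Pne = begin
  ‖ cell (f z) (f se) (f nw) (f ne) ‖
    ≡⟨ cong ‖_‖ (solve 7 (λ fz fse fnw fne f′ z H →
         (con 1ᴳ :- con iᴳ) :* (fz :- fne) :+ (con 1ᴳ :+ con iᴳ) :* (fse :- fnw)
         := (con 1ᴳ :+ con iᴳ) :* ((fse :- fz :- ((z :+ H) :- z) :* f′) :- (fnw :- fz :- ((z :+ con iᴳ :* H) :- z) :* f′))
            :- (con 1ᴳ :- con iᴳ) :* (fne :- fz :- ((z :+ (con 1ᴳ :+ con iᴳ) :* H) :- z) :* f′)) refl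
         (f z) (f se) (f nw) (f ne) (S.f′ z) z H) ⟩
  ‖ (1ᴳ +ᴳ iᴳ) *ᴳ (E se -ᴳ E nw) -ᴳ (1ᴳ -ᴳ iᴳ) *ᴳ E ne ‖
    ≤⟨ ‖-‖≤ {(1ᴳ +ᴳ iᴳ) *ᴳ (E se -ᴳ E nw)} {(1ᴳ -ᴳ iᴳ) *ᴳ E ne}
         (‖*‖≤ {1ᴳ +ᴳ iᴳ} {E se -ᴳ E nw} ℚ.≤-refl
           (‖-‖≤ {E se} {E nw} (E≤ Pse H (ℚ.≤-reflexive ‖H‖) refl) (E≤ Pnw (iᴳ *ᴳ H) ‖iH‖≤ refl)))
         (‖*‖≤ {1ᴳ -ᴳ iᴳ} {E ne} ℚ.≤-refl (E≤ Pne ((1ᴳ +ᴳ iᴳ) *ᴳ H) ‖1+iH‖≤ refl)) ⟩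
  -- Both 1 + i and 1 - i have norm 2, and the north-east corner lies at distance at most 2h; so 12
  -- = 2 (1 + 1) + 2 · 2².
  2ℚ ℚ.* (S.C ℚ.* (h ℚ.* h) ℚ.+ S.C ℚ.* (h ℚ.* h)) ℚ.+ 2ℚ ℚ.* (S.C ℚ.* ((2ℚ ℚ.* h) ℚ.* (2ℚ ℚ.* h)))
    ≡⟨ ℚS.solve 2 (λ C h → ℚS.con 2ℚ ℚS.:* (C ℚS.:* (h ℚS.:* h) ℚS.:+ C ℚS.:* (h ℚS.:* h))
           ℚS.:+ ℚS.con 2ℚ ℚS.:* (C ℚS.:* ((ℚS.con 2ℚ ℚS.:* h) ℚS.:* (ℚS.con 2ℚ ℚS.:* h)))
         ℚS.:= ℚS.con (fromℕ 12) ℚS.:* C ℚS.:* (h ℚS.:* h)) refl S.C h ⟩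
  fromℕ 12 ℚ.* S.C ℚ.* (h ℚ.* h) ∎
  where
  open ℚ.≤-Reasoning
  open ᴳS
  module S = SmoothOn sf
  H se nw ne : ℚ[i]
  H = fromReal h
  se = z +ᴳ H
  nw = z +ᴳ iᴳ *ᴳ H
  ne = z +ᴳ (1ᴳ +ᴳ iᴳ) *ᴳ H
  E : ℚ[i] → ℚ[i]
  E w = f w -ᴳ f z -ᴳ (w -ᴳ z) *ᴳ S.f′ z
  ‖H‖ : ‖ H ‖ ≡ h
  ‖H‖ = trans (ℚ.+-identityʳ ℚ.∣ h ∣) (ℚ.0≤p⇒∣p∣≡p 0≤h)
  ‖iH‖≤ : ‖ iᴳ *ᴳ H ‖ ℚ.≤ h
  ‖iH‖≤ = ℚ.≤-trans (‖z*w‖≤ iᴳ H) (ℚ.≤-reflexive (trans (ℚ.*-identityˡ ‖ H ‖) ‖H‖))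
  ‖1+iH‖≤ : ‖ (1ᴳ +ᴳ iᴳ) *ᴳ H ‖ ℚ.≤ 2ℚ ℚ.* h
  ‖1+iH‖≤ = ℚ.≤-trans (‖z*w‖≤ (1ᴳ +ᴳ iᴳ) H) (ℚ.≤-reflexive (cong (2ℚ ℚ.*_) ‖H‖))
  E≤ : ∀ {w δ} → P w → ∀ D → ‖ D ‖ ℚ.≤ δ → w ≡ z +ᴳ D → ‖ E w ‖ ℚ.≤ S.C ℚ.* (δ ℚ.* δ)
  E≤ {w} {δ} Pw D D≤δ refl = ℚ.≤-trans (S.expansion Pz Pw)
    (ℚ.*-monoˡ-≤-nonNeg S.C {{ℚ.nonNegative S.0≤C}} (sq-mono 0≤‖ z +ᴳ D -ᴳ z ‖
      (subst (λ t → ‖ t ‖ ℚ.≤ δ) (solve 2 (λ z D → D := z :+ D :- z) refl z D) D≤δ)))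

-- Monic polynomials near infinity

powᴳ : ℚ[i] → ℕ → ℚ[i]
powᴳ z zero    = 1ᴳ
powᴳ z (suc n) = z *ᴳ powᴳ z n

pow-inverse : ∀ {z t} → z *ᴳ t ≡ 1ᴳ → ∀ n → powᴳ z n *ᴳ powᴳ t n ≡ 1ᴳ
pow-inverse zt≡1 zero = refl
pow-inverse {z} {t} zt≡1 (suc n) = trans
  (solve 4 (λ z t a b → (z :* a) :* (t :* b) := (z :* t) :* (a :* b)) refl z t (powᴳ z n) (powᴳ t n))
  (cong₂ _*ᴳ_ zt≡1 (pow-inverse zt≡1 n))
  where open ᴳS

‖pow‖≤1 : ∀ {t} → ‖ t ‖ ℚ.≤ 1ℚ → ∀ n → ‖ powᴳ t n ‖ ℚ.≤ 1ℚ
‖pow‖≤1 t≤1 zero    = ℚ.≤-refl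
‖pow‖≤1 {t} t≤1 (suc n) = ‖*‖≤ {t} {powᴳ t n} t≤1 (‖pow‖≤1 t≤1 n)

coefficient-norm : ∀ {n} → Vec ℚ[i] n → ℚ
coefficient-norm []       = 0ℚ
coefficient-norm (c ∷ cs) = ‖ c ‖ ℚ.+ coefficient-norm cs

0≤coefficient-norm : ∀ {n} (cs : Vec ℚ[i] n) → 0ℚ ℚ.≤ coefficient-norm cs
0≤coefficient-norm []       = ℚ.≤-refl
0≤coefficient-norm (c ∷ cs) = 0≤p+q 0≤‖ c ‖ (0≤coefficient-norm cs)

-- Multiplication by tⁿ = z⁻ⁿ reverses the coefficients: the leading 1 becomes the constant term,
-- and all other terms carry a factor t.
eval-near-∞ : ∀ {n} (cs : Vec ℚ[i] n) {z t} → z *ᴳ t ≡ 1ᴳ → ‖ t ‖ ℚ.≤ 1ℚ →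
  ∃[ q ] (‖ q ‖ ℚ.≤ coefficient-norm cs × evalᴳ cs z *ᴳ powᴳ t n ≡ 1ᴳ +ᴳ t *ᴳ q)
eval-near-∞ [] {z} {t} zt≡1 t≤1 = 0ᴳ , ℚ.≤-refl , solve 1 (λ t → con 1ᴳ :* con 1ᴳ := con 1ᴳ :+ t :* con 0ᴳ) refl t
  where open ᴳS
eval-near-∞ {suc n} (c ∷ cs) {z} {t} zt≡1 t≤1 with eval-near-∞ cs {z} {t} zt≡1 t≤1
... | q , q≤ , eq = c *ᴳ T +ᴳ q
  , ‖+‖≤ {c *ᴳ T} {q}
      (ℚ.≤-trans (‖*‖≤ {c} {T} ℚ.≤-refl (‖pow‖≤1 {t} t≤1 n)) (ℚ.≤-reflexive (ℚ.*-identityʳ ‖ c ‖))) q≤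
  , trans (solve 5 (λ c z p t T → (c :+ z :* p) :* (t :* T) := t :* (c :* T) :+ (z :* t) :* (p :* T)) refl
             c z (evalᴳ cs z) t T)
      (trans (cong₂ (λ u v → t *ᴳ (c *ᴳ T) +ᴳ u *ᴳ v) zt≡1 eq)
        (solve 4 (λ c t T q → t :* (c :* T) :+ con 1ᴳ :* (con 1ᴳ :+ t :* q) := con 1ᴳ :+ t :* (c :* T :+ q)) refl c t T q))
  where
  open ᴳS
  T : ℚ[i]
  T = powᴳ t n

4ℚ ¼ : ℚ
4ℚ = fromℕ 4
¼ = 1/suc 3

-- With t = 1/z and p(z) tⁿ⁺¹ = 1 + t q, the quotient f = zⁿ/p(z) satisfies f (1 + t q) = t.
quotient-near-∞ : ∀ {n} (cs : Vec ℚ[i] (suc n)) {z r} → 0ℚ ℚ.< ‖ z ‖ → 0ℚ ℚ.< ‖ evalᴳ cs z ‖ →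
  ‖ inv z ‖ ℚ.≤ 2ℚ ℚ.* r → 2ℚ ℚ.* r ℚ.≤ 1ℚ → (2ℚ ℚ.* r) ℚ.* coefficient-norm cs ℚ.≤ 1/suc 8 →
  ‖ powᴳ z n *ᴳ inv (evalᴳ cs z) -ᴳ inv z ‖ ℚ.≤ r ℚ.* ¼
quotient-near-∞ {n} cs {z} {r} 0<z 0<p t≤2r 2r≤1 small = begin
  ‖ f -ᴳ t ‖             ≡⟨ cong (λ u → ‖ f -ᴳ u ‖) t≡ ⟨
  ‖ f -ᴳ f *ᴳ (1ᴳ +ᴳ d) ‖
    ≡⟨ cong ‖_‖ (solve 2 (λ f d → f :- f :* (con 1ᴳ :+ d) := :- (f :* d)) refl f d) ⟩
  ‖ -ᴳ (f *ᴳ d) ‖        ≡⟨ ‖-z‖ (f *ᴳ d) ⟩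
  ‖ f *ᴳ d ‖             ≤⟨ fd≤X ⟩
  X                      ≤⟨ ℚ.*-cancelˡ-≤-pos (fromℕ 8) 8X≤ ⟩
  r ℚ.* ¼                ∎
  where
  open ℚ.≤-Reasoning
  open ᴳS
  t T f u q d : ℚ[i]
  t = inv z
  T = powᴳ t n
  u = inv (evalᴳ cs z)
  f = powᴳ z n *ᴳ u
  near : ∃[ q ] (‖ q ‖ ℚ.≤ coefficient-norm cs × evalᴳ cs z *ᴳ powᴳ t (suc n) ≡ 1ᴳ +ᴳ t *ᴳ q)
  near = eval-near-∞ cs {z} {t} (*-inv {z} 0<z) (ℚ.≤-trans t≤2r 2r≤1)
  q = proj₁ near
  q≤ : ‖ q ‖ ℚ.≤ coefficient-norm cs
  q≤ = proj₁ (proj₂ near)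
  pT≡ : evalᴳ cs z *ᴳ powᴳ t (suc n) ≡ 1ᴳ +ᴳ t *ᴳ q
  pT≡ = proj₂ (proj₂ near)
  d = t *ᴳ q
  X : ℚ
  X = ‖ f ‖ ℚ.* 1/suc 8
  d≤ : ‖ d ‖ ℚ.≤ 1/suc 8
  d≤ = ℚ.≤-trans (‖*‖≤ {t} {q} t≤2r q≤) small
  fd≤X : ‖ f *ᴳ d ‖ ℚ.≤ X
  fd≤X = ‖*‖≤ {f} {d} ℚ.≤-refl d≤
  t≡ : f *ᴳ (1ᴳ +ᴳ d) ≡ t
  t≡ = trans (cong (f *ᴳ_) (sym pT≡))
    (trans (solve 5 (λ Z u p t T → (Z :* u) :* (p :* (t :* T)) := ((Z :* T) :* (p :* u)) :* t) refl
              (powᴳ z n) u (evalᴳ cs z) t T)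
      (trans (cong₂ (λ a b → (a *ᴳ b) *ᴳ t) (pow-inverse (*-inv {z} 0<z) n) (*-inv {evalᴳ cs z} 0<p))
        (solve 1 (λ t → (con 1ᴳ :* con 1ᴳ) :* t := t) refl t)))
  f≤ : ‖ f ‖ ℚ.≤ 2ℚ ℚ.* r ℚ.+ X
  f≤ = subst (λ v → ‖ v ‖ ℚ.≤ 2ℚ ℚ.* r ℚ.+ X)
    (trans (cong (_-ᴳ f *ᴳ d) (sym t≡)) (solve 2 (λ f d → f :* (con 1ᴳ :+ d) :- f :* d := f) refl f d))
    (‖-‖≤ {t} {f *ᴳ d} t≤2r fd≤X)
  -- Here X = ‖f‖/9, so 8X = ‖f‖ - X ≤ 2r. The tolerance 1/9 for `d` is chosen to make X at most
  -- r/4.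
  8X≤ : fromℕ 8 ℚ.* X ℚ.≤ fromℕ 8 ℚ.* (r ℚ.* ¼)
  8X≤ = begin
    fromℕ 8 ℚ.* X
      ≡⟨ ℚS.solve 1 (λ f → ℚS.con (fromℕ 8) ℚS.:* (f ℚS.:* ℚS.con (1/suc 8)) ℚS.:= f ℚS.:- f ℚS.:* ℚS.con (1/suc 8)) refl ‖ f ‖ ⟩
    ‖ f ‖ ℚ.- X                  ≤⟨ ℚ.+-monoˡ-≤ (ℚ.- X) f≤ ⟩
    (2ℚ ℚ.* r ℚ.+ X) ℚ.- X
      ≡⟨ ℚS.solve 2 (λ r X → (ℚS.con 2ℚ ℚS.:* r ℚS.:+ X) ℚS.:- X ℚS.:= ℚS.con (fromℕ 8) ℚS.:* (r ℚS.:* ℚS.con ¼)) refl r X ⟩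
    fromℕ 8 ℚ.* (r ℚ.* ¼)        ∎

-- Approximate roots by a finite search on a grid

q-∣p-q∣≤p : ∀ p q → q ℚ.- ℚ.∣ p ℚ.- q ∣ ℚ.≤ p
q-∣p-q∣≤p p q = ≤-witness (ℚ.∣ p ℚ.- q ∣ ℚ.+ (p ℚ.- q))
  (subst (0ℚ ℚ.≤_) (trans (cong (ℚ._- (q ℚ.- p)) (∣p-q∣≡∣q-p∣ q p))
      (solve 3 (λ a p q → a :- (q :- p) := a :+ (p :- q)) refl ℚ.∣ p ℚ.- q ∣ p q))
    (0≤q-p (p≤∣p∣ (q ℚ.- p))))
  (solve 3 (λ a p q → p := (q :- a) :+ (a :+ (p :- q))) refl ℚ.∣ p ℚ.- q ∣ p q)
  where open ℚS

module ApproximateRoot {n} (cs : Vec ℚ[i] (suc n)) {ε} (0<ε : 0ℚ ℚ.< ε) where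

  S : ℚ
  S = coefficient-norm cs

  opaque
    R′ : ℕ
    -- R ≥ 18 S makes (2r) S at most 1/9, as `quotient-near-∞` requires. The additional `suc`
    -- secures R ≥ 2, hence 2r ≤ 1.
    R′ = suc (floorℕ (fromℕ 18 ℚ.* S))

    1≤R′ : 1 ℕ.≤ R′
    1≤R′ = ℕ.s≤s ℕ.z≤n

    18S≤R : fromℕ 18 ℚ.* S ℚ.≤ fromℕ (suc R′)
    18S≤R = ℚ.≤-trans (ℚ.<⇒≤ (<-floor (*-nonNeg (0≤fromℕ 18) (0≤coefficient-norm cs))))
      (fromℕ-mono (ℕ.n≤1+n R′))

  -- On the boundary of the square ‖ f z - 1/z ‖ ≤ c, while 1/z has a coordinate of size at least 2c.
  R r c : ℚ
  R = fromℕ (suc R′)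
  r = 1/suc R′
  c = r ℚ.* ¼

  0≤R : 0ℚ ℚ.≤ R
  0≤R = 0≤fromℕ (suc R′)

  0≤r : 0ℚ ℚ.≤ r
  0≤r = ℚ.<⇒≤ (0<1/suc R′)

  r*R : r ℚ.* R ≡ 1ℚ
  r*R = 1/suc*suc R′

  2r≤1 : 2ℚ ℚ.* r ℚ.≤ 1ℚ
  2r≤1 = subst (2ℚ ℚ.* r ℚ.≤_) (trans (ℚ.*-comm R r) r*R)
    (ℚ.*-monoʳ-≤-nonNeg r {{ℚ.nonNegative 0≤r}} (fromℕ-mono {2} {suc R′} (ℕ.s≤s 1≤R′)))

  2rS≤ : (2ℚ ℚ.* r) ℚ.* S ℚ.≤ 1/suc 8
  2rS≤ = begin
    (2ℚ ℚ.* r) ℚ.* S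
      ≡⟨ solve 2 (λ r S → (con 2ℚ :* r) :* S := (r :* (con (fromℕ 18) :* S)) :* con (1/suc 8)) refl r S ⟩
    (r ℚ.* (fromℕ 18 ℚ.* S)) ℚ.* 1/suc 8
      ≤⟨ ℚ.*-monoʳ-≤-nonNeg (1/suc 8) (ℚ.*-monoˡ-≤-nonNeg r {{ℚ.nonNegative 0≤r}} 18S≤R) ⟩
    (r ℚ.* R) ℚ.* 1/suc 8
      ≡⟨ trans (cong (ℚ._* 1/suc 8) r*R) (ℚ.*-identityˡ (1/suc 8)) ⟩
    1/suc 8 ∎
    where
    open ℚ.≤-Reasoning
    open ℚS

  p f : ℚ[i] → ℚ[i]
  p = evalᴳ cs
  f z = powᴳ z n *ᴳ inv (p z)

  P : ℚ[i] → Set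
  P z = ‖ z ‖ ℚ.≤ 2ℚ ℚ.* R × ε ℚ.≤ ‖ p z ‖

  0≤2R : 0ℚ ℚ.≤ 2ℚ ℚ.* R
  0≤2R = *-nonNeg (0≤fromℕ 2) 0≤R

  smooth-pow : ∀ k → SmoothOn P (λ z → powᴳ z k)
  smooth-pow zero    = smooth-const 1ᴳ
  smooth-pow (suc k) = smooth-* (smooth-id 0≤2R proj₁) (smooth-pow k)

  opaque
    smooth-f : SmoothOn P f
    smooth-f = smooth-* (smooth-pow n) (smooth-inv (smooth-eval 0≤2R proj₁ cs) 0<ε proj₂)

  module Side {z} (Pz : P z) (x≤R : ℚ.∣ real z ∣ ℚ.≤ R) (y≤R : ℚ.∣ imag z ∣ ℚ.≤ R) (R≤z : R ℚ.≤ ‖ z ‖) where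

    ρ : ℚ
    ρ = recip (normSq z)

    0<z : 0ℚ ℚ.< ‖ z ‖
    0<z = ℚ.<-≤-trans (0<fromℕ-suc R′) R≤z

    f-t≤c : ‖ f z -ᴳ inv z ‖ ℚ.≤ c
    f-t≤c = quotient-near-∞ cs {z} {r} 0<z (ℚ.<-≤-trans 0<ε (proj₂ Pz))
      (‖inv‖≤ {z} (0<fromℕ-suc R′) R≤z
        (trans (ℚS.solve 2 (λ r R → R ℚS.:* (ℚS.con 2ℚ ℚS.:* r) ℚS.:= ℚS.con 2ℚ ℚS.:* (r ℚS.:* R)) refl r R)
          (cong (2ℚ ℚ.*_) r*R)))
      2r≤1 2rS≤

    -- In the square |z|² ≤ 2R², so R/|z|², the size of the relevant coordinate of 1/z on a side, is
    -- at least 1/(2R) = r/2 = 2c.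
    2c≤Rρ : c ℚ.+ c ℚ.≤ R ℚ.* ρ
    2c≤Rρ = begin
      c ℚ.+ c
        ≡⟨ solve 1 (λ r → r :* con ¼ :+ r :* con ¼ := (r :* con 1ℚ) :* con ½) refl r ⟩
      (r ℚ.* 1ℚ) ℚ.* ½
        ≡⟨ cong (λ u → (r ℚ.* u) ℚ.* ½) (*-recip (0<‖z‖⇒0<normSq {z} 0<z)) ⟨
      (r ℚ.* (normSq z ℚ.* ρ)) ℚ.* ½
        ≤⟨ ℚ.*-monoʳ-≤-nonNeg ½ (ℚ.*-monoˡ-≤-nonNeg r {{ℚ.nonNegative 0≤r}}
             (ℚ.*-monoʳ-≤-nonNeg ρ {{ℚ.nonNegative 0≤ρ}} N≤)) ⟩
      (r ℚ.* ((R ℚ.* R ℚ.+ R ℚ.* R) ℚ.* ρ)) ℚ.* ½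
        ≡⟨ solve 3 (λ r R ρ → (r :* ((R :* R :+ R :* R) :* ρ)) :* con ½ := (r :* R) :* (R :* ρ)) refl r R ρ ⟩
      (r ℚ.* R) ℚ.* (R ℚ.* ρ)
        ≡⟨ trans (cong (ℚ._* (R ℚ.* ρ)) r*R) (ℚ.*-identityˡ (R ℚ.* ρ)) ⟩
      R ℚ.* ρ ∎
      where
      open ℚ.≤-Reasoning
      open ℚS
      0≤ρ : 0ℚ ℚ.≤ ρ
      0≤ρ = ℚ.<⇒≤ (0<recip (0<‖z‖⇒0<normSq {z} 0<z))
      N≤ : normSq z ℚ.≤ R ℚ.* R ℚ.+ R ℚ.* R
      N≤ = ℚ.+-mono-≤
        (subst (ℚ._≤ R ℚ.* R) (∣p∣*∣p∣ (real z)) (sq-mono (ℚ.0≤∣p∣ (real z)) x≤R))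
        (subst (ℚ._≤ R ℚ.* R) (∣p∣*∣p∣ (imag z)) (sq-mono (ℚ.0≤∣p∣ (imag z)) y≤R))

    close : ∀ {a b} → b ≡ R ℚ.* ρ → ℚ.∣ a ℚ.- b ∣ ℚ.≤ c → c ℚ.≤ a
    close {a} {b} b≡ a~b = begin
      c                          ≡⟨ solve 1 (λ c → c := (c :+ c) :- c) refl c ⟩
      (c ℚ.+ c) ℚ.- c            ≤⟨ ℚ.+-mono-≤ 2c≤Rρ (ℚ.neg-antimono-≤ a~b) ⟩
      R ℚ.* ρ ℚ.- ℚ.∣ a ℚ.- b ∣  ≡⟨ cong (ℚ._- ℚ.∣ a ℚ.- b ∣) b≡ ⟨
      b ℚ.- ℚ.∣ a ℚ.- b ∣        ≤⟨ q-∣p-q∣≤p a b ⟩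
      a                          ∎
      where
      open ℚ.≤-Reasoning
      open ℚS

    real~ : ℚ.∣ real (f z) ℚ.- real (inv z) ∣ ℚ.≤ c
    real~ = ℚ.≤-trans ∣re∣≤‖ f z -ᴳ inv z ‖ f-t≤c

    imag~ : ℚ.∣ imag (f z) ℚ.- imag (inv z) ∣ ℚ.≤ c
    imag~ = ℚ.≤-trans ∣im∣≤‖ f z -ᴳ inv z ‖ f-t≤c

    neg~ : ∀ a b → ℚ.∣ a ℚ.- b ∣ ℚ.≤ c → ℚ.∣ ℚ.- a ℚ.- ℚ.- b ∣ ℚ.≤ c
    neg~ a b = subst (ℚ._≤ c) (trans (∣p-q∣≡∣q-p∣ a b)
      (cong ℚ.∣_∣ (ℚS.solve 2 (λ a b → b ℚS.:- a ℚS.:= (ℚS.:- a) ℚS.:- (ℚS.:- b)) refl a b)))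

    neg-neg : ∀ {x y} → x ≡ ℚ.- y → ℚ.- (x ℚ.* ρ) ≡ y ℚ.* ρ
    neg-neg {_} {y} refl = ℚS.solve 2 (λ y ρ → ℚS.:- ((ℚS.:- y) ℚS.:* ρ) ℚS.:= y ℚS.:* ρ) refl y ρ

    east : real z ≡ R → c ℚ.≤ real (f z)
    east x≡R = close (cong (ℚ._* ρ) x≡R) real~

    west : real z ≡ ℚ.- R → c ℚ.≤ ℚ.- real (f z)
    west x≡-R = close (neg-neg x≡-R) (neg~ (real (f z)) (real (inv z)) real~)

    south : imag z ≡ ℚ.- R → c ℚ.≤ imag (f z)
    south y≡-R = close (neg-neg y≡-R) imag~

    north : imag z ≡ R → c ℚ.≤ ℚ.- imag (f z)
    north y≡R = close
      (trans (ℚS.solve 2 (λ y ρ → ℚS.:- (ℚS.:- (y ℚS.:* ρ)) ℚS.:= y ℚS.:* ρ) refl (imag z) ρ) (cong (ℚ._* ρ) y≡R))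
      (neg~ (imag (f z)) (imag (inv z)) imag~)

  B : ℚ
  B = fromℕ 12 ℚ.* SmoothOn.C smooth-f

  0≤B : 0ℚ ℚ.≤ B
  0≤B = *-nonNeg (0≤fromℕ 12) (SmoothOn.0≤C smooth-f)

  opaque
    k : ℕ
    -- With m = 2R(k+1) steps of length h = 1/(k+1) along each side, the cells add up to at most m²
    -- B h² = 4BR², while the boundary gives at least 8mc = 4(k+1). Hence k + 1 > BR² is what is
    -- wanted.
    k = floorℕ (B ℚ.* (R ℚ.* R))

    BR²<k+1 : B ℚ.* (R ℚ.* R) ℚ.< fromℕ (suc k)
    BR²<k+1 = <-floor (*-nonNeg 0≤B (*-nonNeg 0≤R 0≤R))

  h : ℚ
  h = 1/suc k

  0≤h : 0ℚ ℚ.≤ h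
  0≤h = ℚ.<⇒≤ (0<1/suc k)

  opaque
    m : ℕ
    m = (suc R′ ℕ.+ suc R′) ℕ.* suc k

    m≡ : fromℕ m ≡ (R ℚ.+ R) ℚ.* fromℕ (suc k)
    m≡ = trans (sym (fromℕ-* (suc R′ ℕ.+ suc R′) (suc k))) (cong (ℚ._* fromℕ (suc k)) (sym (fromℕ-+ (suc R′) (suc R′))))

  m*h : fromℕ m ℚ.* h ≡ R ℚ.+ R
  m*h = trans (cong (ℚ._* h) m≡)
    (trans (ℚS.solve 3 (λ R k h → ((R ℚS.:+ R) ℚS.:* k) ℚS.:* h ℚS.:= (R ℚS.:+ R) ℚS.:* (h ℚS.:* k)) refl R (fromℕ (suc k)) h)
      (trans (cong ((R ℚ.+ R) ℚ.*_) (1/suc*suc k)) (ℚ.*-identityʳ (R ℚ.+ R))))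

  coordinate : ℕ → ℚ
  coordinate a = fromℕ a ℚ.* h ℚ.- R

  coordinate-suc : ∀ a → coordinate (suc a) ≡ coordinate a ℚ.+ h
  coordinate-suc a = trans (cong (λ u → u ℚ.* h ℚ.- R) (sym (fromℕ-+ 1 a)))
    (ℚS.solve 3 (λ a h R → (ℚS.con 1ℚ ℚS.:+ a) ℚS.:* h ℚS.:- R ℚS.:= (a ℚS.:* h ℚS.:- R) ℚS.:+ h) refl (fromℕ a) h R)

  coordinate-0 : coordinate 0 ≡ ℚ.- R
  coordinate-0 = ℚS.solve 2 (λ h R → ℚS.con 0ℚ ℚS.:* h ℚS.:- R ℚS.:= ℚS.:- R) refl h R

  coordinate-m : coordinate m ≡ R
  coordinate-m = trans (cong (ℚ._- R) m*h) (ℚS.solve 1 (λ R → (R ℚS.:+ R) ℚS.:- R ℚS.:= R) refl R)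

  ∣coordinate∣≤R : ∀ {a} → a ℕ.≤ m → ℚ.∣ coordinate a ∣ ℚ.≤ R
  ∣coordinate∣≤R {a} a≤m with ℚ.∣p∣≡p∨∣p∣≡-p (coordinate a)
  ... | inj₁ eq = subst (ℚ._≤ R) (sym eq) (subst (coordinate a ℚ.≤_) coordinate-m
    (ℚ.+-monoˡ-≤ (ℚ.- R) (ℚ.*-monoʳ-≤-nonNeg h {{ℚ.nonNegative 0≤h}} (fromℕ-mono a≤m))))
  ... | inj₂ eq = subst (ℚ._≤ R) (sym eq) (≤-witness (fromℕ a ℚ.* h) (*-nonNeg (0≤fromℕ a) 0≤h)
    (ℚS.solve 2 (λ x R → R ℚS.:= (ℚS.:- (x ℚS.:- R)) ℚS.:+ x) refl (fromℕ a ℚ.* h) R))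

  point : ℕ → ℕ → ℚ[i]
  point a b = gauss (coordinate a) (coordinate b)

  point-e : ∀ a b → point (suc a) b ≡ point a b +ᴳ fromReal h
  point-e a b = cong₂ gauss (coordinate-suc a) (sym (ℚ.+-identityʳ (coordinate b)))

  point-n : ∀ a b → point a (suc b) ≡ point a b +ᴳ iᴳ *ᴳ fromReal h
  point-n a b = trans (cong (gauss (coordinate a)) (coordinate-suc b)) (cong₂ gauss
    (ℚS.solve 2 (λ x h → x ℚS.:= x ℚS.:+ (ℚS.con 0ℚ ℚS.:* h ℚS.:- ℚS.con 1ℚ ℚS.:* ℚS.con 0ℚ)) refl (coordinate a) h)
    (ℚS.solve 2 (λ x h → x ℚS.:+ h ℚS.:= x ℚS.:+ (ℚS.con 0ℚ ℚS.:* ℚS.con 0ℚ ℚS.:+ ℚS.con 1ℚ ℚS.:* h)) refl (coordinate b) h))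

  point-ne : ∀ a b → point (suc a) (suc b) ≡ point a b +ᴳ (1ᴳ +ᴳ iᴳ) *ᴳ fromReal h
  point-ne a b = trans (point-n (suc a) b) (trans (cong (_+ᴳ iᴳ *ᴳ fromReal h) (point-e a b))
    (solve 2 (λ z h → (z :+ h) :+ con iᴳ :* h := z :+ (con 1ᴳ :+ con iᴳ) :* h) refl (point a b) (fromReal h)))
    where open ᴳS

  Found : Set
  Found = ∃[ a ] (a ℕ.< suc m × ∃[ b ] (b ℕ.< suc m × ‖ p (point a b) ‖ ℚ.< ε))

  -- Values of `p` at grid points are Gaussian rationals, so the search decides. Refuting the
  -- negative answer thus yields an actual point, not merely the double negation of its existence.
  found? : Dec Found
  found? = ℕ.anyUpTo? (λ a → ℕ.anyUpTo? (λ b → ‖ p (point a b) ‖ ℚ.<? ε) (suc m)) (suc m)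

  module _ (none : ¬ Found) where

    inside : ∀ {a b} → a ℕ.≤ m → b ℕ.≤ m → P (point a b)
    inside {a} {b} a≤m b≤m =
      ℚ.≤-trans (ℚ.+-mono-≤ (∣coordinate∣≤R a≤m) (∣coordinate∣≤R b≤m))
        (ℚ.≤-reflexive (ℚS.solve 1 (λ R → R ℚS.:+ R ℚS.:= ℚS.con 2ℚ ℚS.:* R) refl R)) ,
      ℚ.≮⇒≥ (λ small → none (a , ℕ.s≤s a≤m , b , ℕ.s≤s b≤m , small))

    F : ℕ → ℕ → ℚ[i]
    F a b = f (point a b)

    ∣R∣ : ∀ {x} → x ≡ R ⊎ x ≡ ℚ.- R → R ℚ.≤ ℚ.∣ x ∣
    ∣R∣ (inj₁ refl) = p≤∣p∣ R
    ∣R∣ (inj₂ refl) = ℚ.≤-trans (p≤∣p∣ R) (ℚ.≤-reflexive (sym (ℚ.∣-p∣≡∣p∣ R)))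

    module AtColumn {a b} (a≤m : a ℕ.≤ m) (b≤m : b ℕ.≤ m) (x=±R : coordinate a ≡ R ⊎ coordinate a ≡ ℚ.- R) =
      Side (inside a≤m b≤m) (∣coordinate∣≤R a≤m) (∣coordinate∣≤R b≤m) (ℚ.≤-trans (∣R∣ x=±R) ∣re∣≤‖ point a b ‖)
    module AtRow {a b} (a≤m : a ℕ.≤ m) (b≤m : b ℕ.≤ m) (y=±R : coordinate b ≡ R ⊎ coordinate b ≡ ℚ.- R) =
      Side (inside a≤m b≤m) (∣coordinate∣≤R a≤m) (∣coordinate∣≤R b≤m) (ℚ.≤-trans (∣R∣ y=±R) ∣im∣≤‖ point a b ‖)

    east′ : ∀ {b} → b ℕ.≤ m → c ℚ.≤ real (F m b)
    east′ b≤m = AtColumn.east ℕ.≤-refl b≤m (inj₁ coordinate-m) coordinate-m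
    west′ : ∀ {b} → b ℕ.≤ m → c ℚ.≤ ℚ.- real (F 0 b)
    west′ b≤m = AtColumn.west ℕ.z≤n b≤m (inj₂ coordinate-0) coordinate-0
    south′ : ∀ {a} → a ℕ.≤ m → c ℚ.≤ imag (F a 0)
    south′ a≤m = AtRow.south a≤m ℕ.z≤n (inj₂ coordinate-0) coordinate-0
    north′ : ∀ {a} → a ℕ.≤ m → c ℚ.≤ ℚ.- imag (F a m)
    north′ a≤m = AtRow.north a≤m ℕ.≤-refl (inj₁ coordinate-m) coordinate-m

    4c : ℚ
    4c = (c ℚ.+ c) ℚ.+ (c ℚ.+ c)

    lower : fromℕ m ℚ.* 4c ℚ.+ fromℕ m ℚ.* 4c ℚ.≤ grid-sum F m
    lower = begin
      fromℕ m ℚ.* 4c ℚ.+ fromℕ m ℚ.* 4c   ≡⟨ cong₂ ℚ._+_ (∑<-const m 4c) (∑<-const m 4c) ⟨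
      ∑< m (λ _ → 4c) ℚ.+ ∑< m (λ _ → 4c)
        ≤⟨ ℚ.+-mono-≤
             (∑<-mono m λ a a<m → ℚ.≤-trans
               (ℚ.+-mono-≤ (ℚ.+-mono-≤ (north′ (ℕ.<⇒≤ a<m)) (north′ a<m)) (ℚ.+-mono-≤ (south′ (ℕ.<⇒≤ a<m)) (south′ a<m)))
               (ℚ.≤-reflexive (solve 4 (λ x y z w → ((:- x) :+ (:- y)) :+ (z :+ w) := (:- (x :+ y)) :- (:- (z :+ w))) refl
                 (imag (F a m)) (imag (F (suc a) m)) (imag (F a 0)) (imag (F (suc a) 0)))))
             (∑<-mono m λ b b<m → ℚ.≤-trans
               (ℚ.+-mono-≤ (ℚ.+-mono-≤ (east′ (ℕ.<⇒≤ b<m)) (east′ b<m)) (ℚ.+-mono-≤ (west′ (ℕ.<⇒≤ b<m)) (west′ b<m)))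
               (ℚ.≤-reflexive (solve 4 (λ x y z w → (x :+ y) :+ ((:- z) :+ (:- w)) := (x :+ y) :- (z :+ w)) refl
                 (real (F m b)) (real (F m (suc b))) (real (F 0 b)) (real (F 0 (suc b)))))) ⟩
      ∑< m (λ a → (ℚ.- (imag (F a m) ℚ.+ imag (F (suc a) m))) ℚ.- (ℚ.- (imag (F a 0) ℚ.+ imag (F (suc a) 0))))
        ℚ.+ ∑< m (λ b → (real (F m b) ℚ.+ real (F m (suc b))) ℚ.- (real (F 0 b) ℚ.+ real (F 0 (suc b))))
        ≡⟨ grid-sum-boundary F m ⟨
      grid-sum F m ∎
      where
      open ℚ.≤-Reasoning
      open ℚS

    cell≤ : ∀ {a b} → a ℕ.< m → b ℕ.< m →
      imag (cell (F a b) (F (suc a) b) (F a (suc b)) (F (suc a) (suc b))) ℚ.≤ B ℚ.* (h ℚ.* h)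
    cell≤ {a} {b} a<m b<m = begin
      imag C                 ≤⟨ p≤∣p∣ (imag C) ⟩
      ℚ.∣ imag C ∣           ≤⟨ ∣im∣≤‖ C ‖ ⟩
      ‖ C ‖
        ≡⟨ cong ‖_‖ (trans (cong₂ (λ u v → cell (F a b) u v (F (suc a) (suc b))) (cong f (point-e a b)) (cong f (point-n a b)))
             (cong (cell (F a b) (f (point a b +ᴳ fromReal h)) (f (point a b +ᴳ iᴳ *ᴳ fromReal h))) (cong f (point-ne a b)))) ⟩
      ‖ cell (F a b) (f (point a b +ᴳ fromReal h)) (f (point a b +ᴳ iᴳ *ᴳ fromReal h)) (f (point a b +ᴳ (1ᴳ +ᴳ iᴳ) *ᴳ fromReal h)) ‖
        ≤⟨ smooth-cell smooth-f 0≤h (inside (ℕ.<⇒≤ a<m) (ℕ.<⇒≤ b<m))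
             (subst P (point-e a b) (inside a<m (ℕ.<⇒≤ b<m)))
             (subst P (point-n a b) (inside (ℕ.<⇒≤ a<m) b<m))
             (subst P (point-ne a b) (inside a<m b<m)) ⟩
      B ℚ.* (h ℚ.* h) ∎
      where
      open ℚ.≤-Reasoning
      C : ℚ[i]
      C = cell (F a b) (F (suc a) b) (F a (suc b)) (F (suc a) (suc b))

    upper : grid-sum F m ℚ.≤ fromℕ m ℚ.* (fromℕ m ℚ.* (B ℚ.* (h ℚ.* h)))
    upper = begin
      grid-sum F m
        ≤⟨ ∑<-mono m (λ a a<m → ∑<-mono m λ b b<m → cell≤ a<m b<m) ⟩
      ∑< m (λ _ → ∑< m (λ _ → B ℚ.* (h ℚ.* h)))
        ≡⟨ trans (∑<-const m _) (cong (fromℕ m ℚ.*_) (∑<-const m (B ℚ.* (h ℚ.* h)))) ⟩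
      fromℕ m ℚ.* (fromℕ m ℚ.* (B ℚ.* (h ℚ.* h))) ∎
      where open ℚ.≤-Reasoning

    m*r : fromℕ m ℚ.* r ≡ 2ℚ ℚ.* fromℕ (suc k)
    m*r = trans (cong (ℚ._* r) m≡)
      (trans (ℚS.solve 3 (λ R k r → ((R ℚS.:+ R) ℚS.:* k) ℚS.:* r ℚS.:= (r ℚS.:* R) ℚS.:* (ℚS.con 2ℚ ℚS.:* k)) refl R (fromℕ (suc k)) r)
        (trans (cong (ℚ._* (2ℚ ℚ.* fromℕ (suc k))) r*R) (ℚ.*-identityˡ _)))

    absurd : 4ℚ ℚ.* fromℕ (suc k) ℚ.≤ 4ℚ ℚ.* (B ℚ.* (R ℚ.* R))
    absurd = begin
      4ℚ ℚ.* fromℕ (suc k)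
        ≡⟨ solve 1 (λ k → con 4ℚ :* k := con 2ℚ :* (con 2ℚ :* k)) refl (fromℕ (suc k)) ⟩
      2ℚ ℚ.* (2ℚ ℚ.* fromℕ (suc k))
        ≡⟨ cong (2ℚ ℚ.*_) m*r ⟨
      2ℚ ℚ.* (fromℕ m ℚ.* r)
        ≡⟨ solve 2 (λ m r → con 2ℚ :* (m :* r) := m :* ((r :* con ¼ :+ r :* con ¼) :+ (r :* con ¼ :+ r :* con ¼))
                        :+ m :* ((r :* con ¼ :+ r :* con ¼) :+ (r :* con ¼ :+ r :* con ¼))) refl (fromℕ m) r ⟩
      fromℕ m ℚ.* 4c ℚ.+ fromℕ m ℚ.* 4c        ≤⟨ lower ⟩
      grid-sum F m                             ≤⟨ upper ⟩
      fromℕ m ℚ.* (fromℕ m ℚ.* (B ℚ.* (h ℚ.* h)))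
        ≡⟨ solve 3 (λ m h B → m :* (m :* (B :* (h :* h))) := B :* ((m :* h) :* (m :* h))) refl (fromℕ m) h B ⟩
      B ℚ.* ((fromℕ m ℚ.* h) ℚ.* (fromℕ m ℚ.* h))
        ≡⟨ cong (λ u → B ℚ.* (u ℚ.* u)) m*h ⟩
      B ℚ.* ((R ℚ.+ R) ℚ.* (R ℚ.+ R))
        ≡⟨ solve 2 (λ B R → B :* ((R :+ R) :* (R :+ R)) := con 4ℚ :* (B :* (R :* R))) refl B R ⟩
      4ℚ ℚ.* (B ℚ.* (R ℚ.* R)) ∎
      where
      open ℚ.≤-Reasoning
      open ℚS

  result : ∃[ z ] ‖ p z ‖ ℚ.< ε
  result = from-dec found?
    where
    from-dec : Dec Found → ∃[ z ] ‖ p z ‖ ℚ.< ε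
    from-dec (yes (a , _ , b , _ , small)) = point a b , small
    from-dec (no none) = contradiction
      (ℚ.≤-<-trans (ℚ.*-cancelˡ-≤-pos 4ℚ (absurd none)) BR²<k+1)
      (ℚ.<-irrefl refl)

approximate-root : ∀ {n} (cs : Vec ℚ[i] (suc n)) {ε} → 0ℚ ℚ.< ε → ∃[ z ] ‖ evalᴳ cs z ‖ ℚ.< ε
approximate-root cs 0<ε = ApproximateRoot.result cs 0<ε

-- Approximate roots near a given point

common-lower-bound : ∀ {p q} → 0ℚ ℚ.< p → 0ℚ ℚ.< q → ∃[ δ ] (0ℚ ℚ.< δ × δ ℚ.≤ p × δ ℚ.≤ q)
common-lower-bound {p} {q} 0<p 0<q = from-total (ℚ.≤-total p q)
  where
  from-total : p ℚ.≤ q ⊎ q ℚ.≤ p → ∃[ δ ] (0ℚ ℚ.< δ × δ ℚ.≤ p × δ ℚ.≤ q)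
  from-total (inj₁ p≤q) = p , 0<p , ℚ.≤-refl , p≤q
  from-total (inj₂ q≤p) = q , 0<q , q≤p , ℚ.≤-refl

infixr 8 _^ℚ_

_^ℚ_ : ℚ → ℕ → ℚ
p ^ℚ zero  = 1ℚ
p ^ℚ suc n = p ℚ.* p ^ℚ n

0<^ℚ : ∀ {p} → 0ℚ ℚ.< p → ∀ n → 0ℚ ℚ.< p ^ℚ n
0<^ℚ 0<p zero    = ℚ.positive⁻¹ 1ℚ
0<^ℚ 0<p (suc n) = *-pos 0<p (0<^ℚ 0<p n)

p≤1+p² : ∀ p → p ℚ.≤ 1ℚ ℚ.+ p ℚ.* p
p≤1+p² p = ≤-witness ((p ℚ.- ½) ℚ.* (p ℚ.- ½) ℚ.+ fromℕ 3 ℚ.* ¼)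
  (0≤p+q (0≤p*p (p ℚ.- ½)) (*-nonNeg (0≤fromℕ 3) (ℚ.<⇒≤ (0<1/suc 3))))
  (solve 1 (λ p → con 1ℚ :+ p :* p := p :+ ((p :- con ½) :* (p :- con ½) :+ con (fromℕ 3) :* con ¼)) refl p)
  where open ℚS

sq-cancel-≤ : ∀ {p q} → 0ℚ ℚ.≤ q → p ℚ.* p ℚ.≤ q ℚ.* q → p ℚ.≤ q
sq-cancel-≤ {p} {q} 0≤q p²≤q² = ℚ.≮⇒≥ λ q<p → ℚ.<-irrefl refl (ℚ.<-≤-trans
  (ℚ.≤-<-trans (ℚ.*-monoˡ-≤-nonNeg q {{ℚ.nonNegative 0≤q}} (ℚ.<⇒≤ q<p))
    (ℚ.*-monoˡ-<-pos p {{ℚ.positive (ℚ.≤-<-trans 0≤q q<p)}} q<p)) p²≤q²)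

-- A crude bound obtained from x ≤ 1 + x² in order to avoid square roots; it only has to confine z
-- to some disc.
normSq<⇒‖z‖≤ : ∀ z {s} → normSq z ℚ.< s → ‖ z ‖ ℚ.≤ 1ℚ ℚ.+ 2ℚ ℚ.* s
normSq<⇒‖z‖≤ z {s} N<s = ℚ.≤-trans (p≤1+p² ‖ z ‖) (ℚ.+-monoʳ-≤ 1ℚ
  (ℚ.≤-trans (‖z‖²≤2normSq z) (ℚ.*-monoˡ-≤-nonNeg 2ℚ (ℚ.<⇒≤ N<s))))

-- Continuity of `normSq` at u with an explicit modulus: it lets a strict bound on |p(z₀)|² survive
-- the subtraction of the small value p(a).
normSq-perturb : ∀ u v → ‖ v ‖ ℚ.≤ 1ℚ → normSq (u -ᴳ v) ℚ.≤ normSq u ℚ.+ (1ℚ ℚ.+ 2ℚ ℚ.* ‖ u ‖) ℚ.* ‖ v ‖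
normSq-perturb u@(gauss a b) v@(gauss c d) v≤1 = begin
  normSq (u -ᴳ v)
    ≡⟨ solve 4 (λ a b c d → (a :- c) :* (a :- c) :+ (b :- d) :* (b :- d)
         := (a :* a :+ b :* b) :+ ((c :* c :+ d :* d) :+ con 2ℚ :* (:- (a :* c :+ b :* d)))) refl a b c d ⟩
  normSq u ℚ.+ (normSq v ℚ.+ 2ℚ ℚ.* (ℚ.- (a ℚ.* c ℚ.+ b ℚ.* d)))
    ≤⟨ ℚ.+-monoʳ-≤ (normSq u) (ℚ.+-mono-≤ N≤ (ℚ.*-monoˡ-≤-nonNeg 2ℚ dot≤)) ⟩
  normSq u ℚ.+ (‖ v ‖ ℚ.+ 2ℚ ℚ.* (‖ u ‖ ℚ.* ‖ v ‖))
    ≡⟨ solve 3 (λ n x y → n :+ (y :+ con 2ℚ :* (x :* y)) := n :+ (con 1ℚ :+ con 2ℚ :* x) :* y) refl (normSq u) ‖ u ‖ ‖ v ‖ ⟩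
  normSq u ℚ.+ (1ℚ ℚ.+ 2ℚ ℚ.* ‖ u ‖) ℚ.* ‖ v ‖ ∎
  where
  open ℚ.≤-Reasoning
  open ℚS
  N≤ : normSq v ℚ.≤ ‖ v ‖
  N≤ = ℚ.≤-trans (normSq≤‖z‖² v) (ℚ.≤-trans
    (ℚ.*-monoˡ-≤-nonNeg ‖ v ‖ {{ℚ.nonNegative 0≤‖ v ‖}} v≤1) (ℚ.≤-reflexive (ℚ.*-identityʳ ‖ v ‖)))
  dot≤ : ℚ.- (a ℚ.* c ℚ.+ b ℚ.* d) ℚ.≤ ‖ u ‖ ℚ.* ‖ v ‖
  dot≤ = begin
    ℚ.- (a ℚ.* c ℚ.+ b ℚ.* d)
      ≡⟨ solve 4 (λ a b c d → :- (a :* c :+ b :* d) := (:- a) :* c :- b :* d) refl a b c d ⟩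
    real (gauss (ℚ.- a) b *ᴳ v)        ≤⟨ p≤∣p∣ _ ⟩
    ℚ.∣ real (gauss (ℚ.- a) b *ᴳ v) ∣  ≤⟨ ∣re∣≤‖ gauss (ℚ.- a) b *ᴳ v ‖ ⟩
    ‖ gauss (ℚ.- a) b *ᴳ v ‖           ≤⟨ ‖z*w‖≤ (gauss (ℚ.- a) b) v ⟩
    ‖ gauss (ℚ.- a) b ‖ ℚ.* ‖ v ‖      ≡⟨ cong (λ t → (t ℚ.+ ℚ.∣ b ∣) ℚ.* ‖ v ‖) (ℚ.∣-p∣≡∣p∣ a) ⟩
    ‖ u ‖ ℚ.* ‖ v ‖ ∎

eval-difference : ∀ {n} (cs : Vec ℚ[i] (suc n)) a z → evalᴳ cs z -ᴳ evalᴳ cs a ≡ (z -ᴳ a) *ᴳ evalᴳ (quotientᴳ a cs) z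
eval-difference cs a z = trans
  (solve 4 (λ x y a e → x :- y := (x :+ a :* e) :- (y :+ a :* e)) refl (evalᴳ cs z) (evalᴳ cs a) a e)
  (trans (cong (_-ᴳ (evalᴳ cs a +ᴳ a *ᴳ e)) (evalᴳ-quotientᴳ a cs z))
    (solve 4 (λ y a z e → (y :+ z :* e) :- (y :+ a :* e) := (z :- a) :* e) refl (evalᴳ cs a) a z e))
  where
  open ᴳS
  e : ℚ[i]
  e = evalᴳ (quotientᴳ a cs) z

-- If |p(z₀)|² < sⁿ then an (approximate) root lies within distance √s of z₀: split off an
-- approximate root a; unless a is close to z₀, the cofactor q of X - a satisfies |q(z₀)|² < sⁿ⁻¹.
approximate-root-near : ∀ {n} (cs : Vec ℚ[i] n) z₀ {s ε} → 0ℚ ℚ.< s → 0ℚ ℚ.< ε →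
  normSq (evalᴳ cs z₀) ℚ.< s ^ℚ n → ∃[ z ] (normSq (z -ᴳ z₀) ℚ.< s × ‖ evalᴳ cs z ‖ ℚ.< ε)
approximate-root-near [] z₀ 0<s 0<ε 1<1 = contradiction 1<1 (ℚ.<-irrefl refl)
approximate-root-near {suc n} cs@(_ ∷ _) z₀ {s} {ε} 0<s 0<ε N<sⁿ = from-dec (normSq (a -ᴳ z₀) ℚ.<? s)
  where
  u : ℚ[i]
  u = evalᴳ cs z₀
  W : ℚ
  W = 1ℚ ℚ.+ 2ℚ ℚ.* ‖ u ‖
  0<W : 0ℚ ℚ.< W
  0<W = ℚ.+-mono-<-≤ (ℚ.positive⁻¹ 1ℚ) (*-nonNeg (0≤fromℕ 2) 0≤‖ u ‖)
  -- How much p(a) may disturb |p(z₀)|² before it reaches sⁿ⁺¹; `W` is the factor from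
  -- `normSq-perturb`.
  slack : ∃[ δ ] (0ℚ ℚ.< δ × W ℚ.* δ ≡ s ^ℚ suc n ℚ.- normSq u)
  slack = divide 0<W (0<q-p N<sⁿ)
  small₁ : ∃[ δ ] (0ℚ ℚ.< δ × δ ℚ.≤ 1ℚ × δ ℚ.≤ proj₁ slack)
  small₁ = common-lower-bound (ℚ.positive⁻¹ 1ℚ) (proj₁ (proj₂ slack))
  small₂ : ∃[ δ ] (0ℚ ℚ.< δ × δ ℚ.≤ proj₁ small₁ × δ ℚ.≤ ½ ℚ.* ε)
  small₂ = common-lower-bound (proj₁ (proj₂ small₁)) (half-pos 0<ε)
  η : ℚ
  η = proj₁ small₂
  root : ∃[ a ] ‖ evalᴳ cs a ‖ ℚ.< η
  root = approximate-root cs (proj₁ (proj₂ small₂))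
  a v : ℚ[i]
  a = proj₁ root
  v = evalᴳ cs a
  v<η : ‖ v ‖ ℚ.< η
  v<η = proj₂ root
  v<½ε : ‖ v ‖ ℚ.< ½ ℚ.* ε
  v<½ε = ℚ.<-≤-trans v<η (proj₂ (proj₂ (proj₂ small₂)))
  v<1∧slack : ‖ v ‖ ℚ.< proj₁ small₁
  v<1∧slack = ℚ.<-≤-trans v<η (proj₁ (proj₂ (proj₂ small₂)))
  qs : Vec ℚ[i] n
  qs = quotientᴳ a cs
  -- `K` bounds ‖z - a‖ for all z within √s of z₀, so p(z) = p(a) + (z - a) q(z) stays below ε once
  -- ‖q(z)‖ < ε/(2K).
  K : ℚ
  K = (1ℚ ℚ.+ 2ℚ ℚ.* s) ℚ.+ ‖ z₀ -ᴳ a ‖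
  0<K : 0ℚ ℚ.< K
  0<K = ℚ.+-mono-<-≤ (ℚ.+-mono-<-≤ (ℚ.positive⁻¹ 1ℚ) (*-nonNeg (0≤fromℕ 2) (ℚ.<⇒≤ 0<s))) 0≤‖ z₀ -ᴳ a ‖
  ε/K : ∃[ δ ] (0ℚ ℚ.< δ × K ℚ.* δ ≡ ½ ℚ.* ε)
  ε/K = divide 0<K (half-pos 0<ε)

  N[u-v]<sⁿ : normSq (u -ᴳ v) ℚ.< s ^ℚ suc n
  N[u-v]<sⁿ = begin-strict
    normSq (u -ᴳ v)                       ≤⟨ normSq-perturb u v (ℚ.<⇒≤ (ℚ.<-≤-trans v<1∧slack (proj₁ (proj₂ (proj₂ small₁))))) ⟩
    normSq u ℚ.+ W ℚ.* ‖ v ‖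
      <⟨ ℚ.+-monoʳ-< (normSq u) (ℚ.*-monoʳ-<-pos W {{ℚ.positive 0<W}} (ℚ.<-≤-trans v<1∧slack (proj₂ (proj₂ (proj₂ small₁))))) ⟩
    normSq u ℚ.+ W ℚ.* proj₁ slack        ≡⟨ cong (normSq u ℚ.+_) (proj₂ (proj₂ slack)) ⟩
    normSq u ℚ.+ (s ^ℚ suc n ℚ.- normSq u)
      ≡⟨ solve 2 (λ x y → x :+ (y :- x) := y) refl (normSq u) (s ^ℚ suc n) ⟩
    s ^ℚ suc n ∎
    where
    open ℚ.≤-Reasoning
    open ℚS

  -- p(z₀) - p(a) = (z₀ - a) q(z₀), so two large factors would give a large product. This needs
  -- exact multiplicativity, hence `normSq`; the norm ‖·‖ is only submultiplicative.
  N[q]<sⁿ : s ℚ.≤ normSq (z₀ -ᴳ a) → normSq (evalᴳ qs z₀) ℚ.< s ^ℚ n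
  N[q]<sⁿ s≤N = ℚ.≰⇒> λ sⁿ≤ → ℚ.<-irrefl refl (ℚ.<-≤-trans N[u-v]<sⁿ
    (subst (s ^ℚ suc n ℚ.≤_) (sym (trans (cong normSq (eval-difference cs a z₀)) (normSq-* (z₀ -ᴳ a) (evalᴳ qs z₀))))
      (*-mono-≤ (ℚ.<⇒≤ 0<s) s≤N (ℚ.<⇒≤ (0<^ℚ 0<s n)) sⁿ≤)))

  p<ε : ∀ z → normSq (z -ᴳ z₀) ℚ.< s → ‖ evalᴳ qs z ‖ ℚ.< proj₁ ε/K → ‖ evalᴳ cs z ‖ ℚ.< ε
  p<ε z z~z₀ q<ε = begin-strict
    ‖ evalᴳ cs z ‖
      ≡⟨ cong ‖_‖ (trans (solve 2 (λ x y → x := y :+ (x :- y)) refl (evalᴳ cs z) v) (cong (v +ᴳ_) (eval-difference cs a z))) ⟩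
    ‖ v +ᴳ (z -ᴳ a) *ᴳ evalᴳ qs z ‖
      ≤⟨ ‖+‖≤ {v} {(z -ᴳ a) *ᴳ evalᴳ qs z} ℚ.≤-refl
           (‖*‖≤ {z -ᴳ a} {evalᴳ qs z} z-a≤K (ℚ.<⇒≤ q<ε)) ⟩
    ‖ v ‖ ℚ.+ K ℚ.* proj₁ ε/K      ≡⟨ cong (‖ v ‖ ℚ.+_) (proj₂ (proj₂ ε/K)) ⟩
    ‖ v ‖ ℚ.+ ½ ℚ.* ε              <⟨ ℚ.+-monoˡ-< (½ ℚ.* ε) v<½ε ⟩
    ½ ℚ.* ε ℚ.+ ½ ℚ.* ε            ≡⟨ halves ε ⟩
    ε                              ∎
    where
    open ℚ.≤-Reasoning
    open ᴳS
    z-a≤K : ‖ z -ᴳ a ‖ ℚ.≤ K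
    z-a≤K = subst (λ t → ‖ t ‖ ℚ.≤ K) (solve 3 (λ z z₀ a → (z :- z₀) :+ (z₀ :- a) := z :- a) refl z z₀ a)
      (‖+‖≤ {z -ᴳ z₀} {z₀ -ᴳ a} (normSq<⇒‖z‖≤ (z -ᴳ z₀) z~z₀) ℚ.≤-refl)

  normSq-sym : ∀ z w → normSq (z -ᴳ w) ≡ normSq (w -ᴳ z)
  normSq-sym (gauss a b) (gauss c d) = solve 4 (λ a b c d →
    (a :- c) :* (a :- c) :+ (b :- d) :* (b :- d) := (c :- a) :* (c :- a) :+ (d :- b) :* (d :- b)) refl a b c d
    where open ℚS

  from-dec : Dec (normSq (a -ᴳ z₀) ℚ.< s) → ∃[ z ] (normSq (z -ᴳ z₀) ℚ.< s × ‖ evalᴳ cs z ‖ ℚ.< ε)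
  from-dec (yes a~z₀) = a , a~z₀ , ℚ.<-≤-trans v<½ε
    (≤-witness (½ ℚ.* ε) (ℚ.<⇒≤ (half-pos 0<ε)) (sym (halves ε)))
  from-dec (no a≁z₀) =
    let z , z~z₀ , q<ε = approximate-root-near qs z₀ {s} 0<s (proj₁ (proj₂ ε/K))
          (N[q]<sⁿ (subst (s ℚ.≤_) (normSq-sym a z₀) (ℚ.≮⇒≥ a≁z₀)))
    in z , z~z₀ , p<ε z z~z₀ q<ε

-- Complex numbers as sequences of Gaussian rationals

at : ℂ → ℕ → ℚ[i]
at z n = gauss (seq (re z) n) (seq (im z) n)

record Null (s : ℕ → ℚ[i]) : Set where
  constructor mkNull
  field eventually-< : ∀ ε → 0ℚ ℚ.< ε → ∃[ N ] (∀ n → N ℕ.≤ n → ‖ s n ‖ ℚ.< ε)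
open Null public

record Bounded (s : ℕ → ℚ[i]) : Set where
  constructor mkBounded
  field eventually-≤ : ∃[ B ] (0ℚ ℚ.< B × ∃[ N ] (∀ n → N ℕ.≤ n → ‖ s n ‖ ℚ.≤ B))
open Bounded public

null-≡ : ∀ {s t} → (∀ n → s n ≡ t n) → Null s → Null t
null-≡ s≗t null .eventually-< ε 0<ε = let N , s<ε = eventually-< null ε 0<ε in
  N , λ n N≤n → subst (λ u → ‖ u ‖ ℚ.< ε) (s≗t n) (s<ε n N≤n)

null-0 : Null (λ _ → 0ᴳ)
null-0 .eventually-< ε 0<ε = 0 , λ _ _ → 0<ε

null-neg : ∀ {s} → Null s → Null (λ n → -ᴳ s n)
null-neg {s} null .eventually-< ε 0<ε = let N , s<ε = eventually-< null ε 0<ε in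
  N , λ n N≤n → subst (ℚ._< ε) (sym (‖-z‖ (s n))) (s<ε n N≤n)

null-+ : ∀ {s t} → Null s → Null t → Null (λ n → s n +ᴳ t n)
null-+ {s} {t} null-s null-t .eventually-< ε 0<ε =
  let M , s< = eventually-< null-s (½ ℚ.* ε) (half-pos 0<ε)
      N , t< = eventually-< null-t (½ ℚ.* ε) (half-pos 0<ε)
  in M ℕ.⊔ N , λ n ≤n → subst (‖ s n +ᴳ t n ‖ ℚ.<_) (halves ε)
    (ℚ.≤-<-trans (‖z+w‖≤ (s n) (t n))
      (ℚ.+-mono-< (s< n (ℕ.m⊔n≤o⇒m≤o M N ≤n)) (t< n (ℕ.m⊔n≤o⇒n≤o M N ≤n))))

null-* : ∀ {s t} → Bounded s → Null t → Null (λ n → s n *ᴳ t n)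
null-* {s} {t} (mkBounded (B , 0<B , M , s≤B)) null .eventually-< ε 0<ε =
  let δ , 0<δ , Bδ≡ε = divide 0<B 0<ε
      N , t<         = eventually-< null δ 0<δ
  in M ℕ.⊔ N , λ n ≤n → begin-strict
    ‖ s n *ᴳ t n ‖       ≤⟨ ‖*‖≤ {s n} {t n} (s≤B n (ℕ.m⊔n≤o⇒m≤o M N ≤n)) ℚ.≤-refl ⟩
    B ℚ.* ‖ t n ‖        <⟨ ℚ.*-monoʳ-<-pos B {{ℚ.positive 0<B}} (t< n (ℕ.m⊔n≤o⇒n≤o M N ≤n)) ⟩
    B ℚ.* δ              ≡⟨ Bδ≡ε ⟩
    ε                    ∎
  where open ℚ.≤-Reasoning

opaque
  bounded : ∀ z → Bounded (at z)
  bounded z .eventually-≤ =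
    let B , 0<B , M , x≤B = cauchy⇒bounded {seq (re z)} (isCauchy (re z))
        C , 0<C , N , y≤C = cauchy⇒bounded {seq (im z)} (isCauchy (im z))
    in B ℚ.+ C , ℚ.+-mono-< {0ℚ} {B} {0ℚ} 0<B 0<C , M ℕ.⊔ N , λ n ≤n →
      ℚ.+-mono-≤ (x≤B n (ℕ.m⊔n≤o⇒m≤o M N ≤n)) (y≤C n (ℕ.m⊔n≤o⇒n≤o M N ≤n))

limit : (z : ℕ → ℚ[i]) → (∀ ε → 0ℚ ℚ.< ε → ∃[ N ] (∀ m n → N ℕ.≤ m → N ℕ.≤ n → ‖ z m -ᴳ z n ‖ ℚ.< ε)) → ℂ
limit z cauchy =
  mkℝ (λ m → real (z m)) (λ ε 0<ε → let N , z< = cauchy ε 0<ε in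
    N , λ m n ≤m ≤n → ℚ.≤-<-trans ∣re∣≤‖ z m -ᴳ z n ‖ (z< m n ≤m ≤n)) +i
  mkℝ (λ m → imag (z m)) (λ ε 0<ε → let N , z< = cauchy ε 0<ε in
    N , λ m n ≤m ≤n → ℚ.≤-<-trans ∣im∣≤‖ z m -ᴳ z n ‖ (z< m n ≤m ≤n))

-- The relation _≃ℂ_, as a data type so that Agda can read z and w off it.
infix 4 _≈ℂ_

record _≈ℂ_ (z w : ℂ) : Set where
  constructor mk≈
  field null : Null (λ n → at z n -ᴳ at w n)
open _≈ℂ_ public

≃⇒≈ : ∀ {z w} → z ≃ℂ w → z ≈ℂ w
≃⇒≈ {z} {w} (re≃ , im≃) .null .eventually-< ε 0<ε =
  let M , x< = re≃ (½ ℚ.* ε) (half-pos 0<ε)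
      N , y< = im≃ (½ ℚ.* ε) (half-pos 0<ε)
  in M ℕ.⊔ N , λ n ≤n → subst (‖ at z n -ᴳ at w n ‖ ℚ.<_) (halves ε)
    (ℚ.+-mono-< (x< n (ℕ.m⊔n≤o⇒m≤o M N ≤n)) (y< n (ℕ.m⊔n≤o⇒n≤o M N ≤n)))

≈⇒≃ : ∀ {z w} → z ≈ℂ w → z ≃ℂ w
≈⇒≃ {z} {w} (mk≈ null) =
  (λ ε 0<ε → let N , <ε = eventually-< null ε 0<ε in N , λ n ≤n → ℚ.≤-<-trans ∣re∣≤‖ at z n -ᴳ at w n ‖ (<ε n ≤n)) ,
  (λ ε 0<ε → let N , <ε = eventually-< null ε 0<ε in N , λ n ≤n → ℚ.≤-<-trans ∣im∣≤‖ at z n -ᴳ at w n ‖ (<ε n ≤n))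

-- The operations on ℂ act term by term, so the ring laws are inherited from ℚ(i) at every index;
-- limits enter only in the congruence rules and in the equivalence relation.
pointwise : ∀ {z w} → (∀ n → at z n ≡ at w n) → z ≈ℂ w
pointwise {z} {w} z≗w = mk≈ (null-≡ (λ n → trans (sym (ᴳ.-‿inverseʳ (at w n))) (cong (_-ᴳ at w n) (sym (z≗w n)))) null-0)

-ℂ_ : ℂ → ℂ
-ℂ z = (-ℝ re z) +i (-ℝ im z)

1ℂ : ℂ
1ℂ = 1ℝ +i 0ℝ

+-*-ℂ-commutativeRing : CommutativeRing 0ℓ 0ℓ
+-*-ℂ-commutativeRing = record
  { Carrier = ℂ ; _≈_ = _≈ℂ_ ; _+_ = _+ℂ_ ; _*_ = _*ℂ_ ; -_ = -ℂ_ ; 0# = 0ℂ ; 1# = 1ℂ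
  ; isCommutativeRing = record
    { isRing = record
      { +-isAbelianGroup = record
        { isGroup = record
          { isMonoid = record
            { isSemigroup = record
              { isMagma = record
                { isEquivalence = record
                  { refl  = pointwise λ _ → refl
                  ; sym   = λ {z} {w} z≈w → mk≈ (null-≡
                      (λ n → solve 2 (λ z w → :- (z :- w) := w :- z) refl (at z n) (at w n)) (null-neg (null z≈w)))
                  ; trans = λ {z} {w} {v} z≈w w≈v → mk≈ (null-≡
                      (λ n → solve 3 (λ z w v → (z :- w) :+ (w :- v) := z :- v) refl (at z n) (at w n) (at v n))
                      (null-+ (null z≈w) (null w≈v))) }
                ; ∙-cong = λ {z} {z′} {w} {w′} z≈ w≈ → mk≈ (null-≡
                    (λ n → solve 4 (λ a b c d → (a :- b) :+ (c :- d) := (a :+ c) :- (b :+ d)) refl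
                             (at z n) (at z′ n) (at w n) (at w′ n))
                    (null-+ (null z≈) (null w≈))) }
              ; assoc = λ z w v → pointwise λ n → ᴳ.+-assoc (at z n) (at w n) (at v n) }
            ; identity = (λ z → pointwise λ n → ᴳ.+-identityˡ (at z n))
                       , (λ z → pointwise λ n → ᴳ.+-identityʳ (at z n)) }
          ; inverse = (λ z → pointwise λ n → ᴳ.-‿inverseˡ (at z n))
                    , (λ z → pointwise λ n → ᴳ.-‿inverseʳ (at z n))
          ; ⁻¹-cong = λ {z} {w} z≈w → mk≈ (null-≡
              (λ n → solve 2 (λ z w → :- (z :- w) := (:- z) :- (:- w)) refl (at z n) (at w n)) (null-neg (null z≈w))) }
        ; comm = λ z w → pointwise λ n → ᴳ.+-comm (at z n) (at w n) }
      ; *-cong = λ {z} {z′} {w} {w′} z≈ w≈ → mk≈ (null-≡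
          (λ n → solve 4 (λ a b c d → a :* (c :- d) :+ d :* (a :- b) := a :* c :- b :* d) refl
                   (at z n) (at z′ n) (at w n) (at w′ n))
          (null-+ (null-* (bounded z) (null w≈)) (null-* (bounded w′) (null z≈))))
      ; *-assoc = λ z w v → pointwise λ n → ᴳ.*-assoc (at z n) (at w n) (at v n)
      ; *-identity = (λ z → pointwise λ n → ᴳ.*-identityˡ (at z n))
                   , (λ z → pointwise λ n → ᴳ.*-identityʳ (at z n))
      ; distrib = (λ z w v → pointwise λ n → ᴳ.distribˡ (at z n) (at w n) (at v n))
                , (λ z w v → pointwise λ n → ᴳ.distribʳ (at z n) (at w n) (at v n)) }
    ; *-comm = λ z w → pointwise λ n → ᴳ.*-comm (at z n) (at w n) } }
  where open ᴳS

module ℂR = CommutativeRing +-*-ℂ-commutativeRing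

open Monic +-*-ℂ-commutativeRing using () renaming (eval to evalℂ)

-- The fundamental theorem of algebra

approximation : ∀ {n} → ℕ → Vec ℂ n → Vec ℚ[i] n
approximation m = Vec.map (λ c → at c m)

at-eval : ∀ {n} (cs : Vec ℂ n) z m → at (evalℂ cs z) m ≡ evalᴳ (approximation m cs) (at z m)
at-eval []       z m = refl
at-eval (c ∷ cs) z m = cong (λ e → at c m +ᴳ at z m *ᴳ e) (at-eval cs z m)

at-cauchy : ∀ c ε → 0ℚ ℚ.< ε → ∃[ N ] (∀ m n → N ℕ.≤ m → N ℕ.≤ n → ‖ at c m -ᴳ at c n ‖ ℚ.< ε)
at-cauchy c ε 0<ε =
  let M , x< = isCauchy (re c) (½ ℚ.* ε) (half-pos 0<ε)
      N , y< = isCauchy (im c) (½ ℚ.* ε) (half-pos 0<ε)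
  in M ℕ.⊔ N , λ m n ≤m ≤n → subst (‖ at c m -ᴳ at c n ‖ ℚ.<_) (halves ε)
    (ℚ.+-mono-< (x< m n (ℕ.m⊔n≤o⇒m≤o M N ≤m) (ℕ.m⊔n≤o⇒m≤o M N ≤n))
                (y< m n (ℕ.m⊔n≤o⇒n≤o M N ≤m) (ℕ.m⊔n≤o⇒n≤o M N ≤n)))

module OnDisc {K} (0<K : 0ℚ ℚ.< K) where

  private
    0≤K : 0ℚ ℚ.≤ K
    0≤K = ℚ.<⇒≤ 0<K

  open ℚ.≤-Reasoning

  -- `N` must be uniform over the disc: the point at which the estimate is applied is found from one
  -- approximation whose index already depends on `N`.
  eval-cauchy : ∀ {n} (cs : Vec ℂ n) ε → 0ℚ ℚ.< ε → ∃[ N ] (∀ l m → N ℕ.≤ l → N ℕ.≤ m → ∀ z → ‖ z ‖ ℚ.≤ K →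
    ‖ evalᴳ (approximation l cs) z -ᴳ evalᴳ (approximation m cs) z ‖ ℚ.< ε)
  eval-cauchy []       ε 0<ε = 0 , λ _ _ _ _ _ _ → 0<ε
  eval-cauchy (c ∷ cs) ε 0<ε =
    let M , c<         = at-cauchy c (½ ℚ.* ε) (half-pos 0<ε)
        δ , 0<δ , Kδ≡  = divide 0<K (half-pos 0<ε)
        N , cs<        = eval-cauchy cs δ 0<δ
    in M ℕ.⊔ N , λ l m ≤l ≤m z z≤K →
      let E : ℕ → ℚ[i]
          E k = evalᴳ (approximation k cs) z
      in begin-strict
        ‖ (at c l +ᴳ z *ᴳ E l) -ᴳ (at c m +ᴳ z *ᴳ E m) ‖
          ≡⟨ cong ‖_‖ (solve 5 (λ a b z e f → (a :+ z :* e) :- (b :+ z :* f) := (a :- b) :+ z :* (e :- f)) refl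
               (at c l) (at c m) z (E l) (E m)) ⟩
        ‖ (at c l -ᴳ at c m) +ᴳ z *ᴳ (E l -ᴳ E m) ‖
          ≤⟨ ‖+‖≤ {at c l -ᴳ at c m} {z *ᴳ (E l -ᴳ E m)} ℚ.≤-refl
               (‖*‖≤ {z} {E l -ᴳ E m} z≤K
                 (ℚ.<⇒≤ (cs< l m (ℕ.m⊔n≤o⇒n≤o M N ≤l) (ℕ.m⊔n≤o⇒n≤o M N ≤m) z z≤K))) ⟩
        ‖ at c l -ᴳ at c m ‖ ℚ.+ K ℚ.* δ
          ≡⟨ cong (‖ at c l -ᴳ at c m ‖ ℚ.+_) Kδ≡ ⟩
        ‖ at c l -ᴳ at c m ‖ ℚ.+ ½ ℚ.* ε
          <⟨ ℚ.+-monoˡ-< (½ ℚ.* ε) (c< l m (ℕ.m⊔n≤o⇒m≤o M N ≤l) (ℕ.m⊔n≤o⇒m≤o M N ≤m)) ⟩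
        ½ ℚ.* ε ℚ.+ ½ ℚ.* ε
          ≡⟨ halves ε ⟩
        ε ∎
    where open ᴳS

  eval-bounded : ∀ {n} (cs : Vec ℂ n) → ∃[ B ] (0ℚ ℚ.≤ B × ∃[ N ] (∀ m → N ℕ.≤ m → ∀ z → ‖ z ‖ ℚ.≤ K →
    ‖ evalᴳ (approximation m cs) z ‖ ℚ.≤ B))
  eval-bounded []       = 1ℚ , 0≤1 , 0 , λ _ _ _ _ → ℚ.≤-refl
  eval-bounded (c ∷ cs) =
    let C , 0<C , M , c≤  = eventually-≤ (bounded c)
        B , 0≤B , N , cs≤ = eval-bounded cs
    in C ℚ.+ K ℚ.* B , 0≤p+q (ℚ.<⇒≤ 0<C) (*-nonNeg 0≤K 0≤B) , M ℕ.⊔ N , λ m ≤m z z≤K →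
      ‖+‖≤ {at c m} {z *ᴳ evalᴳ (approximation m cs) z} (c≤ m (ℕ.m⊔n≤o⇒m≤o M N ≤m))
        (‖*‖≤ {z} {evalᴳ (approximation m cs) z} z≤K (cs≤ m (ℕ.m⊔n≤o⇒n≤o M N ≤m) z z≤K))

  -- One constant serves all late approximations, so moving the point and improving the coefficients
  -- can be done simultaneously.
  eval-lipschitz : ∀ {n} (cs : Vec ℂ n) → ∃[ L ] (0ℚ ℚ.≤ L × ∃[ N ] (∀ m → N ℕ.≤ m →
    ∀ z w → ‖ z ‖ ℚ.≤ K → ‖ w ‖ ℚ.≤ K →
    ‖ evalᴳ (approximation m cs) z -ᴳ evalᴳ (approximation m cs) w ‖ ℚ.≤ L ℚ.* ‖ z -ᴳ w ‖))
  eval-lipschitz []       = 0ℚ , ℚ.≤-refl , 0 , λ _ _ z w _ _ →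
    ℚ.≤-reflexive (sym (ℚ.*-zeroˡ ‖ z -ᴳ w ‖))
  eval-lipschitz (c ∷ cs) =
    let B , 0≤B , M , cs≤  = eval-bounded cs
        L , 0≤L , N , lip  = eval-lipschitz cs
    in K ℚ.* L ℚ.+ B , 0≤p+q (*-nonNeg 0≤K 0≤L) 0≤B , M ℕ.⊔ N , λ m ≤m z w z≤K w≤K →
      let E : ℚ[i] → ℚ[i]
          E = evalᴳ (approximation m cs)
          d : ℚ
          d = ‖ z -ᴳ w ‖
      in begin
        ‖ (at c m +ᴳ z *ᴳ E z) -ᴳ (at c m +ᴳ w *ᴳ E w) ‖
          ≡⟨ cong ‖_‖ (solve 5 (λ c z w e f → (c :+ z :* e) :- (c :+ w :* f) := z :* (e :- f) :+ f :* (z :- w)) refl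
               (at c m) z w (E z) (E w)) ⟩
        ‖ z *ᴳ (E z -ᴳ E w) +ᴳ E w *ᴳ (z -ᴳ w) ‖
          ≤⟨ ‖+‖≤ {z *ᴳ (E z -ᴳ E w)} {E w *ᴳ (z -ᴳ w)}
               (‖*‖≤ {z} {E z -ᴳ E w} z≤K (lip m (ℕ.m⊔n≤o⇒n≤o M N ≤m) z w z≤K w≤K))
               (‖*‖≤ {E w} {z -ᴳ w} (cs≤ m (ℕ.m⊔n≤o⇒m≤o M N ≤m) w w≤K) ℚ.≤-refl) ⟩
        K ℚ.* (L ℚ.* d) ℚ.+ B ℚ.* d
          ≡⟨ ℚS.solve 4 (λ K L B d → K ℚS.:* (L ℚS.:* d) ℚS.:+ B ℚS.:* d ℚS.:= (K ℚS.:* L ℚS.:+ B) ℚS.:* d) refl K L B d ⟩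
        (K ℚ.* L ℚ.+ B) ℚ.* d ∎
    where open ᴳS

½^k≤1/suc : ∀ k → ½ ^ℚ k ℚ.≤ 1/suc k
½^k≤1/suc k = ℚ.*-cancelʳ-≤-pos (fromℕ (suc k)) {{ℚ.positive (0<fromℕ-suc k)}}
  (ℚ.≤-trans (½^k*suc≤1 k) (ℚ.≤-reflexive (sym (1/suc*suc k))))
  where
  open ℚ.≤-Reasoning
  open ℚS
  ½^k*suc≤1 : ∀ k → ½ ^ℚ k ℚ.* fromℕ (suc k) ℚ.≤ 1ℚ
  ½^k*suc≤1 zero    = ℚ.≤-refl
  ½^k*suc≤1 (suc k) = begin
    (½ ℚ.* ½ ^ℚ k) ℚ.* fromℕ (suc (suc k))
      ≤⟨ ≤-witness ((½ ℚ.* ½ ^ℚ k) ℚ.* fromℕ k)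
           (*-nonNeg (ℚ.<⇒≤ (half-pos (0<^ℚ (half-pos (ℚ.positive⁻¹ 1ℚ)) k))) (0≤fromℕ k))
           (trans (cong (½ ^ℚ k ℚ.*_) (sym (fromℕ-+ 1 k)))
             (trans (solve 2 (λ h k → h :* (con 1ℚ :+ k) := (con ½ :* h) :* (con 2ℚ :+ k) :+ (con ½ :* h) :* k) refl (½ ^ℚ k) (fromℕ k))
               (cong (λ t → (½ ℚ.* ½ ^ℚ k) ℚ.* t ℚ.+ (½ ℚ.* ½ ^ℚ k) ℚ.* fromℕ k) (fromℕ-+ 2 k)))) ⟩
    ½ ^ℚ k ℚ.* fromℕ (suc k)  ≤⟨ ½^k*suc≤1 k ⟩
    1ℚ ∎

1≤p⇒1≤p^n : ∀ {p} → 1ℚ ℚ.≤ p → ∀ n → 1ℚ ℚ.≤ p ^ℚ n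
1≤p⇒1≤p^n 1≤p zero    = ℚ.≤-refl
1≤p⇒1≤p^n 1≤p (suc n) = *-mono-≤ 0≤1 1≤p 0≤1 (1≤p⇒1≤p^n 1≤p n)

module Root {n} (cs : Vec ℂ (suc n)) where

  p : ℕ → ℚ[i] → ℚ[i]
  p m = evalᴳ (approximation m cs)

  open OnDisc (ℚ.positive⁻¹ 1ℚ) using (eval-bounded)

  opaque
    bound : ∃[ B ] (0ℚ ℚ.≤ B × ∃[ N ] (∀ m → N ℕ.≤ m → ‖ p m 0ᴳ ‖ ℚ.≤ B))
    bound = let B , 0≤B , N , p≤ = eval-bounded cs in B , 0≤B , N , λ m N≤m → p≤ m N≤m 0ᴳ 0≤1

  -- The added 1 makes ‖p m 0‖ < σ strict for late m and gives σ ≥ 1, so that σ² ≤ (σ²)ⁿ⁺¹ and the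
  -- iteration can start at 0.
  σ : ℚ
  σ = proj₁ bound ℚ.+ 1ℚ

  1≤σ : 1ℚ ℚ.≤ σ
  1≤σ = ≤-witness (proj₁ bound) (proj₁ (proj₂ bound)) (ℚ.+-comm (proj₁ bound) 1ℚ)

  0<σ : 0ℚ ℚ.< σ
  0<σ = ℚ.<-≤-trans (ℚ.positive⁻¹ 1ℚ) 1≤σ

  g : ℕ → ℚ
  g k = σ ℚ.* ½ ^ℚ k

  0<g : ∀ k → 0ℚ ℚ.< g k
  0<g k = *-pos 0<σ (0<^ℚ (half-pos (ℚ.positive⁻¹ 1ℚ)) k)

  g-small : ∀ ε → 0ℚ ℚ.< ε → ∃[ k ] g k ℚ.< ε
  g-small ε 0<ε =
    let δ , 0<δ , σδ≡ = divide 0<σ (half-pos 0<ε)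
        N , 1/suc≤δ   = archimedean 0<δ
    in N , (begin-strict
      σ ℚ.* ½ ^ℚ N  ≤⟨ ℚ.*-monoˡ-≤-nonNeg σ {{ℚ.nonNegative (ℚ.<⇒≤ 0<σ)}} (ℚ.≤-trans (½^k≤1/suc N) (1/suc≤δ N ℕ.≤-refl)) ⟩
      σ ℚ.* δ       ≡⟨ σδ≡ ⟩
      ½ ℚ.* ε       <⟨ <-witness (½ ℚ.* ε) (half-pos 0<ε) (sym (halves ε)) ⟩
      ε             ∎)
    where open ℚ.≤-Reasoning

  -- The first bound is the hypothesis of `approximate-root-near` with s = (g k)², which puts the
  -- next point within distance g k; the second is the residual that tends to 0. Both hold for all
  -- late `m`, so the next step may choose any sufficiently good approximation.
  Good : ℕ → ℚ[i] → Set
  Good k z = ∃[ M ] (∀ m → M ℕ.≤ m → normSq (p m z) ℚ.< (g k ℚ.* g k) ^ℚ suc n × ‖ p m z ‖ ℚ.< g k)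

  good-0 : Good 0 0ᴳ
  good-0 = proj₁ (proj₂ (proj₂ bound)) , λ m ≤m → let p<σ = p0<σ m ≤m in
    N<σ² m p<σ , subst (‖ p m 0ᴳ ‖ ℚ.<_) (sym (ℚ.*-identityʳ σ)) p<σ
    where
    p0<σ : ∀ m → proj₁ (proj₂ (proj₂ bound)) ℕ.≤ m → ‖ p m 0ᴳ ‖ ℚ.< σ
    p0<σ m ≤m = ℚ.≤-<-trans (proj₂ (proj₂ (proj₂ bound)) m ≤m) (<-witness 1ℚ (ℚ.positive⁻¹ 1ℚ) refl)
    g0 : σ ≡ g 0
    g0 = sym (ℚ.*-identityʳ σ)
    N<σ² : ∀ m → ‖ p m 0ᴳ ‖ ℚ.< σ → normSq (p m 0ᴳ) ℚ.< (g 0 ℚ.* g 0) ^ℚ suc n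
    N<σ² m p<σ = begin-strict
      normSq (p m 0ᴳ)                ≤⟨ normSq≤‖z‖² (p m 0ᴳ) ⟩
      ‖ p m 0ᴳ ‖ ℚ.* ‖ p m 0ᴳ ‖      ≤⟨ ℚ.*-monoʳ-≤-nonNeg ‖ p m 0ᴳ ‖ {{ℚ.nonNegative 0≤‖ p m 0ᴳ ‖}} (ℚ.<⇒≤ p<σ) ⟩
      σ ℚ.* ‖ p m 0ᴳ ‖               <⟨ ℚ.*-monoʳ-<-pos σ {{ℚ.positive 0<σ}} p<σ ⟩
      σ ℚ.* σ                        ≡⟨ ℚ.*-identityʳ (σ ℚ.* σ) ⟨
      (σ ℚ.* σ) ℚ.* 1ℚ
        ≤⟨ ℚ.*-monoˡ-≤-nonNeg (σ ℚ.* σ) {{ℚ.nonNegative (0≤p*p σ)}} (1≤p⇒1≤p^n (*-mono-≤ 0≤1 1≤σ 0≤1 1≤σ) n) ⟩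
      (σ ℚ.* σ) ^ℚ suc n             ≡⟨ cong (λ t → (t ℚ.* t) ^ℚ suc n) g0 ⟩
      (g 0 ℚ.* g 0) ^ℚ suc n         ∎
      where open ℚ.≤-Reasoning

  opaque
    step : ∀ k z → Good k z → ∃[ z′ ] (normSq (z′ -ᴳ z) ℚ.< g k ℚ.* g k × Good (suc k) z′)
    step k z (M , good) =
      -- τ lies below 1 and below both bounds demanded by `Good (suc k)`. One half is spent on the
      -- approximate root of the l-th polynomial, the other on passing from l to later indices.
      let τ , 0<τ , τ≤ , τ≤1 = common-lower-bound {proj₁ min} {1ℚ} (proj₁ (proj₂ min)) (ℚ.positive⁻¹ 1ℚ)
          N , cauchy   = OnDisc.eval-cauchy 0<K cs (½ ℚ.* τ) (half-pos 0<τ)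
          l            = M ℕ.⊔ N
          z′ , near , small = approximate-root-near (approximation l cs) z (*-pos (0<g k) (0<g k)) (half-pos 0<τ)
                                (proj₁ (good l (ℕ.m≤m⊔n M N)))
          p<τ : ∀ m → N ℕ.≤ m → ‖ p m z′ ‖ ℚ.< τ
          p<τ m N≤m = subst (‖ p m z′ ‖ ℚ.<_) (halves τ) (ℚ.≤-<-trans
            (subst (λ t → ‖ t ‖ ℚ.≤ ‖ p l z′ ‖ ℚ.+ ‖ p m z′ -ᴳ p l z′ ‖)
              (ᴳS.solve 2 (λ a b → a ᴳS.:+ (b ᴳS.:- a) ᴳS.:= b) refl (p l z′) (p m z′))
              (‖z+w‖≤ (p l z′) (p m z′ -ᴳ p l z′)))
            (ℚ.+-mono-< small (cauchy m l N≤m (ℕ.m≤n⊔m M N) z′ (z′≤K z′ near))))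
      in z′ , near , N , λ m N≤m → N<τ (p m z′) τ≤1 (ℚ.≤-trans τ≤ (proj₁ (proj₂ (proj₂ min)))) (p<τ m N≤m)
           , ℚ.<-≤-trans (p<τ m N≤m) (ℚ.≤-trans τ≤ (proj₂ (proj₂ (proj₂ min))))
      where
      s′ᵈ : ℚ
      s′ᵈ = (g (suc k) ℚ.* g (suc k)) ^ℚ suc n
      min : ∃[ δ ] (0ℚ ℚ.< δ × δ ℚ.≤ s′ᵈ × δ ℚ.≤ g (suc k))
      min = common-lower-bound (0<^ℚ (*-pos (0<g (suc k)) (0<g (suc k))) (suc n)) (0<g (suc k))
      K : ℚ
      K = (1ℚ ℚ.+ 2ℚ ℚ.* (g k ℚ.* g k)) ℚ.+ ‖ z ‖
      0<K : 0ℚ ℚ.< K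
      0<K = ℚ.+-mono-<-≤ (ℚ.+-mono-<-≤ (ℚ.positive⁻¹ 1ℚ) (*-nonNeg (0≤fromℕ 2) (0≤p*p (g k)))) 0≤‖ z ‖
      z′≤K : ∀ z′ → normSq (z′ -ᴳ z) ℚ.< g k ℚ.* g k → ‖ z′ ‖ ℚ.≤ K
      z′≤K z′ near = subst (λ t → ‖ t ‖ ℚ.≤ K) (ᴳS.solve 2 (λ z w → (w ᴳS.:- z) ᴳS.:+ z ᴳS.:= w) refl z z′)
        (‖+‖≤ {z′ -ᴳ z} {z} (normSq<⇒‖z‖≤ (z′ -ᴳ z) near) ℚ.≤-refl)
      N<τ : ∀ {τ} v → τ ℚ.≤ 1ℚ → τ ℚ.≤ s′ᵈ → ‖ v ‖ ℚ.< τ → normSq v ℚ.< s′ᵈ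
      N<τ {τ} v τ≤1 τ≤s v<τ = begin-strict
        normSq v             ≤⟨ normSq≤‖z‖² v ⟩
        ‖ v ‖ ℚ.* ‖ v ‖      ≤⟨ ℚ.*-monoˡ-≤-nonNeg ‖ v ‖ {{ℚ.nonNegative 0≤‖ v ‖}} (ℚ.<⇒≤ (ℚ.<-≤-trans v<τ τ≤1)) ⟩
        ‖ v ‖ ℚ.* 1ℚ         ≡⟨ ℚ.*-identityʳ ‖ v ‖ ⟩
        ‖ v ‖                <⟨ v<τ ⟩
        τ                    ≤⟨ τ≤s ⟩
        s′ᵈ                  ∎
        where open ℚ.≤-Reasoning

  state : ∀ k → Σ ℚ[i] (Good k)
  state zero    = 0ᴳ , good-0
  state (suc k) = let z′ , _ , good = step k (proj₁ (state k)) (proj₂ (state k)) in z′ , good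

  z : ℕ → ℚ[i]
  z k = proj₁ (state k)

  -- The distance is below g k in modulus, hence below √2 times g k in ‖·‖; √2 is rounded up to 2 to
  -- remain rational.
  z-step : ∀ k → ‖ z (suc k) -ᴳ z k ‖ ℚ.≤ 2ℚ ℚ.* g k
  z-step k = sq-cancel-≤ (*-nonNeg (0≤fromℕ 2) (ℚ.<⇒≤ (0<g k))) (begin
    ‖ z (suc k) -ᴳ z k ‖ ℚ.* ‖ z (suc k) -ᴳ z k ‖     ≤⟨ ‖z‖²≤2normSq (z (suc k) -ᴳ z k) ⟩
    2ℚ ℚ.* normSq (z (suc k) -ᴳ z k)
      ≤⟨ ℚ.*-monoˡ-≤-nonNeg 2ℚ (ℚ.<⇒≤ (proj₁ (proj₂ (step k (proj₁ (state k)) (proj₂ (state k)))))) ⟩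
    2ℚ ℚ.* (g k ℚ.* g k)
      ≤⟨ ≤-witness (2ℚ ℚ.* (g k ℚ.* g k)) (*-nonNeg (0≤fromℕ 2) (0≤p*p (g k)))
           (ℚS.solve 1 (λ g → (ℚS.con 2ℚ ℚS.:* g) ℚS.:* (ℚS.con 2ℚ ℚS.:* g)
              ℚS.:= ℚS.con 2ℚ ℚS.:* (g ℚS.:* g) ℚS.:+ ℚS.con 2ℚ ℚS.:* (g ℚS.:* g)) refl (g k)) ⟩
    (2ℚ ℚ.* g k) ℚ.* (2ℚ ℚ.* g k) ∎)
    where open ℚ.≤-Reasoning

  -- As g halves at each step, 2 g(i) = 4 g(i) - 4 g(i+1), and the bounds from `z-step` telescope.
  z-drift : ∀ j k → ‖ z (j ℕ.+ k) -ᴳ z k ‖ ℚ.≤ 4ℚ ℚ.* g k ℚ.- 4ℚ ℚ.* g (j ℕ.+ k)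
  z-drift zero    k = ℚ.≤-reflexive (trans (cong ‖_‖ (ᴳ.-‿inverseʳ (z k))) (sym (ℚ.+-inverseʳ (4ℚ ℚ.* g k))))
  z-drift (suc j) k = begin
    ‖ z (suc (j ℕ.+ k)) -ᴳ z k ‖
      ≡⟨ cong ‖_‖ (ᴳS.solve 3 (λ a b c → a ᴳS.:- c ᴳS.:= (a ᴳS.:- b) ᴳS.:+ (b ᴳS.:- c)) refl
           (z (suc (j ℕ.+ k))) (z (j ℕ.+ k)) (z k)) ⟩
    ‖ (z (suc (j ℕ.+ k)) -ᴳ z (j ℕ.+ k)) +ᴳ (z (j ℕ.+ k) -ᴳ z k) ‖
      ≤⟨ ‖+‖≤ {z (suc (j ℕ.+ k)) -ᴳ z (j ℕ.+ k)} {z (j ℕ.+ k) -ᴳ z k} (z-step (j ℕ.+ k)) (z-drift j k) ⟩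
    2ℚ ℚ.* g (j ℕ.+ k) ℚ.+ (4ℚ ℚ.* g k ℚ.- 4ℚ ℚ.* g (j ℕ.+ k))
      ≡⟨ ℚS.solve 3 (λ s h G → ℚS.con 2ℚ ℚS.:* (s ℚS.:* h) ℚS.:+ (ℚS.con 4ℚ ℚS.:* G ℚS.:- ℚS.con 4ℚ ℚS.:* (s ℚS.:* h))
             ℚS.:= ℚS.con 4ℚ ℚS.:* G ℚS.:- ℚS.con 4ℚ ℚS.:* (s ℚS.:* (ℚS.con ½ ℚS.:* h))) refl σ (½ ^ℚ (j ℕ.+ k)) (g k) ⟩
    4ℚ ℚ.* g k ℚ.- 4ℚ ℚ.* g (suc (j ℕ.+ k)) ∎
    where open ℚ.≤-Reasoning

  z-close : ∀ {k m} → k ℕ.≤ m → ‖ z m -ᴳ z k ‖ ℚ.≤ 4ℚ ℚ.* g k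
  z-close {k} {m} k≤m = subst (λ l → ‖ z l -ᴳ z k ‖ ℚ.≤ 4ℚ ℚ.* g k) (ℕ.m∸n+n≡m k≤m)
    (ℚ.≤-trans (z-drift (m ℕ.∸ k) k)
      (≤-witness (4ℚ ℚ.* g j) (*-nonNeg (0≤fromℕ 4) (ℚ.<⇒≤ (0<g j)))
        (ℚS.solve 2 (λ a b → a ℚS.:= (a ℚS.:- b) ℚS.:+ b) refl (4ℚ ℚ.* g k) (4ℚ ℚ.* g j))))
    where
    j : ℕ
    j = m ℕ.∸ k ℕ.+ k

  8ℚ : ℚ
  8ℚ = fromℕ 8

  z-cauchy : ∀ ε → 0ℚ ℚ.< ε → ∃[ N ] (∀ m n → N ℕ.≤ m → N ℕ.≤ n → ‖ z m -ᴳ z n ‖ ℚ.< ε)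
  z-cauchy ε 0<ε =
    let N , g< = g-small (1/suc 7 ℚ.* ε) (*-pos (0<1/suc 7) 0<ε)
    in N , λ m n N≤m N≤n → begin-strict
      ‖ z m -ᴳ z n ‖
        ≡⟨ cong ‖_‖ (ᴳS.solve 3 (λ a b c → a ᴳS.:- b ᴳS.:= (a ᴳS.:- c) ᴳS.:- (b ᴳS.:- c)) refl (z m) (z n) (z N)) ⟩
      ‖ (z m -ᴳ z N) -ᴳ (z n -ᴳ z N) ‖
        ≤⟨ ‖-‖≤ {z m -ᴳ z N} {z n -ᴳ z N} (z-close N≤m) (z-close N≤n) ⟩
      4ℚ ℚ.* g N ℚ.+ 4ℚ ℚ.* g N
        ≡⟨ ℚS.solve 1 (λ g → ℚS.con 4ℚ ℚS.:* g ℚS.:+ ℚS.con 4ℚ ℚS.:* g ℚS.:= ℚS.con 8ℚ ℚS.:* g) refl (g N) ⟩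
      8ℚ ℚ.* g N                    <⟨ ℚ.*-monoʳ-<-pos 8ℚ g< ⟩
      8ℚ ℚ.* (1/suc 7 ℚ.* ε)
        ≡⟨ ℚS.solve 1 (λ e → ℚS.con 8ℚ ℚS.:* (ℚS.con (1/suc 7) ℚS.:* e) ℚS.:= e) refl ε ⟩
      ε ∎
    where open ℚ.≤-Reasoning

  ζ : ℂ
  ζ = limit z z-cauchy

  K : ℚ
  K = 4ℚ ℚ.* g 0

  0<K : 0ℚ ℚ.< K
  0<K = *-pos (0<fromℕ-suc 3) (0<g 0)

  z≤K : ∀ m → ‖ z m ‖ ℚ.≤ K
  z≤K m = subst (λ t → ‖ t ‖ ℚ.≤ K) (ᴳS.solve 1 (λ z → z ᴳS.:- ᴳS.con 0ᴳ ᴳS.:= z) refl (z m)) (z-close {0} {m} ℕ.z≤n)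

  root : evalℂ cs ζ ≈ℂ 0ℂ
  root = mk≈ (null-≡ (λ m → sym (trans (ᴳS.solve 1 (λ x → x ᴳS.:- ᴳS.con 0ᴳ ᴳS.:= x) refl (at (evalℂ cs ζ) m)) (at-eval cs ζ m)))
    -- The m-th term of p(ζ) is p m (z m), but `Good k` controls p m at z k, from an index depending
    -- on k. So k is fixed first and z m is compared with z k by the Lipschitz bound, giving g k + L
    -- · 4 g k = W g k.
    (mkNull λ ε 0<ε →
      let L , 0≤L , N , lip = OnDisc.eval-lipschitz 0<K cs
          W = 1ℚ ℚ.+ 4ℚ ℚ.* L
          0<W : 0ℚ ℚ.< W
          0<W = ℚ.+-mono-<-≤ (ℚ.positive⁻¹ 1ℚ) (*-nonNeg (0≤fromℕ 4) 0≤L)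
          δ , 0<δ , Wδ≡ε = divide 0<W 0<ε
          k , g<δ        = g-small δ 0<δ
          M , good       = proj₂ (state k)
      in k ℕ.⊔ (M ℕ.⊔ N) , λ m ≤m →
        let k≤m = ℕ.m⊔n≤o⇒m≤o k (M ℕ.⊔ N) ≤m
            M≤m = ℕ.m⊔n≤o⇒m≤o M N (ℕ.m⊔n≤o⇒n≤o k (M ℕ.⊔ N) ≤m)
            N≤m = ℕ.m⊔n≤o⇒n≤o M N (ℕ.m⊔n≤o⇒n≤o k (M ℕ.⊔ N) ≤m)
        in begin-strict
          ‖ p m (z m) ‖
            ≡⟨ cong ‖_‖ (ᴳS.solve 2 (λ a b → a ᴳS.:= b ᴳS.:+ (a ᴳS.:- b)) refl (p m (z m)) (p m (z k))) ⟩
          ‖ p m (z k) +ᴳ (p m (z m) -ᴳ p m (z k)) ‖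
            ≤⟨ ‖+‖≤ {p m (z k)} {p m (z m) -ᴳ p m (z k)} (ℚ.<⇒≤ (proj₂ (good m M≤m)))
                 (ℚ.≤-trans (lip m N≤m (z m) (z k) (z≤K m) (z≤K k))
                   (ℚ.*-monoˡ-≤-nonNeg L {{ℚ.nonNegative 0≤L}} (z-close k≤m))) ⟩
          g k ℚ.+ L ℚ.* (4ℚ ℚ.* g k)
            ≡⟨ ℚS.solve 2 (λ g L → g ℚS.:+ L ℚS.:* (ℚS.con 4ℚ ℚS.:* g) ℚS.:= (ℚS.con 1ℚ ℚS.:+ ℚS.con 4ℚ ℚS.:* L) ℚS.:* g) refl (g k) L ⟩
          W ℚ.* g k         <⟨ ℚ.*-monoʳ-<-pos W {{ℚ.positive 0<W}} g<δ ⟩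
          W ℚ.* δ           ≡⟨ Wδ≡ε ⟩
          ε                 ∎))
    where open ℚ.≤-Reasoning

opaque
  fundamental-theorem-of-algebra : ∀ {n} (cs : Vec ℂ (suc n)) → ∃[ z ] evalℂ cs z ≈ℂ 0ℂ
  fundamental-theorem-of-algebra cs = Root.ζ cs , Root.root cs

-- The double negation monad

infixl 1 _>>=_

_>>=_ : ∀ {a b} {A : Set a} {B : Set b} → ¬ ¬ A → (A → ¬ ¬ B) → ¬ ¬ B
(¬¬a >>= f) ¬b = ¬¬a λ a → f a ¬b

pure : ∀ {a} {A : Set a} → A → ¬ ¬ A
pure a ¬a = ¬a a

-- Linear algebra over a commutative ring

module LinearAlgebra {c ℓ} (R : CommutativeRing c ℓ) where
  open CommutativeRing R renaming (Carrier to A; refl to ≈-refl; sym to ≈-sym; trans to ≈-trans)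
  open import Relation.Binary.Reasoning.Setoid setoid
  open SemiringSum semiring
  open RingProperties ring using (-‿distribˡ-*) renaming (x∙y⁻¹≈ε⇒x≈y to x-y≈0⇒x≈y)
  open Monic R
  open NaturalCoefficients commutativeSemiring

  apply : ∀ {m n} → (Fin m → Fin n → A) → Vector A n → Vector A m
  apply M v i = sum λ j → M i j * v j

  apply-linear : ∀ {m n} (M : Fin m → Fin n → A) a u w i →
    apply M (λ j → a * u j + w j) i ≈ a * apply M u i + apply M w i
  apply-linear M a u w i = begin
    sum (λ j → M i j * (a * u j + w j))
      ≈⟨ sum-cong-≋ (λ j → solve 4 (λ m a u w → m :* (a :* u :+ w) := a :* (m :* u) :+ m :* w) ≈-refl (M i j) a (u j) (w j)) ⟩
    sum (λ j → a * (M i j * u j) + M i j * w j)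
      ≈⟨ ∑-distrib-+ (λ j → a * (M i j * u j)) (λ j → M i j * w j) ⟩
    sum (λ j → a * (M i j * u j)) + apply M w i
      ≈⟨ +-congʳ (*-distribˡ-sum a (λ j → M i j * u j)) ⟨
    a * apply M u i + apply M w i ∎

  scale-eigenvector : ∀ {n} (M : Fin n → Fin n → A) {μ v} w → (∀ i → apply M v i ≈ μ * v i) →
    ∀ i → apply M (λ j → w * v j) i ≈ μ * (w * v i)
  scale-eigenvector M {μ} {v} w Mv≈μv i = begin
    apply M (λ j → w * v j) i
      ≈⟨ sum-cong-≋ (λ j → solve 3 (λ m w v → m :* (w :* v) := w :* (m :* v)) ≈-refl (M i j) w (v j)) ⟩
    sum (λ j → w * (M i j * v j))   ≈⟨ *-distribˡ-sum w (λ j → M i j * v j) ⟨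
    w * apply M v i                 ≈⟨ *-congˡ (Mv≈μv i) ⟩
    w * (μ * v i)                   ≈⟨ solve 3 (λ w μ v → w :* (μ :* v) := μ :* (w :* v)) ≈-refl w μ (v i) ⟩
    μ * (w * v i)                   ∎

  combine-cong : ∀ {d} (cs : Vec A d) {x y} → (∀ k → x k ≈ y k) → combine cs x ≈ combine cs y
  combine-cong []       x≈y = x≈y 0
  combine-cong (c ∷ cs) x≈y = +-cong (*-congˡ (x≈y 0)) (combine-cong cs λ k → x≈y (suc k))

  combine-zero : ∀ {d} (cs : Vec A d) {x} → (∀ k → x k ≈ 0#) → combine cs x ≈ 0#
  combine-zero []       x≈0 = x≈0 0
  combine-zero (c ∷ cs) x≈0 = ≈-trans
    (+-cong (≈-trans (*-congˡ (x≈0 0)) (zeroʳ c)) (combine-zero cs λ k → x≈0 (suc k))) (+-identityˡ 0#)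

  combine-linear : ∀ {d} (cs : Vec A d) x y a →
    combine cs (λ k → x k + y k * a) ≈ combine cs x + combine cs y * a
  combine-linear []       x y a = ≈-refl
  combine-linear (c ∷ cs) x y a = begin
    c * (x 0 + y 0 * a) + combine cs (λ k → x (suc k) + y (suc k) * a)
      ≈⟨ +-congˡ (combine-linear cs (λ k → x (suc k)) (λ k → y (suc k)) a) ⟩
    c * (x 0 + y 0 * a) + (X + Y * a)
      ≈⟨ solve 6 (λ c x y a X Y → c :* (x :+ y :* a) :+ (X :+ Y :* a) := (c :* x :+ X) :+ (c :* y :+ Y) :* a) ≈-refl
           c (x 0) (y 0) a X Y ⟩
    (c * x 0 + X) + (c * y 0 + Y) * a ∎
    where
    X Y : A
    X = combine cs (λ k → x (suc k))
    Y = combine cs (λ k → y (suc k))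

  apply-combine : ∀ {m n d} (M : Fin m → Fin n → A) (cs : Vec A d) (x : ℕ → Vector A n) i →
    apply M (λ j → combine cs (λ k → x k j)) i ≈ combine cs (λ k → apply M (x k) i)
  apply-combine M []       x i = ≈-refl
  apply-combine M (c ∷ cs) x i = ≈-trans
    (apply-linear M c (x 0) (λ j → combine cs (λ k → x (suc k) j)) i)
    (+-congˡ (apply-combine M cs (λ k → x (suc k)) i))

  -- With xₖ = Mᵏ v: if p = (X - a) q and p(M) v = 0, then (M - a) q(M) v = 0.
  quotient-eigenvector : ∀ {n d} (M : Fin n → Fin n → A) (cs : Vec A (suc d)) a (x : ℕ → Vector A n) →
    (∀ k i → x (suc k) i ≈ apply M (x k) i) → (∀ i → combine cs (λ k → x k i) ≈ 0#) → eval cs a ≈ 0# →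
    let u = λ i → combine (quotient a cs) (λ k → x k i) in ∀ i → apply M u i ≈ a * u i
  quotient-eigenvector M cs a x x-step relation root i = begin
    apply M u i                                            ≈⟨ apply-combine M q x i ⟩
    combine q (λ k → apply M (x k) i)                      ≈⟨ combine-cong q (λ k → x-step k i) ⟨
    combine q (λ k → x (suc k) i)                          ≈⟨ +-identityˡ _ ⟨
    0# + combine q (λ k → x (suc k) i)                     ≈⟨ +-congʳ (≈-trans (*-congʳ root) (zeroˡ _)) ⟨
    eval cs a * x 0 i + combine q (λ k → x (suc k) i)      ≈⟨ combine-quotient a cs (λ k → x k i) ⟨
    combine cs (λ k → x k i) + a * u i                     ≈⟨ +-congʳ (relation i) ⟩
    0# + a * u i                                           ≈⟨ +-identityˡ _ ⟩
    a * u i ∎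
    where
    q : Vec A _
    q = quotient a cs
    u : Vector A _
    u i = combine q (λ k → x k i)

  -- Gaussian elimination of coordinate k from x₁ , x₂ , … by means of x₀.
  module Eliminate {n} (x : ℕ → Vector A (suc n)) (k : Fin (suc n)) (w : A) (x₀w≈1 : x 0 k * w ≈ 1#) where

    α : ℕ → A
    α i = - (x (suc i) k * w)

    eliminated : ℕ → Vector A n
    eliminated i j = x (suc i) (punchIn k j) + α i * x 0 (punchIn k j)

    -- Coordinate k of xᵢ₊₁ + αᵢ x₀ vanishes by the choice of αᵢ, so the relation extends to all
    -- coordinates. Collecting the multiples of x₀ produces the new lowest coefficient and leaves
    -- the leading 1 untouched.
    eliminated-relation : ∀ {d} (cs : Vec A d) → (∀ j → combine cs (λ i → eliminated i j) ≈ 0#) →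
      ∀ l → combine (combine cs α ∷ cs) (λ i → x i l) ≈ 0#
    eliminated-relation cs relation l = begin
      combine cs α * x 0 l + combine cs (λ i → x (suc i) l)      ≈⟨ +-comm _ _ ⟩
      combine cs (λ i → x (suc i) l) + combine cs α * x 0 l
        ≈⟨ combine-linear cs (λ i → x (suc i) l) α (x 0 l) ⟨
      combine cs (λ i → x (suc i) l + α i * x 0 l)               ≈⟨ at-coordinate (k Fin.≟ l) ⟩
      0# ∎
      where
      at-coordinate : Dec (k ≡ l) → combine cs (λ i → x (suc i) l + α i * x 0 l) ≈ 0#
      at-coordinate (yes refl) = combine-zero cs λ i → begin
        x (suc i) k + α i * x 0 k                 ≈⟨ +-congˡ (-‿distribˡ-* _ _) ⟨
        x (suc i) k + - (x (suc i) k * w * x 0 k)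
          ≈⟨ +-congˡ (-‿cong (≈-trans (solve 3 (λ x w y → x :* w :* y := x :* (y :* w)) ≈-refl (x (suc i) k) w (x 0 k))
               (≈-trans (*-congˡ x₀w≈1) (*-identityʳ _)))) ⟩
        x (suc i) k + - x (suc i) k               ≈⟨ -‿inverseʳ _ ⟩
        0# ∎
      at-coordinate (no k≢l) = subst (λ l → combine cs (λ i → x (suc i) l + α i * x 0 l) ≈ 0#)
        (Fin.punchIn-punchOut k≢l) (relation (punchOut k≢l))

  trace² : ∀ {n} → (Fin n → Fin n → A) → A
  trace² M = sum λ i → sum λ j → M i j * M j i

  sum²-+ : ∀ {m n} (f g : Fin m → Fin n → A) →
    sum (λ i → sum λ j → f i j + g i j) ≈ sum (λ i → sum (f i)) + sum (λ i → sum (g i))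
  sum²-+ f g = ≈-trans (sum-cong-≋ λ i → ∑-distrib-+ (f i) (g i)) (∑-distrib-+ (λ i → sum (f i)) (λ i → sum (g i)))

  -- The matrix induced on the quotient by an eigenvector v with v k = 1, in the basis of the eⱼ with j ≠ k.
  module Deflate {n} (M : Fin (suc n) → Fin (suc n) → A) (k : Fin (suc n)) (v : Vector A (suc n)) (μ : A)
                 (vk≈1 : v k ≈ 1#) (Mv≈μv : ∀ i → apply M v i ≈ μ * v i) where

    a : A
    a = M k k
    b : Fin n → Fin n → A
    b i j = M (punchIn k i) (punchIn k j)
    row column v⁻ : Vector A n
    row j = M k (punchIn k j)
    column i = M (punchIn k i) k
    v⁻ i = - v (punchIn k i)

    -- Since v k = 1, modulo v the vector eₖ equals the sum of the - v j eⱼ over j ≠ k. Substituting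
    -- this for the component `row j` of M eⱼ along eₖ gives the correction term.
    deflated : Fin n → Fin n → A
    deflated i j = b i j + v⁻ i * row j

    row-v : ∀ i → M i k + sum (λ j → M i (punchIn k j) * v (punchIn k j)) ≈ μ * v i
    row-v i = begin
      M i k + sum (λ j → M i (punchIn k j) * v (punchIn k j))
        ≈⟨ +-congʳ (≈-trans (≈-sym (*-identityʳ _)) (*-congˡ (≈-sym vk≈1))) ⟩
      M i k * v k + sum (λ j → M i (punchIn k j) * v (punchIn k j))
        ≈⟨ sum-remove {i = k} (λ j → M i j * v j) ⟨
      apply M v i  ≈⟨ Mv≈μv i ⟩
      μ * v i      ∎

    -- The i-th eigenvector equation solved for M i k. Treating the negated coordinates `v⁻` as
    -- atoms keeps the later computations within commutative semirings.
    row-v⁻ : ∀ i → sum (λ j → M i (punchIn k j) * v⁻ j) + μ * v i ≈ M i k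
    row-v⁻ i = begin
      S⁻ + μ * v i      ≈⟨ +-congˡ (row-v i) ⟨
      S⁻ + (M i k + S)  ≈⟨ solve 3 (λ x y z → x :+ (y :+ z) := y :+ (x :+ z)) ≈-refl S⁻ (M i k) S ⟩
      M i k + (S⁻ + S)
        ≈⟨ +-congˡ (≈-trans (≈-sym (∑-distrib-+ (λ j → M i (punchIn k j) * v⁻ j) (λ j → M i (punchIn k j) * v (punchIn k j))))
             (≈-trans (sum-cong-≋ {n} {λ j → M i (punchIn k j) * v⁻ j + M i (punchIn k j) * v (punchIn k j)} {λ _ → 0#} λ j →
                 ≈-trans (≈-sym (distribˡ _ _ _)) (≈-trans (*-congˡ (-‿inverseˡ _)) (zeroʳ _)))
               (sum-replicate-zero n))) ⟩
      M i k + 0#        ≈⟨ +-identityʳ _ ⟩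
      M i k             ∎
      where
      S S⁻ : A
      S = sum λ j → M i (punchIn k j) * v (punchIn k j)
      S⁻ = sum λ j → M i (punchIn k j) * v⁻ j

    s β-sum P S : A
    s = sum λ j → row j * v⁻ j
    P = sum λ j → row j * column j
    S = trace² b
    β : Vector A n
    β i = sum λ j → b i j * v⁻ j
    β-sum = sum λ i → row i * β i

    -- Equivalently tr M = μ + tr `deflated`, because both traces contain the trace of `b`.
    s+μ≈a : s + μ ≈ a
    s+μ≈a = ≈-trans (+-congˡ (≈-trans (≈-sym (*-identityʳ μ)) (*-congˡ (≈-sym vk≈1)))) (row-v⁻ k)

    β≈ : ∀ i → β i ≈ column i + μ * v⁻ i
    β≈ i = begin
      β i                                  ≈⟨ +-identityʳ _ ⟨
      β i + 0#                             ≈⟨ +-congˡ (≈-trans (*-congˡ (-‿inverseʳ _)) (zeroʳ μ)) ⟨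
      β i + μ * (v (punchIn k i) + v⁻ i)
        ≈⟨ solve 4 (λ β μ v u → β :+ μ :* (v :+ u) := (β :+ μ :* v) :+ μ :* u) ≈-refl (β i) μ (v (punchIn k i)) (v⁻ i) ⟩
      (β i + μ * v (punchIn k i)) + μ * v⁻ i  ≈⟨ +-congʳ (row-v⁻ (punchIn k i)) ⟩
      column i + μ * v⁻ i                  ∎

    β-sum≈ : β-sum ≈ P + μ * s
    β-sum≈ = begin
      β-sum
        ≈⟨ sum-cong-≋ (λ i → ≈-trans (*-congˡ (β≈ i))
             (solve 4 (λ r c μ u → r :* (c :+ μ :* u) := r :* c :+ μ :* (r :* u)) ≈-refl (row i) (column i) μ (v⁻ i))) ⟩
      sum (λ i → row i * column i + μ * (row i * v⁻ i))
        ≈⟨ ∑-distrib-+ (λ i → row i * column i) (λ i → μ * (row i * v⁻ i)) ⟩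
      P + sum (λ i → μ * (row i * v⁻ i))
        ≈⟨ +-congˡ (*-distribˡ-sum μ (λ i → row i * v⁻ i)) ⟨
      P + μ * s ∎

    trace²-M : trace² M ≈ (a * a + P) + (P + S)
    trace²-M = begin
      trace² M
        ≈⟨ sum-remove {i = k} (λ i → sum λ j → M i j * M j i) ⟩
      sum (λ j → M k j * M j k) + sum (λ i → sum λ j → M (punchIn k i) j * M j (punchIn k i))
        ≈⟨ +-cong (sum-remove {i = k} (λ j → M k j * M j k))
             (≈-trans (sum-cong-≋ λ i → ≈-trans (sum-remove {i = k} (λ j → M (punchIn k i) j * M j (punchIn k i))) (+-congʳ (*-comm _ _)))
               (∑-distrib-+ (λ i → row i * column i) (λ i → sum λ j → b i j * b j i))) ⟩
      (a * a + P) + (P + S) ∎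

    trace²-deflated : trace² deflated ≈ S + β-sum + β-sum + s * s
    trace²-deflated = begin
      trace² deflated
        ≈⟨ sum-cong-≋ (λ i → sum-cong-≋ λ j →
             solve 6 (λ bij bji ui uj ri rj → (bij :+ ui :* rj) :* (bji :+ uj :* ri)
                 := bij :* bji :+ ri :* (bij :* uj) :+ rj :* (bji :* ui) :+ (ri :* ui) :* (rj :* uj)) ≈-refl
               (b i j) (b j i) (v⁻ i) (v⁻ j) (row i) (row j)) ⟩
      sum (λ i → sum λ j → b i j * b j i + X i j + X j i + Y i j)
        ≈⟨ sum²-+ (λ i j → b i j * b j i + X i j + X j i) Y ⟩
      sum (λ i → sum λ j → b i j * b j i + X i j + X j i) + sum (λ i → sum (Y i))
        ≈⟨ +-cong (≈-trans (sum²-+ (λ i j → b i j * b j i + X i j) (λ i j → X j i))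
                     (+-cong (≈-trans (sum²-+ (λ i j → b i j * b j i) X) (+-congˡ ΣX)) (≈-trans (∑-comm (λ i j → X j i)) ΣX))) ΣY ⟩
      S + β-sum + β-sum + s * s ∎
      where
      X Y : Fin n → Fin n → A
      X i j = row i * (b i j * v⁻ j)
      Y i j = (row i * v⁻ i) * (row j * v⁻ j)
      ΣX : sum (λ i → sum (X i)) ≈ β-sum
      ΣX = sum-cong-≋ λ i → ≈-sym (*-distribˡ-sum (row i) (λ j → b i j * v⁻ j))
      ΣY : sum (λ i → sum (Y i)) ≈ s * s
      ΣY = ≈-trans (sum-cong-≋ λ i → ≈-sym (*-distribˡ-sum (row i * v⁻ i) (λ j → row j * v⁻ j)))
             (≈-sym (*-distribʳ-sum s (λ i → row i * v⁻ i)))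

    -- In the basis of v and the eⱼ with j ≠ k the matrix is block triangular with diagonal blocks μ
    -- and `deflated`. Instead of changing the basis, both traces are expressed through s, μ, P and
    -- S.
    trace²-deflate : trace² M ≈ μ * μ + trace² deflated
    trace²-deflate = begin
      trace² M                                       ≈⟨ trace²-M ⟩
      (a * a + P) + (P + S)                          ≈⟨ +-congʳ (+-congʳ (*-cong s+μ≈a s+μ≈a)) ⟨
      ((s + μ) * (s + μ) + P) + (P + S)
        ≈⟨ solve 4 (λ s μ P S → ((s :+ μ) :* (s :+ μ) :+ P) :+ (P :+ S)
             := μ :* μ :+ (S :+ (P :+ μ :* s) :+ (P :+ μ :* s) :+ s :* s)) ≈-refl s μ P S ⟩
      μ * μ + (S + (P + μ * s) + (P + μ * s) + s * s)
        ≈⟨ +-congˡ (+-congʳ (+-cong (+-congˡ β-sum≈) β-sum≈)) ⟨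
      μ * μ + (S + β-sum + β-sum + s * s)            ≈⟨ +-congˡ trace²-deflated ⟨
      μ * μ + trace² deflated                        ∎

    -- An eigenvector w of the deflated matrix lifts to (ν - μ) w̃ + t v, where w̃ extends w by 0.
    module Lift (ν : A) (w : Vector A n) (Bw≈νw : ∀ i → apply deflated w i ≈ ν * w i) where

      δ t : A
      δ = ν - μ
      t = sum λ j → row j * w j

      w̃ lifted : Vector A (suc n)
      w̃ = insertAt w k 0#
      lifted i = δ * w̃ i + t * v i

      w̃k≈0 : w̃ k ≈ 0#
      w̃k≈0 = reflexive (insertAt-lookup w k 0#)

      w̃-punchIn : ∀ j → w̃ (punchIn k j) ≈ w j
      w̃-punchIn j = reflexive (insertAt-punchIn w k 0# j)

      apply-w̃ : ∀ i → apply M w̃ i ≈ sum (λ j → M i (punchIn k j) * w j)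
      apply-w̃ i = begin
        apply M w̃ i       ≈⟨ sum-remove {i = k} (λ j → M i j * w̃ j) ⟩
        M i k * w̃ k + sum (λ j → M i (punchIn k j) * w̃ (punchIn k j))
          ≈⟨ +-cong (≈-trans (*-congˡ w̃k≈0) (zeroʳ _)) (sum-cong-≋ λ j → *-congˡ (w̃-punchIn j)) ⟩
        0# + sum (λ j → M i (punchIn k j) * w j)  ≈⟨ +-identityˡ _ ⟩
        sum (λ j → M i (punchIn k j) * w j)       ∎

      -- w is an eigenvector in the quotient, so (M - ν) w̃ is a multiple of v; coordinate k, where
      -- w̃ is 0 and v is 1, shows that the multiple is t.
      apply-w̃≈ : ∀ i → apply M w̃ i ≈ ν * w̃ i + t * v i
      apply-w̃≈ i = at-coordinate (k Fin.≟ i)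
        where
        off-k : ∀ l → apply M w̃ (punchIn k l) ≈ ν * w̃ (punchIn k l) + t * v (punchIn k l)
        off-k l = begin
          apply M w̃ (punchIn k l)                  ≈⟨ apply-w̃ (punchIn k l) ⟩
          bw                                       ≈⟨ +-identityʳ _ ⟨
          bw + 0#                                  ≈⟨ +-congˡ (≈-trans (*-congʳ (-‿inverseˡ _)) (zeroˡ t)) ⟨
          bw + (v⁻ l + v (punchIn k l)) * t
            ≈⟨ solve 4 (λ x u v t → x :+ (u :+ v) :* t := (x :+ u :* t) :+ t :* v) ≈-refl bw (v⁻ l) (v (punchIn k l)) t ⟩
          (bw + v⁻ l * t) + t * v (punchIn k l)
            ≈⟨ +-congʳ (+-congˡ (*-distribˡ-sum (v⁻ l) (λ j → row j * w j))) ⟩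
          (bw + sum (λ j → v⁻ l * (row j * w j))) + t * v (punchIn k l)
            ≈⟨ +-congʳ (∑-distrib-+ (λ j → b l j * w j) (λ j → v⁻ l * (row j * w j))) ⟨
          sum (λ j → b l j * w j + v⁻ l * (row j * w j)) + t * v (punchIn k l)
            ≈⟨ +-congʳ (sum-cong-≋ λ j →
                 solve 4 (λ b u r w → b :* w :+ u :* (r :* w) := (b :+ u :* r) :* w) ≈-refl (b l j) (v⁻ l) (row j) (w j)) ⟩
          apply deflated w l + t * v (punchIn k l) ≈⟨ +-congʳ (≈-trans (Bw≈νw l) (*-congˡ (≈-sym (w̃-punchIn l)))) ⟩
          ν * w̃ (punchIn k l) + t * v (punchIn k l) ∎
          where
          bw : A
          bw = sum λ j → b l j * w j
        at-coordinate : Dec (k ≡ i) → apply M w̃ i ≈ ν * w̃ i + t * v i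
        at-coordinate (yes refl) = begin
          apply M w̃ k            ≈⟨ apply-w̃ k ⟩
          t                      ≈⟨ solve 1 (λ t → t := con 0 :+ t :* con 1) ≈-refl t ⟩
          0# + t * 1#            ≈⟨ +-cong (≈-trans (*-congˡ w̃k≈0) (zeroʳ ν)) (*-congˡ vk≈1) ⟨
          ν * w̃ k + t * v k      ∎
        at-coordinate (no k≢i) = subst (λ i → apply M w̃ i ≈ ν * w̃ i + t * v i)
          (Fin.punchIn-punchOut k≢i) (off-k (punchOut k≢i))

      -- M - ν sends w̃ to t v and v to - δ v, so the two contributions to δ w̃ + t v cancel.
      -- Scaling by δ avoids a division by ν - μ.
      lifted-eigenvector : ∀ i → apply M lifted i ≈ ν * lifted i
      lifted-eigenvector i = begin
        apply M lifted i                         ≈⟨ apply-linear M δ w̃ (λ j → t * v j) i ⟩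
        δ * apply M w̃ i + apply M (λ j → t * v j) i
          ≈⟨ +-cong (*-congˡ (apply-w̃≈ i)) (≈-trans
               (sum-cong-≋ λ j → solve 3 (λ m t v → m :* (t :* v) := t :* (m :* v)) ≈-refl (M i j) t (v j))
               (≈-trans (≈-sym (*-distribˡ-sum t (λ j → M i j * v j))) (*-congˡ (Mv≈μv i)))) ⟩
        δ * (ν * w̃ i + t * v i) + t * (μ * v i)
          ≈⟨ solve 6 (λ δ ν w t v μ → δ :* (ν :* w :+ t :* v) :+ t :* (μ :* v) := ν :* (δ :* w) :+ (δ :+ μ) :* (t :* v)) ≈-refl
               δ ν (w̃ i) t (v i) μ ⟩
        ν * (δ * w̃ i) + (δ + μ) * (t * v i)
          ≈⟨ +-congˡ (*-congʳ (≈-trans (+-assoc _ _ _) (≈-trans (+-congˡ (-‿inverseˡ μ)) (+-identityʳ ν)))) ⟩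
        ν * (δ * w̃ i) + ν * (t * v i)            ≈⟨ distribˡ _ _ _ ⟨
        ν * lifted i                             ∎

      δ≈0⇒eigenvector : δ ≈ 0# → ∀ i → apply M v i ≈ ν * v i
      δ≈0⇒eigenvector δ≈0 i = ≈-trans (Mv≈μv i) (*-congʳ (≈-sym (x-y≈0⇒x≈y ν μ δ≈0)))

      lifted-zero : (∀ i → lifted i ≈ 0#) → ∀ j → δ * w j ≈ 0#
      lifted-zero lifted≈0 j = begin
        δ * w j                                       ≈⟨ *-congˡ (w̃-punchIn j) ⟨
        δ * w̃ (punchIn k j)                           ≈⟨ +-identityʳ _ ⟨
        δ * w̃ (punchIn k j) + 0#                      ≈⟨ +-congˡ (≈-trans (*-congʳ t≈0) (zeroˡ _)) ⟨
        lifted (punchIn k j)                          ≈⟨ lifted≈0 (punchIn k j) ⟩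
        0#                                            ∎
        where
        t≈0 : t ≈ 0#
        t≈0 = begin
          t                      ≈⟨ solve 2 (λ t δ → t := δ :* con 0 :+ t :* con 1) ≈-refl t δ ⟩
          δ * 0# + t * 1#        ≈⟨ +-cong (*-congˡ w̃k≈0) (*-congˡ vk≈1) ⟨
          lifted k               ≈⟨ lifted≈0 k ⟩
          0#                     ∎

  Eigenvalue : ∀ {n} → (Fin n → Fin n → A) → A → Set _
  Eigenvalue {n} M μ = Σ (Vector A n) λ v → ¬ (∀ i → v i ≈ 0#) × (∀ i → apply M v i ≈ μ * v i)

-- Linear algebra over an algebraically closed field

-- Classical reasoning takes place under double negation.
record IsAlgebraicallyClosedField {c ℓ} (R : CommutativeRing c ℓ) : Set (c ⊔ ℓ) where
  open CommutativeRing R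
  field
    ≈0-stable   : ∀ {x} → ¬ ¬ x ≈ 0# → x ≈ 0#
    1≉0         : ¬ 1# ≈ 0#
    ≉0⇒inverse  : ∀ {x} → ¬ x ≈ 0# → ¬ ¬ (∃[ y ] x * y ≈ 1#)
    root        : ∀ {n} (cs : Vec Carrier (suc n)) → ∃[ z ] Monic.eval R cs z ≈ 0#

module Spectrum {c ℓ} (R : CommutativeRing c ℓ) (isAlgebraicallyClosedField : IsAlgebraicallyClosedField R) where

  open CommutativeRing R hiding (zero) renaming (Carrier to A; refl to ≈-refl; sym to ≈-sym; trans to ≈-trans)
  open IsAlgebraicallyClosedField isAlgebraicallyClosedField
  open import Relation.Binary.Reasoning.Setoid setoid
  open SemiringSum semiring
  open Monic R
  open LinearAlgebra R

  *-cancelˡ-≈0 : ∀ {x y} → ¬ x ≈ 0# → x * y ≈ 0# → y ≈ 0#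
  *-cancelˡ-≈0 {x} {y} x≉0 xy≈0 = ≈0-stable (≉0⇒inverse x≉0 >>= λ (w , xw≈1) → pure (begin
    y            ≈⟨ *-identityˡ y ⟨
    1# * y       ≈⟨ *-congʳ xw≈1 ⟨
    (x * w) * y  ≈⟨ *-congʳ (*-comm x w) ⟩
    (w * x) * y  ≈⟨ *-assoc w x y ⟩
    w * (x * y)  ≈⟨ *-congˡ xy≈0 ⟩
    w * 0#       ≈⟨ zeroʳ w ⟩
    0#           ∎))

  nonzero-coordinate : ∀ {n} {v : Vector A n} → ¬ (∀ i → v i ≈ 0#) → ¬ ¬ (∃[ i ] ¬ v i ≈ 0#)
  nonzero-coordinate v≉0 none = v≉0 λ i → ≈0-stable λ vi≉0 → none (i , vi≉0)

  -- Every nonzero first vector eliminates one coordinate, so after at most n steps a first vector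
  -- vanishes and is itself a monic relation of degree 0. Undoing the eliminations keeps the
  -- relation monic.
  monic-relation : ∀ {n} (x : ℕ → Vector A n) →
    ¬ ¬ (∃[ d ] Σ (Vec A d) λ cs → ∀ i → combine cs (λ k → x k i) ≈ 0#)
  monic-relation {zero}  x = pure (0 , [] , λ ())
  monic-relation {suc n} x = ¬¬-excluded-middle >>= from-dec
    where
    from-dec : Dec (∀ i → x 0 i ≈ 0#) → ¬ ¬ (∃[ d ] Σ (Vec A d) λ cs → ∀ i → combine cs (λ k → x k i) ≈ 0#)
    from-dec (yes x₀≈0) = pure (0 , [] , x₀≈0)
    from-dec (no x₀≉0) =
      nonzero-coordinate x₀≉0 >>= λ (k , x₀k≉0) →
      ≉0⇒inverse x₀k≉0 >>= λ (w , x₀kw≈1) →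
      let open Eliminate x k w x₀kw≈1 in
      monic-relation eliminated >>= λ (d , cs , relation) →
      pure (suc d , combine cs α ∷ cs , eliminated-relation cs relation)

  -- Splitting off a root μ as p = (X - μ) q, either q already annihilates the start vector and the
  -- degree drops, or q(M) x₀ is an eigenvector for μ. Degree 0 is excluded because it would say x₀
  -- = 0.
  annihilated⇒eigenvalue : ∀ {n d} (M : Fin n → Fin n → A) (x : ℕ → Vector A n) →
    (∀ k i → x (suc k) i ≈ apply M (x k) i) → ¬ (∀ i → x 0 i ≈ 0#) →
    (cs : Vec A d) → (∀ i → combine cs (λ k → x k i) ≈ 0#) → ¬ ¬ (∃[ μ ] Eigenvalue M μ)
  annihilated⇒eigenvalue M x x-step x₀≉0 []         relation = contradiction relation x₀≉0
  annihilated⇒eigenvalue {n} {suc d} M x x-step x₀≉0 cs@(_ ∷ _) relation = ¬¬-excluded-middle >>= from-dec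
    where
    μ : A
    μ = proj₁ (root cs)
    q : Vec A d
    q = quotient μ cs
    from-dec : Dec (∀ i → combine q (λ k → x k i) ≈ 0#) → ¬ ¬ (∃[ μ ] Eigenvalue M μ)
    from-dec (yes u≈0) = annihilated⇒eigenvalue M x x-step x₀≉0 q u≈0
    from-dec (no u≉0)  = pure (μ , (λ i → combine q (λ k → x k i)) , u≉0 ,
      quotient-eigenvector M cs μ x x-step relation (proj₂ (root cs)))

  -- Any nonzero start vector would do; for the all-ones vector this is immediate in positive
  -- dimension.
  krylov : ∀ {n} → (Fin n → Fin n → A) → ℕ → Vector A n
  krylov M zero    i = 1#
  krylov M (suc k) i = apply M (krylov M k) i

  eigenvalue-exists : ∀ {n} (M : Fin (suc n) → Fin (suc n) → A) → ¬ ¬ (∃[ μ ] Eigenvalue M μ)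
  eigenvalue-exists M = monic-relation (krylov M) >>= λ (d , cs , relation) →
    annihilated⇒eigenvalue M (krylov M) (λ k i → ≈-refl) (λ 1≈0 → 1≉0 (1≈0 zero)) cs relation

  normalised-eigenvector : ∀ {n} {M : Fin n → Fin n → A} {μ} → Eigenvalue M μ →
    ¬ ¬ (∃[ k ] Σ (Vector A n) λ v → v k ≈ 1# × (∀ i → apply M v i ≈ μ * v i))
  normalised-eigenvector {n} {M} {μ} (v , v≉0 , Mv≈μv) =
    nonzero-coordinate v≉0 >>= λ (k , vk≉0) →
    ≉0⇒inverse vk≉0 >>= λ (w , vkw≈1) →
    pure (k , (λ i → w * v i) , ≈-trans (*-comm w (v k)) vkw≈1 , scale-eigenvector M {μ} {v} w Mv≈μv)

  deflated-eigenvalue : ∀ {n} (M : Fin (suc n) → Fin (suc n) → A) k v μ (vk≈1 : v k ≈ 1#)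
    (Mv≈μv : ∀ i → apply M v i ≈ μ * v i) {ν} →
    Eigenvalue (Deflate.deflated M k v μ vk≈1 Mv≈μv) ν → ¬ ¬ Eigenvalue M ν
  deflated-eigenvalue M k v μ vk≈1 Mv≈μv {ν} (w , w≉0 , Bw≈νw) = ¬¬-excluded-middle >>= from-dec
    where
    open Deflate.Lift M k v μ vk≈1 Mv≈μv ν w Bw≈νw
    from-dec : Dec (δ ≈ 0#) → ¬ ¬ Eigenvalue M ν
    from-dec (yes δ≈0) = pure (v , (λ v≈0 → 1≉0 (≈-trans (≈-sym vk≈1) (v≈0 k))) , δ≈0⇒eigenvector δ≈0)
    from-dec (no δ≉0)  = pure (lifted , (λ lifted≈0 → w≉0 λ j → *-cancelˡ-≈0 δ≉0 (lifted-zero lifted≈0 j)) , lifted-eigenvector)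

  -- Each eigenvalue found after a deflation is carried back by a case distinction on ν - μ ≈ 0.
  -- Leaving that double negation inside the quantifier avoids collecting one classical decision per
  -- index.
  trace²-spectrum : ∀ {n} (M : Fin n → Fin n → A) →
    ¬ ¬ (Σ (Vector A n) λ μ → (∀ i → ¬ ¬ Eigenvalue M (μ i)) × trace² M ≈ sum (λ i → μ i * μ i))
  trace²-spectrum {zero}  M = pure ((λ ()) , (λ ()) , ≈-refl)
  trace²-spectrum {suc n} M =
    eigenvalue-exists M >>= λ (μ , ev) →
    normalised-eigenvector {M = M} ev >>= λ (k , v , vk≈1 , Mv≈μv) →
    let open Deflate M k v μ vk≈1 Mv≈μv in
    trace²-spectrum deflated >>= λ (ν , ν-ev , trace≈) →
    pure (μ ◂ ν ,
      (λ { zero → pure ev ; (suc i) → ν-ev i >>= deflated-eigenvalue M k v μ vk≈1 Mv≈μv }) ,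
      ≈-trans trace²-deflate (+-congˡ trace≈))

-- The complex numbers as an algebraically closed field

Apart : ℂ → Set
Apart z = ∃[ δ ] (0ℚ ℚ.< δ × ∃[ N ] (∀ n → N ℕ.≤ n → δ ℚ.≤ ‖ at z n ‖))

-- One rational comparison decides: beyond N the terms vary by less than ε/4, so ‖z N‖ < ε/2 keeps
-- all later ones below ε, and otherwise they stay above ε/4.
small-or-apart : ∀ z ε → 0ℚ ℚ.< ε → (∃[ N ] (∀ n → N ℕ.≤ n → ‖ at z n ‖ ℚ.< ε)) ⊎ Apart z
small-or-apart z ε 0<ε = from-dec (‖ at z N ‖ ℚ.<? ½ ℚ.* ε)
  where
  δ : ℚ
  δ = ½ ℚ.* (½ ℚ.* ε)
  0<δ : 0ℚ ℚ.< δ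
  0<δ = half-pos (half-pos 0<ε)
  cauchy : ∃[ N ] (∀ m n → N ℕ.≤ m → N ℕ.≤ n → ‖ at z m -ᴳ at z n ‖ ℚ.< δ)
  cauchy = at-cauchy z δ 0<δ
  N : ℕ
  N = proj₁ cauchy
  δ≤½ε : δ ℚ.≤ ½ ℚ.* ε
  δ≤½ε = ≤-witness δ (ℚ.<⇒≤ 0<δ) (sym (halves (½ ℚ.* ε)))
  triangle : ∀ m n → ‖ at z m ‖ ℚ.≤ ‖ at z n ‖ ℚ.+ ‖ at z m -ᴳ at z n ‖
  triangle m n = subst (λ t → ‖ t ‖ ℚ.≤ ‖ at z n ‖ ℚ.+ ‖ at z m -ᴳ at z n ‖)
    (ᴳS.solve 2 (λ a b → b ᴳS.:+ (a ᴳS.:- b) ᴳS.:= a) refl (at z m) (at z n)) (‖z+w‖≤ (at z n) (at z m -ᴳ at z n))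
  from-dec : Dec (‖ at z N ‖ ℚ.< ½ ℚ.* ε) → (∃[ N ] (∀ n → N ℕ.≤ n → ‖ at z n ‖ ℚ.< ε)) ⊎ Apart z
  from-dec (yes small) = inj₁ (N , λ n N≤n → subst (‖ at z n ‖ ℚ.<_) (halves ε)
    (ℚ.≤-<-trans (triangle n N) (ℚ.+-mono-< small (ℚ.<-≤-trans (proj₂ cauchy n N N≤n ℕ.≤-refl) δ≤½ε))))
  from-dec (no large) = inj₂ (δ , 0<δ , N , λ n N≤n → subst₂ ℚ._≤_
    (trans (cong (ℚ._- δ) (sym (halves (½ ℚ.* ε)))) (ℚS.solve 1 (λ d → (d ℚS.:+ d) ℚS.:- d ℚS.:= d) refl δ))
    (ℚS.solve 2 (λ a d → (a ℚS.:+ d) ℚS.:- d ℚS.:= a) refl ‖ at z n ‖ δ)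
    (ℚ.+-monoˡ-≤ (ℚ.- δ) (ℚ.≤-trans (ℚ.≮⇒≥ large) (ℚ.≤-trans (triangle N n)
      (ℚ.+-monoʳ-≤ ‖ at z n ‖ (ℚ.<⇒≤ (proj₂ cauchy N n ℕ.≤-refl N≤n)))))))

apart⇒≉0 : ∀ {z} → Apart z → ¬ z ≈ℂ 0ℂ
apart⇒≉0 {z} (δ , 0<δ , M , δ≤) (mk≈ null) =
  let N , <δ = eventually-< null δ 0<δ
      n      = M ℕ.⊔ N
  in ℚ.<-irrefl refl (ℚ.≤-<-trans (δ≤ n (ℕ.m≤m⊔n M N))
       (subst (λ t → ‖ t ‖ ℚ.< δ) (ᴳS.solve 1 (λ x → x ᴳS.:- ᴳS.con 0ᴳ ᴳS.:= x) refl (at z n)) (<δ n (ℕ.m≤n⊔m M N))))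

-- For each ε the second alternative of `small-or-apart` is refuted. Hence being zero amounts to a
-- negation, which is the source of its stability.
¬apart⇒≈0 : ∀ {z} → ¬ Apart z → z ≈ℂ 0ℂ
¬apart⇒≈0 {z} ¬apart = mk≈ (null-≡ (λ n → ᴳS.solve 1 (λ x → x ᴳS.:= x ᴳS.:- ᴳS.con 0ᴳ) refl (at z n))
  (mkNull λ ε 0<ε → resolve (small-or-apart z ε 0<ε)))
  where
  resolve : ∀ {a} {A : Set a} → A ⊎ Apart z → A
  resolve (inj₁ a)     = a
  resolve (inj₂ apart) = contradiction apart ¬apart

≈0-stable : ∀ {z} → ¬ ¬ z ≈ℂ 0ℂ → z ≈ℂ 0ℂ
≈0-stable ¬¬z≈0 = ¬apart⇒≈0 λ apart → ¬¬z≈0 (apart⇒≉0 apart)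

≉0⇒apart : ∀ {z} → ¬ z ≈ℂ 0ℂ → ¬ ¬ Apart z
≉0⇒apart z≉0 ¬apart = z≉0 (¬apart⇒≈0 ¬apart)

1≉0 : ¬ 1ℂ ≈ℂ 0ℂ
1≉0 = apart⇒≉0 {1ℂ} (1ℚ , ℚ.positive⁻¹ 1ℚ , 0 , λ _ _ → ℚ.≤-refl)

apart⇒inverse : ∀ {z} → Apart z → ∃[ w ] z *ℂ w ≈ℂ 1ℂ
apart⇒inverse {z} (δ , 0<δ , M , δ≤) = w , mk≈ (mkNull λ ε 0<ε → M , λ n M≤n → subst (λ t → ‖ t ‖ ℚ.< ε)
    (sym (trans (cong (_-ᴳ 1ᴳ) (zu≡1 n M≤n)) (ᴳ.-‿inverseʳ 1ᴳ))) 0<ε)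
  where
  D : ℚ
  D = proj₁ (divide 0<δ (0<fromℕ-suc 1))
  0<D : 0ℚ ℚ.< D
  0<D = proj₁ (proj₂ (divide 0<δ (0<fromℕ-suc 1)))
  -- Terms of z before `M` may vanish, where `inv` takes its default value; every estimate below
  -- concerns indices from `M` on.
  u : ℕ → ℚ[i]
  u n = inv (at z n)
  u≤D : ∀ n → M ℕ.≤ n → ‖ u n ‖ ℚ.≤ D
  u≤D n M≤n = ‖inv‖≤ {at z n} 0<δ (δ≤ n M≤n) (proj₂ (proj₂ (divide 0<δ (0<fromℕ-suc 1))))
  zu≡1 : ∀ n → M ℕ.≤ n → at z n *ᴳ u n ≡ 1ᴳ
  zu≡1 n M≤n = *-inv {at z n} (ℚ.<-≤-trans 0<δ (δ≤ n M≤n))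
  difference : ∀ m n → M ℕ.≤ m → M ℕ.≤ n → u m -ᴳ u n ≡ (u m *ᴳ u n) *ᴳ (at z n -ᴳ at z m)
  difference m n M≤m M≤n = trans
    (solve 2 (λ a b → a :- b := con 1ᴳ :* a :- con 1ᴳ :* b) refl (u m) (u n))
    (trans (cong₂ (λ s t → s *ᴳ u m -ᴳ t *ᴳ u n) (sym (zu≡1 n M≤n)) (sym (zu≡1 m M≤m)))
      (solve 4 (λ z v y w → (z :* v) :* w :- (y :* w) :* v := (w :* v) :* (z :- y)) refl (at z n) (u n) (at z m) (u m)))
    where open ᴳS
  cauchy : ∀ ε → 0ℚ ℚ.< ε → ∃[ N ] (∀ m n → N ℕ.≤ m → N ℕ.≤ n → ‖ u m -ᴳ u n ‖ ℚ.< ε)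
  cauchy ε 0<ε =
    let η , 0<η , D²η≡ε = divide (*-pos 0<D 0<D) 0<ε
        N , z<          = at-cauchy z η 0<η
    in M ℕ.⊔ N , λ m n ≤m ≤n →
      let M≤m = ℕ.m⊔n≤o⇒m≤o M N ≤m
          M≤n = ℕ.m⊔n≤o⇒m≤o M N ≤n
      in begin-strict
        ‖ u m -ᴳ u n ‖                             ≡⟨ cong ‖_‖ (difference m n M≤m M≤n) ⟩
        ‖ (u m *ᴳ u n) *ᴳ (at z n -ᴳ at z m) ‖
          ≤⟨ ‖*‖≤ {u m *ᴳ u n} {at z n -ᴳ at z m} (‖*‖≤ {u m} {u n} (u≤D m M≤m) (u≤D n M≤n)) ℚ.≤-refl ⟩
        (D ℚ.* D) ℚ.* ‖ at z n -ᴳ at z m ‖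
          <⟨ ℚ.*-monoʳ-<-pos (D ℚ.* D) {{ℚ.positive (*-pos 0<D 0<D)}}
               (z< n m (ℕ.m⊔n≤o⇒n≤o M N ≤n) (ℕ.m⊔n≤o⇒n≤o M N ≤m)) ⟩
        (D ℚ.* D) ℚ.* η                            ≡⟨ D²η≡ε ⟩
        ε ∎
    where open ℚ.≤-Reasoning
  w : ℂ
  w = limit u cauchy

≉0⇒inverse : ∀ {z} → ¬ z ≈ℂ 0ℂ → ¬ ¬ (∃[ w ] z *ℂ w ≈ℂ 1ℂ)
≉0⇒inverse z≉0 = ¬¬-map apart⇒inverse (≉0⇒apart z≉0)

ℂ-isAlgebraicallyClosedField : IsAlgebraicallyClosedField +-*-ℂ-commutativeRing
ℂ-isAlgebraicallyClosedField = record
  { ≈0-stable  = ≈0-stable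
  ; 1≉0        = 1≉0
  ; ≉0⇒inverse = ≉0⇒inverse
  ; root       = fundamental-theorem-of-algebra
  }

open LinearAlgebra +-*-ℂ-commutativeRing using (trace²)
open Spectrum +-*-ℂ-commutativeRing ℂ-isAlgebraicallyClosedField using (trace²-spectrum)

opaque
  trace²-spectrumℂ : ∀ {n} (M : Matrix n) → ¬ ¬ (Σ (Vector ℂ n) λ μ →
    (∀ i → ¬ ¬ IsEigenvalue M (μ i)) × trace² M ≈ℂ ∑ (λ i → μ i *ℂ μ i))
  trace²-spectrumℂ M = trace²-spectrum M >>= λ (μ , ev , trace≈) →
    pure (μ , (λ i → ¬¬-map (λ (v , v≉0 , Mv≈μv) → v , (λ v≃0 → v≉0 λ i → ≃⇒≈ (v≃0 i)) , λ j → ≈⇒≃ (Mv≈μv j)) (ev i)) , trace≈)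

open import Data.Nat.Base using (_*_)

-- The order of the reals

∣p-q∣≤d⇒p≤q+d : ∀ p q {d} → ℚ.∣ p ℚ.- q ∣ ℚ.≤ d → p ℚ.≤ q ℚ.+ d
∣p-q∣≤d⇒p≤q+d p q {d} ≤d = begin
  p                ≡⟨ ℚS.solve 2 (λ p q → p ℚS.:= q ℚS.:+ (p ℚS.:- q)) refl p q ⟩
  q ℚ.+ (p ℚ.- q)  ≤⟨ ℚ.+-monoʳ-≤ q (ℚ.≤-trans (p≤∣p∣ (p ℚ.- q)) ≤d) ⟩
  q ℚ.+ d          ∎
  where open ℚ.≤-Reasoning

+-cancelʳ-≤ : ∀ p q r → p ℚ.+ r ℚ.≤ q ℚ.+ r → p ℚ.≤ q
+-cancelʳ-≤ p q r p+r≤q+r = subst₂ ℚ._≤_ (cancel p) (cancel q) (ℚ.+-monoˡ-≤ (ℚ.- r) p+r≤q+r)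
  where
  cancel : ∀ p → p ℚ.+ r ℚ.- r ≡ p
  cancel p = ℚS.solve 2 (λ p r → p ℚS.:+ r ℚS.:- r ℚS.:= p) refl p r

-- The terms at one late index are compared in ℚ. If x N exceeds y N + ε/2, drifts of at most d =
-- ε/8 still leave a gap d at all later indices, which the hypothesis forbids; otherwise the same
-- drifts fit into ε.
≤ℝ-by-contradiction : ∀ x y →
  (∀ δ → 0ℚ ℚ.< δ → ¬ (∃[ N ] (∀ n → N ℕ.≤ n → seq y n ℚ.+ δ ℚ.≤ seq x n))) → x ≤ℝ y
≤ℝ-by-contradiction x y y+δ≰x ε 0<ε = from-dec (seq x N ℚ.≤? seq y N ℚ.+ ½ ℚ.* ε)
  where
  open ℚ.≤-Reasoning
  open ℚS
  ¼ε d : ℚ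
  ¼ε = ½ ℚ.* (½ ℚ.* ε)
  d = ½ ℚ.* ¼ε
  0<d : 0ℚ ℚ.< d
  0<d = half-pos (half-pos (half-pos 0<ε))
  N₁ N₂ N : ℕ
  N₁ = proj₁ (isCauchy x d 0<d)
  N₂ = proj₁ (isCauchy y d 0<d)
  N = N₁ ℕ.⊔ N₂
  x~ : ∀ m n → N ℕ.≤ m → N ℕ.≤ n → seq x m ℚ.≤ seq x n ℚ.+ d
  x~ m n N≤m N≤n = ∣p-q∣≤d⇒p≤q+d (seq x m) (seq x n)
    (ℚ.<⇒≤ (proj₂ (isCauchy x d 0<d) m n (ℕ.m⊔n≤o⇒m≤o N₁ N₂ N≤m) (ℕ.m⊔n≤o⇒m≤o N₁ N₂ N≤n)))
  y~ : ∀ m n → N ℕ.≤ m → N ℕ.≤ n → seq y m ℚ.≤ seq y n ℚ.+ d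
  y~ m n N≤m N≤n = ∣p-q∣≤d⇒p≤q+d (seq y m) (seq y n)
    (ℚ.<⇒≤ (proj₂ (isCauchy y d 0<d) m n (ℕ.m⊔n≤o⇒n≤o N₁ N₂ N≤m) (ℕ.m⊔n≤o⇒n≤o N₁ N₂ N≤n)))
  from-dec : Dec (seq x N ℚ.≤ seq y N ℚ.+ ½ ℚ.* ε) → ∃[ N ] (∀ n → N ℕ.≤ n → seq x n ℚ.≤ seq y n ℚ.+ ε)
  from-dec (yes x≤y) = N , λ n N≤n → begin
    seq x n                                   ≤⟨ x~ n N N≤n ℕ.≤-refl ⟩
    seq x N ℚ.+ d                             ≤⟨ ℚ.+-monoˡ-≤ d x≤y ⟩
    (seq y N ℚ.+ ½ ℚ.* ε) ℚ.+ d
      ≤⟨ ℚ.+-monoˡ-≤ d (ℚ.+-monoˡ-≤ (½ ℚ.* ε) (y~ N n ℕ.≤-refl N≤n)) ⟩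
    ((seq y n ℚ.+ d) ℚ.+ ½ ℚ.* ε) ℚ.+ d
      ≤⟨ ≤-witness ¼ε (ℚ.<⇒≤ (half-pos (half-pos 0<ε)))
           (solve 2 (λ y e → let q = con ½ :* (con ½ :* e) ; d = con ½ :* q in
              y :+ e := (((y :+ d) :+ con ½ :* e) :+ d) :+ q) refl (seq y n) ε) ⟩
    seq y n ℚ.+ ε ∎
  from-dec (no x≰y) = contradiction (N , λ n N≤n → +-cancelʳ-≤ _ _ d (begin
    (seq y n ℚ.+ d) ℚ.+ d         ≤⟨ ℚ.+-monoˡ-≤ d (ℚ.+-monoˡ-≤ d (y~ n N N≤n ℕ.≤-refl)) ⟩
    ((seq y N ℚ.+ d) ℚ.+ d) ℚ.+ d
      ≤⟨ ≤-witness d (ℚ.<⇒≤ 0<d)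
           (solve 2 (λ y e → let d = con ½ :* (con ½ :* (con ½ :* e)) in
              y :+ con ½ :* e := (((y :+ d) :+ d) :+ d) :+ d) refl (seq y N) ε) ⟩
    seq y N ℚ.+ ½ ℚ.* ε           ≤⟨ ℚ.<⇒≤ (ℚ.≰⇒> x≰y) ⟩
    seq x N                       ≤⟨ x~ N n ℕ.≤-refl N≤n ⟩
    seq x n ℚ.+ d                 ∎)) (y+δ≰x d 0<d)

≤ℝ-stable : ∀ x y → ¬ ¬ (x ≤ℝ y) → x ≤ℝ y
≤ℝ-stable x y ¬¬x≤y = ≤ℝ-by-contradiction x y λ δ 0<δ (M , y+δ≤x) → ¬¬x≤y λ x≤y →
  let N , x≤y+½δ = x≤y (½ ℚ.* δ) (half-pos 0<δ)
      n          = M ℕ.⊔ N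
  in ℚ.<-irrefl refl (ℚ.≤-<-trans
       (ℚ.≤-trans (y+δ≤x n (ℕ.m≤m⊔n M N)) (x≤y+½δ n (ℕ.m≤n⊔m M N)))
       (ℚ.+-monoʳ-< (seq y n) (<-witness (½ ℚ.* δ) (half-pos 0<δ) (sym (halves δ)))))

re-≤-resp-≈ : ∀ {z w y} → z ≈ℂ w → re z ≤ℝ y → re w ≤ℝ y
re-≤-resp-≈ {z} {w} {y} (mk≈ null) z≤y ε 0<ε =
  let M , z~w = eventually-< null (½ ℚ.* ε) (half-pos 0<ε)
      N , z≤  = z≤y (½ ℚ.* ε) (half-pos 0<ε)
  in M ℕ.⊔ N , λ n ≤n → begin
    seq (re w) n
      ≤⟨ ∣p-q∣≤d⇒p≤q+d (seq (re w) n) (seq (re z) n) (subst (ℚ._≤ ½ ℚ.* ε) (∣p-q∣≡∣q-p∣ (seq (re z) n) (seq (re w) n))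
           (ℚ.≤-trans ∣re∣≤‖ at z n -ᴳ at w n ‖ (ℚ.<⇒≤ (z~w n (ℕ.m⊔n≤o⇒m≤o M N ≤n))))) ⟩
    seq (re z) n ℚ.+ ½ ℚ.* ε                ≤⟨ ℚ.+-monoˡ-≤ (½ ℚ.* ε) (z≤ n (ℕ.m⊔n≤o⇒n≤o M N ≤n)) ⟩
    (seq y n ℚ.+ ½ ℚ.* ε) ℚ.+ ½ ℚ.* ε       ≡⟨ trans (ℚ.+-assoc (seq y n) _ _) (cong (seq y n ℚ.+_) (halves ε)) ⟩
    seq y n ℚ.+ ε                           ∎
  where open ℚ.≤-Reasoning

+ℝ-mono-≤ : ∀ {x y p q} → x ≤ℝ fromℚ p → y ≤ℝ fromℚ q → (x +ℝ y) ≤ℝ fromℚ (p ℚ.+ q)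
+ℝ-mono-≤ {x} {y} {p} {q} x≤p y≤q ε 0<ε =
  let M , x≤ = x≤p (½ ℚ.* ε) (half-pos 0<ε)
      N , y≤ = y≤q (½ ℚ.* ε) (half-pos 0<ε)
  in M ℕ.⊔ N , λ n ≤n → begin
    seq x n ℚ.+ seq y n   ≤⟨ ℚ.+-mono-≤ (x≤ n (ℕ.m⊔n≤o⇒m≤o M N ≤n)) (y≤ n (ℕ.m⊔n≤o⇒n≤o M N ≤n)) ⟩
    (p ℚ.+ ½ ℚ.* ε) ℚ.+ (q ℚ.+ ½ ℚ.* ε)
      ≡⟨ ℚS.solve 3 (λ p q h → (p ℚS.:+ h) ℚS.:+ (q ℚS.:+ h) ℚS.:= (p ℚS.:+ q) ℚS.:+ (h ℚS.:+ h)) refl p q (½ ℚ.* ε) ⟩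
    (p ℚ.+ q) ℚ.+ (½ ℚ.* ε ℚ.+ ½ ℚ.* ε)
      ≡⟨ cong ((p ℚ.+ q) ℚ.+_) (halves ε) ⟩
    (p ℚ.+ q) ℚ.+ ε       ∎
  where open ℚ.≤-Reasoning

normSqℝ : ℂ → ℝ
normSqℝ z = re z *ℝ re z +ℝ im z *ℝ im z

re-z²≤normSq : ∀ z {y} → normSqℝ z ≤ℝ y → re (z *ℂ z) ≤ℝ y
re-z²≤normSq z N≤y ε 0<ε = let N , N≤ = N≤y ε 0<ε in
  N , λ n N≤n → ℚ.≤-trans (≤-witness (2ℚ ℚ.* (seq (im z) n ℚ.* seq (im z) n)) (*-nonNeg (0≤fromℕ 2) (0≤p*p (seq (im z) n)))
    (ℚS.solve 2 (λ x y → x ℚS.:* x ℚS.:+ y ℚS.:* y ℚS.:= (x ℚS.:* x ℚS.:- y ℚS.:* y) ℚS.:+ ℚS.con 2ℚ ℚS.:* (y ℚS.:* y)) refl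
      (seq (re z) n) (seq (im z) n)))
    (N≤ n N≤n)

-- Bounding Σ λᵢ² by the eigenvalues

re-∑z²≤ : ∀ {n} (z : Vector ℂ n) τ → (∀ i → normSqℝ (z i) ≤ℝ fromℚ τ) →
  re (∑ λ i → z i *ℂ z i) ≤ℝ fromℚ (fromℕ n ℚ.* τ)
re-∑z²≤ {zero}  z τ bound ε 0<ε = 0 , λ _ _ → subst (λ t → 0ℚ ℚ.≤ t ℚ.+ ε) (sym (ℚ.*-zeroˡ τ))
  (ℚ.<⇒≤ (subst (0ℚ ℚ.<_) (sym (ℚ.+-identityˡ ε)) 0<ε))
re-∑z²≤ {suc n} z τ bound = subst (λ t → re (∑ λ i → z i *ℂ z i) ≤ℝ fromℚ t) suc-*
  (+ℝ-mono-≤ {re (z zero *ℂ z zero)} {re (∑ λ i → z (suc i) *ℂ z (suc i))} {τ} {fromℕ n ℚ.* τ}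
    (re-z²≤normSq (z zero) {fromℚ τ} (bound zero)) (re-∑z²≤ (λ i → z (suc i)) τ (λ i → bound (suc i))))
  where
  suc-* : τ ℚ.+ fromℕ n ℚ.* τ ≡ fromℕ (suc n) ℚ.* τ
  suc-* = trans (ℚS.solve 2 (λ t n → t ℚS.:+ n ℚS.:* t ℚS.:= (ℚS.con 1ℚ ℚS.:+ n) ℚS.:* t) refl τ (fromℕ n))
    (cong (ℚ._* τ) (fromℕ-+ 1 n))

-- The bound is a rational `τ` instead of ρ²: the proof by contradiction has room between ρ and the
-- claimed bound, and a rational square from that gap is simpler to handle.
re-trace²≤ : ∀ {n} (M : Matrix n) τ → (∀ μ → IsEigenvalue M μ → normSqℝ μ ≤ℝ fromℚ τ) →
  re (trace² M) ≤ℝ fromℚ (fromℕ n ℚ.* τ)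
re-trace²≤ {n} M τ bound = ≤ℝ-stable (re (trace² M)) (fromℚ (fromℕ n ℚ.* τ))
  (trace²-spectrumℂ M >>= λ (μ , ev , trace≈) →
   pure (re-≤-resp-≈ {∑ λ i → μ i *ℂ μ i} {trace² M} {fromℚ (fromℕ n ℚ.* τ)} (ℂR.sym trace≈)
     (re-∑z²≤ μ τ λ i → ≤ℝ-stable (normSqℝ (μ i)) (fromℚ τ) (¬¬-map (bound (μ i)) (ev i)))))

-- Counting digons

open MonoidSum ℕ.+-0-commutativeMonoid using ()
  renaming (sum to sumℕ; ∑-comm to sumℕ-comm; ∑-distrib-+ to sumℕ-+; sum-cong-≗ to sumℕ-cong)

indicator : ∀ {p} {P : Set p} → Dec P → ℕ
indicator (yes _) = 1
indicator (no _)  = 0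

indicator-yes : ∀ {p} {P : Set p} (P? : Dec P) → P → indicator P? ≡ 1
indicator-yes (yes _) _ = refl
indicator-yes (no ¬p) p = contradiction p ¬p

indicator-no : ∀ {p} {P : Set p} (P? : Dec P) → ¬ P → indicator P? ≡ 0
indicator-no (yes p) ¬p = contradiction p ¬p
indicator-no (no _)  _  = refl

module _ {a p} {A : Set a} {P : A → Set p} (P? : Decidable P) where

  length-filter-tabulate : ∀ {n} (f : Fin n → A) → length (filter P? (tabulate f)) ≡ sumℕ (λ i → indicator (P? (f i)))
  length-filter-tabulate {zero}  f = refl
  length-filter-tabulate {suc n} f with P? (f zero)
  ... | yes _ = cong suc (length-filter-tabulate (λ i → f (suc i)))
  ... | no  _ = length-filter-tabulate (λ i → f (suc i))

length-filter-cartesianProduct : ∀ {p m n} {P : Fin m × Fin n → Set p} (P? : Decidable P) →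
  length (filter P? (cartesianProduct (allFin m) (allFin n))) ≡ sumℕ (λ i → sumℕ λ j → indicator (P? (i , j)))
length-filter-cartesianProduct {m = m} {n} P? = go (λ i → i)
  where
  open ≡-Reasoning
  go : ∀ {k} (f : Fin k → Fin m) →
    length (filter P? (cartesianProduct (tabulate f) (allFin n))) ≡ sumℕ (λ i → sumℕ λ j → indicator (P? (f i , j)))
  go {zero}  f = refl
  go {suc k} f = begin
    length (filter P? (map (f zero ,_) (allFin n) ++ cartesianProduct (tabulate (λ i → f (suc i))) (allFin n)))
      ≡⟨ cong length (List.filter-++ P? (map (f zero ,_) (allFin n)) _) ⟩
    length (filter P? (map (f zero ,_) (allFin n)) ++ filter P? (cartesianProduct (tabulate (λ i → f (suc i))) (allFin n)))
      ≡⟨ List.length-++ (filter P? (map (f zero ,_) (allFin n))) ⟩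
    length (filter P? (map (f zero ,_) (allFin n))) ℕ.+ length (filter P? (cartesianProduct (tabulate (λ i → f (suc i))) (allFin n)))
      ≡⟨ cong₂ ℕ._+_ (trans (cong (λ xs → length (filter P? xs)) (List.map-tabulate (λ j → j) (f zero ,_)))
                       (length-filter-tabulate P? (f zero ,_)))
                     (go (λ i → f (suc i))) ⟩
    sumℕ (λ j → indicator (P? (f zero , j))) ℕ.+ sumℕ (λ i → sumℕ λ j → indicator (P? (f (suc i) , j))) ∎

module _ {n} (D : Digraph n) where
  open Digraph D

  private
    e : Fin n → Fin n → ℕ
    e i j = indicator ((i Fin.<? j) ×-dec isDigon? i j)

    split : ∀ i j → indicator (isDigon? i j) ≡ e i j ℕ.+ e j i
    split i j = go (isDigon? i j)
      where
      go : Dec (IsDigon i j) → indicator (isDigon? i j) ≡ e i j ℕ.+ e j i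
      go (no ¬d) = trans (indicator-no (isDigon? i j) ¬d) (sym (cong₂ ℕ._+_
        (indicator-no ((i Fin.<? j) ×-dec isDigon? i j) (λ (_ , d) → ¬d d))
        (indicator-no ((j Fin.<? i) ×-dec isDigon? j i) (λ (_ , b , a) → ¬d (a , b)))))
      go (yes d@(a , b)) with Fin.<-cmp i j
      ... | tri< i<j _ j≮i = trans (indicator-yes (isDigon? i j) d) (sym (cong₂ ℕ._+_
        (indicator-yes ((i Fin.<? j) ×-dec isDigon? i j) (i<j , d))
        (indicator-no ((j Fin.<? i) ×-dec isDigon? j i) (λ (j<i , _) → j≮i j<i))))
      ... | tri≈ _ refl _ = contradiction a (noLoop i)
      ... | tri> i≮j _ j<i = trans (indicator-yes (isDigon? i j) d) (sym (cong₂ ℕ._+_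
        (indicator-no ((i Fin.<? j) ×-dec isDigon? i j) (λ (i<j , _) → i≮j i<j))
        (indicator-yes ((j Fin.<? i) ×-dec isDigon? j i) (j<i , b , a))))

  -- The list of digons runs over i < j, the trace over all ordered pairs. As there are no loops,
  -- each digon arises in exactly two orders.
  sum-digons : sumℕ (λ i → sumℕ λ j → indicator (isDigon? i j)) ≡ 2 * numDigons
  sum-digons = begin
    sumℕ (λ i → sumℕ λ j → indicator (isDigon? i j))
      ≡⟨ sumℕ-cong (λ i → trans (sumℕ-cong (split i)) (sumℕ-+ (e i) (λ j → e j i))) ⟩
    sumℕ (λ i → sumℕ (e i) ℕ.+ sumℕ (λ j → e j i))
      ≡⟨ sumℕ-+ (λ i → sumℕ (e i)) (λ i → sumℕ (λ j → e j i)) ⟩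
    sumℕ (λ i → sumℕ (e i)) ℕ.+ sumℕ (λ i → sumℕ (λ j → e j i))
      ≡⟨ cong (sumℕ (λ i → sumℕ (e i)) ℕ.+_) (sumℕ-comm (λ i j → e j i)) ⟩
    sumℕ (λ i → sumℕ (e i)) ℕ.+ sumℕ (λ i → sumℕ (e i))
      ≡⟨ cong₂ ℕ._+_ (sym count) (trans (sym count) (sym (ℕ.+-identityʳ numDigons))) ⟩
    2 * numDigons ∎
    where
    open ≡-Reasoning
    count : numDigons ≡ sumℕ (λ i → sumℕ (e i))
    count = length-filter-cartesianProduct (λ (i , j) → (i Fin.<? j) ×-dec isDigon? i j)

-- The trace of the squared adjacency matrix

fromℕℂ : ℕ → ℂ
fromℕℂ k = fromℚ (fromℕ k) +i 0ℝ

sum-fromℕℂ : ∀ {n} (f : Vector ℕ n) → ∑ (λ i → fromℕℂ (f i)) ≈ℂ fromℕℂ (sumℕ f)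
sum-fromℕℂ {zero}  f = ℂR.refl
sum-fromℕℂ {suc n} f = ℂR.trans (ℂR.+-congˡ {fromℕℂ (f zero)} (sum-fromℕℂ (λ i → f (suc i))))
  (pointwise λ _ → cong₂ gauss (fromℕ-+ (f zero) (sumℕ (λ i → f (suc i)))) (ℚ.+-identityʳ 0ℚ))

∣z∣≃1⇒z*z̄≈1 : ∀ z → ∣ z ∣ ≃ℝ 1ℝ → z *ℂ conj z ≈ℂ 1ℂ
∣z∣≃1⇒z*z̄≈1 z ∣z∣≃1 = mk≈ (mkNull λ ε 0<ε →
  -- The computed square root is within η of 1 and has itself an error of at most η, so |z|² lies
  -- between (1 - η)² and (1 + 2η)². Since η ≤ 1, this is within 8η ≤ ε/2 of 1.
  let η , 0<η , η≤1 , η≤ε/16 = common-lower-bound (ℚ.positive⁻¹ 1ℚ) (*-pos (0<1/suc 15) 0<ε)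
      M , 1/suc≤η            = archimedean 0<η
      N , ∣z∣~1              = ∣z∣≃1 η 0<η
  in M ℕ.⊔ N , λ n ≤n → N~1 ε 0<ε η 0<η η≤1 η≤ε/16 n (1/suc≤η n (ℕ.m⊔n≤o⇒m≤o M N ≤n)) (∣z∣~1 n (ℕ.m⊔n≤o⇒n≤o M N ≤n)))
  where
  N~1 : ∀ ε → 0ℚ ℚ.< ε → ∀ η → 0ℚ ℚ.< η → η ℚ.≤ 1ℚ → η ℚ.≤ 1/suc 15 ℚ.* ε → ∀ n → 1/suc n ℚ.≤ η →
    ℚ.∣ sqrtApprox n (normSq (at z n)) ℚ.- 1ℚ ∣ ℚ.< η → ‖ at (z *ℂ conj z) n -ᴳ 1ᴳ ‖ ℚ.< ε
  N~1 ε 0<ε η 0<η η≤1 η≤ε/16 n 1/n≤η r~1 = begin-strict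
    ‖ at (z *ℂ conj z) n -ᴳ 1ᴳ ‖
      ≡⟨ cong ‖_‖ (cong₂ gauss
           (solve 2 (λ x y → x :* x :- y :* (:- y) :- con 1ℚ := (x :* x :+ y :* y) :- con 1ℚ) refl (real w) (imag w))
           (solve 2 (λ x y → x :* (:- y) :+ y :* x :- con 0ℚ := con 0ℚ) refl (real w) (imag w))) ⟩
    ℚ.∣ N ℚ.- 1ℚ ∣ ℚ.+ 0ℚ          ≡⟨ ℚ.+-identityʳ ℚ.∣ N ℚ.- 1ℚ ∣ ⟩
    ℚ.∣ N ℚ.- 1ℚ ∣                 <⟨ ∣p∣<q upper lower ⟩
    ε ∎
    where
    open ℚ.≤-Reasoning
    open ℚS
    w : ℚ[i]
    w = at z n
    N r : ℚ
    N = normSq w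
    r = sqrtApprox n N
    8η<ε : fromℕ 8 ℚ.* η ℚ.< ε
    8η<ε = begin-strict
      fromℕ 8 ℚ.* η                      ≤⟨ ℚ.*-monoˡ-≤-nonNeg (fromℕ 8) η≤ε/16 ⟩
      fromℕ 8 ℚ.* (1/suc 15 ℚ.* ε)       ≡⟨ solve 1 (λ e → con (fromℕ 8) :* (con (1/suc 15) :* e) := con ½ :* e) refl ε ⟩
      ½ ℚ.* ε                            <⟨ <-witness (½ ℚ.* ε) (half-pos 0<ε) (sym (halves ε)) ⟩
      ε                                  ∎
    N⊔0≡N : N ℚ.⊔ 0ℚ ≡ N
    N⊔0≡N = ℚ.p≥q⇒p⊔q≡p (0≤normSq w)
    r≤1+η : r ℚ.≤ 1ℚ ℚ.+ η
    r≤1+η = ∣p-q∣≤d⇒p≤q+d r 1ℚ (ℚ.<⇒≤ r~1)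
    1≤r+η : 1ℚ ℚ.≤ r ℚ.+ η
    1≤r+η = ∣p-q∣≤d⇒p≤q+d 1ℚ r (subst (ℚ._≤ η) (∣p-q∣≡∣q-p∣ r 1ℚ) (ℚ.<⇒≤ r~1))
    upper : N ℚ.- 1ℚ ℚ.< ε
    upper = begin-strict
      N ℚ.- 1ℚ                                              ≡⟨ cong (ℚ._- 1ℚ) N⊔0≡N ⟨
      N ℚ.⊔ 0ℚ ℚ.- 1ℚ                                       <⟨ ℚ.+-monoˡ-< (ℚ.- 1ℚ) (<sqrtApprox² n N) ⟩
      (r ℚ.+ 1/suc n) ℚ.* (r ℚ.+ 1/suc n) ℚ.- 1ℚ
        ≤⟨ ℚ.+-monoˡ-≤ (ℚ.- 1ℚ) (sq-mono (0≤p+q (0≤sqrtApprox n N) (ℚ.<⇒≤ (0<1/suc n))) (ℚ.+-mono-≤ r≤1+η 1/n≤η)) ⟩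
      ((1ℚ ℚ.+ η) ℚ.+ η) ℚ.* ((1ℚ ℚ.+ η) ℚ.+ η) ℚ.- 1ℚ
        ≤⟨ ≤-witness (fromℕ 4 ℚ.* (η ℚ.* (1ℚ ℚ.- η))) (*-nonNeg (0≤fromℕ 4) (*-nonNeg (ℚ.<⇒≤ 0<η) (0≤q-p η≤1)))
             (solve 1 (λ h → con (fromℕ 8) :* h := (((con 1ℚ :+ h) :+ h) :* ((con 1ℚ :+ h) :+ h) :- con 1ℚ)
                :+ con (fromℕ 4) :* (h :* (con 1ℚ :- h))) refl η) ⟩
      fromℕ 8 ℚ.* η                                         <⟨ 8η<ε ⟩
      ε ∎
    lower : ℚ.- (N ℚ.- 1ℚ) ℚ.< ε
    lower = begin-strict
      ℚ.- (N ℚ.- 1ℚ)              ≡⟨ solve 1 (λ x → :- (x :- con 1ℚ) := con 1ℚ :- x) refl N ⟩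
      1ℚ ℚ.- N
        ≤⟨ ℚ.+-monoʳ-≤ 1ℚ (ℚ.neg-antimono-≤ (subst (r ℚ.* r ℚ.≤_) N⊔0≡N (sqrtApprox²≤ n N))) ⟩
      1ℚ ℚ.- r ℚ.* r
        ≤⟨ ℚ.+-monoʳ-≤ 1ℚ (ℚ.neg-antimono-≤ (sq-mono (0≤q-p η≤1) 1-η≤r)) ⟩
      1ℚ ℚ.- (1ℚ ℚ.- η) ℚ.* (1ℚ ℚ.- η)
        ≤⟨ ≤-witness (fromℕ 6 ℚ.* η ℚ.+ η ℚ.* η) (0≤p+q (*-nonNeg (0≤fromℕ 6) (ℚ.<⇒≤ 0<η)) (0≤p*p η))
             (solve 1 (λ h → con (fromℕ 8) :* h := (con 1ℚ :- (con 1ℚ :- h) :* (con 1ℚ :- h)) :+ (con (fromℕ 6) :* h :+ h :* h)) refl η) ⟩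
      fromℕ 8 ℚ.* η               <⟨ 8η<ε ⟩
      ε ∎
      where
      1-η≤r : 1ℚ ℚ.- η ℚ.≤ r
      1-η≤r = +-cancelʳ-≤ (1ℚ ℚ.- η) r η (ℚ.≤-trans (ℚ.≤-reflexive (solve 1 (λ h → con 1ℚ :- h :+ h := con 1ℚ) refl η)) 1≤r+η)

module _ {n} (Φ : GainDigraph n) where
  open GainDigraph Φ

  adjacency-arc : ∀ i j (a : Arc i j) → adjacency i j ≡ gainℂ i j a
  adjacency-arc i j a with arc i j | gain i j
  ... | true | g = refl

  adjacency-nonArc : ∀ i j → ¬ Arc i j → adjacency i j ≡ 0ℂ
  adjacency-nonArc i j ¬a with arc i j | gain i j
  ... | true  | _ = contradiction _ ¬a
  ... | false | _ = refl

  module _ (conjugate : HasConjugateDigons) where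

    adjacency-* : ∀ i j → adjacency i j *ℂ adjacency j i ≈ℂ fromℕℂ (indicator (isDigon? i j))
    adjacency-* i j = go (T? (arc i j)) (T? (arc j i))
      where
      open ℂR using (*-congʳ; *-congˡ; zeroˡ; zeroʳ; reflexive)
      go : Dec (Arc i j) → Dec (Arc j i) → adjacency i j *ℂ adjacency j i ≈ℂ fromℕℂ (indicator (isDigon? i j))
      go (yes a) (yes b) = subst₂ (λ s t → s *ℂ t ≈ℂ fromℕℂ (indicator (isDigon? i j)))
        (sym (adjacency-arc i j a)) (sym (adjacency-arc j i b))
        (subst (λ k → gainℂ i j a *ℂ gainℂ j i b ≈ℂ fromℕℂ k) (sym (indicator-yes (isDigon? i j) (a , b)))
          (ℂR.trans (*-congˡ {gainℂ i j a} (≃⇒≈ (conjugate i j a b))) (∣z∣≃1⇒z*z̄≈1 (gainℂ i j a) (proj₂ (gain i j a)))))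
      go (no ¬a) _ = subst₂ (λ s k → s *ℂ adjacency j i ≈ℂ fromℕℂ k)
        (sym (adjacency-nonArc i j ¬a)) (sym (indicator-no (isDigon? i j) (λ (a , _) → ¬a a))) (zeroˡ (adjacency j i))
      go _ (no ¬b) = subst₂ (λ s k → adjacency i j *ℂ s ≈ℂ fromℕℂ k)
        (sym (adjacency-nonArc j i ¬b)) (sym (indicator-no (isDigon? i j) (λ (_ , b) → ¬b b))) (zeroʳ (adjacency i j))

    trace²-adjacency : trace² adjacency ≈ℂ fromℕℂ (2 * numDigons)
    trace²-adjacency = subst (λ k → trace² adjacency ≈ℂ fromℕℂ k) (sum-digons digraph)
      (ℂR.trans (sum-cong-≋ λ i → ℂR.trans (sum-cong-≋ (adjacency-* i)) (sum-fromℕℂ (λ j → indicator (isDigon? i j))))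
        (sum-fromℕℂ (λ i → sumℕ λ j → indicator (isDigon? i j))))
      where open MonoidSum ℂR.+-commutativeMonoid using (sum-cong-≋)

-- The lower bound for the spectral radius

fromℕ-*-/ : ∀ k n .{{_ : NonZero n}} → fromℕ n ℚ.* (+ k / n) ≡ fromℕ k
fromℕ-*-/ k zero    = contradiction refl (ℕ.≢-nonZero⁻¹ 0)
fromℕ-*-/ k (suc n) = ℚ.toℚᵘ-injective (begin
  ℚ.toℚᵘ (fromℕ (suc n) ℚ.* (+ k / suc n))
    ≈⟨ ℚ.toℚᵘ-homo-* (fromℕ (suc n)) (+ k / suc n) ⟩
  ℚ.toℚᵘ (fromℕ (suc n)) ℚᵘ.* ℚ.toℚᵘ (+ k / suc n)
    ≈⟨ ℚᵘ.*-cong (toℚᵘ-fromℕ (suc n)) (ℚ.toℚᵘ-fromℚᵘ (ℚᵘ.mkℚᵘ (+ k) n)) ⟩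
  ℚᵘ.mkℚᵘ (+ suc n) 0 ℚᵘ.* ℚᵘ.mkℚᵘ (+ k) n
    ≈⟨ ℚᵘ.*≡* (trans (ℤ.*-identityʳ _) (trans (ℤ.*-comm (+ suc n) (+ k)) (cong (λ t → + k ℤ.* + suc t) (sym (ℕ.+-identityʳ n))))) ⟩
  ℚᵘ.mkℚᵘ (+ k) 0           ≈⟨ toℚᵘ-fromℕ k ⟨
  ℚ.toℚᵘ (fromℕ k)          ∎)
  where open ℚᵘ.≃-Reasoning

theorem3p10 : (n : ℕ) .{{_ : NonZero n}} (Φ : GainDigraph n) →
    let open GainDigraph Φ in
    HasConjugateDigons →
    (ρ : ℝ) → IsSpectralRadius adjacency ρ →
    √ fromℚ (+ (2 * numDigons) / n) ≤ℝ ρ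
theorem3p10 n Φ conjugate ρ isSpectralRadius = ≤ℝ-by-contradiction (√ fromℚ c) ρ impossible
  where
  open GainDigraph Φ
  open IsSpectralRadius isSpectralRadius
  open ℚ.≤-Reasoning
  open ℚS
  c : ℚ
  c = + (2 * numDigons) / n
  1≤n : 1ℚ ℚ.≤ fromℕ n
  1≤n = fromℕ-mono {1} {n} (ℕ.>-nonZero⁻¹ n)
  nc≡2q : fromℕ n ℚ.* c ≡ fromℕ (2 * numDigons)
  nc≡2q = fromℕ-*-/ (2 * numDigons) n
  0≤c : 0ℚ ℚ.≤ c
  0≤c = ℚ.*-cancelˡ-≤-pos (fromℕ n) {{ℚ.positive (ℚ.<-≤-trans (ℚ.positive⁻¹ 1ℚ) 1≤n)}}
    (subst₂ ℚ._≤_ (sym (ℚ.*-zeroʳ (fromℕ n))) (sym nc≡2q) (0≤fromℕ (2 * numDigons)))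

  impossible : ∀ δ → 0ℚ ℚ.< δ → ¬ (∃[ N ] (∀ m → N ℕ.≤ m → seq ρ m ℚ.+ δ ℚ.≤ sqrtApprox m c))
  impossible δ 0<δ (N₀ , ρ+δ≤) = ℚ.<-irrefl refl (begin-strict
    fromℕ (2 * numDigons)               ≤⟨ proj₂ 2q≤ (proj₁ 2q≤) ℕ.≤-refl ⟩
    -- The slack in `_≤ℝ_` is set to e²/2, strictly less than the surplus n e² ≥ e² that τ² + e² ≤ c
    -- provides after multiplication by n.
    fromℕ n ℚ.* τ² ℚ.+ ½ ℚ.* (e ℚ.* e)
      <⟨ <-witness (½ ℚ.* (e ℚ.* e)) (half-pos (*-pos 0<e 0<e))
           (trans (cong (fromℕ n ℚ.* τ² ℚ.+_) (sym (halves (e ℚ.* e)))) (sym (ℚ.+-assoc (fromℕ n ℚ.* τ²) _ _))) ⟩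
    fromℕ n ℚ.* τ² ℚ.+ e ℚ.* e
      ≤⟨ ℚ.+-monoʳ-≤ (fromℕ n ℚ.* τ²) (subst (ℚ._≤ fromℕ n ℚ.* (e ℚ.* e)) (ℚ.*-identityˡ (e ℚ.* e))
           (ℚ.*-monoʳ-≤-nonNeg (e ℚ.* e) {{ℚ.nonNegative (0≤p*p e)}} 1≤n)) ⟩
    fromℕ n ℚ.* τ² ℚ.+ fromℕ n ℚ.* (e ℚ.* e) ≡⟨ ℚ.*-distribˡ-+ (fromℕ n) τ² (e ℚ.* e) ⟨
    fromℕ n ℚ.* (τ² ℚ.+ e ℚ.* e)
      ≤⟨ ℚ.*-monoˡ-≤-nonNeg (fromℕ n) {{ℚ.nonNegative (0≤fromℕ n)}} τ²+e²≤c ⟩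
    fromℕ n ℚ.* c                       ≡⟨ nc≡2q ⟩
    fromℕ (2 * numDigons)               ∎)
    where
    e : ℚ
    -- The gap δ is divided into four: the drift of the terms of ρ, the slack in `upperBound`, the
    -- error of the computed square root, and a margin left between τ and √ c.
    e = ½ ℚ.* (½ ℚ.* δ)
    0<e : 0ℚ ℚ.< e
    0<e = half-pos (half-pos 0<δ)
    0≤e : 0ℚ ℚ.≤ e
    0≤e = ℚ.<⇒≤ 0<e
    μ₀ : ℂ
    μ₀ = proj₁ attained
    N₁ N₂ M : ℕ
    N₁ = proj₁ (isCauchy ρ e 0<e)
    N₂ = proj₁ (proj₂ (proj₂ attained) e 0<e)
    M = N₀ ℕ.⊔ (N₁ ℕ.⊔ N₂)
    N₁≤M : N₁ ℕ.≤ M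
    N₁≤M = ℕ.≤-trans (ℕ.m≤m⊔n N₁ N₂) (ℕ.m≤n⊔m N₀ (N₁ ℕ.⊔ N₂))
    N₂≤M : N₂ ℕ.≤ M
    N₂≤M = ℕ.≤-trans (ℕ.m≤n⊔m N₁ N₂) (ℕ.m≤n⊔m N₀ (N₁ ℕ.⊔ N₂))
    -- τ eventually exceeds every ∣ μ ∣, and still τ + e ≤ √ c.
    r τ τ² : ℚ
    r = seq ρ M
    τ = ((r ℚ.+ e) ℚ.+ e) ℚ.+ e
    τ² = τ ℚ.* τ

    -- ρ is the modulus of an eigenvalue by `attained`, so its terms are eventually nonnegative up
    -- to e. Without a sign, τ + e ≤ √ c could not be squared.
    0≤r+e : 0ℚ ℚ.≤ r ℚ.+ e
    0≤r+e = ℚ.≤-trans (0≤sqrtApprox M (normSq (at μ₀ M)))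
      (∣p-q∣≤d⇒p≤q+d (seq ∣ μ₀ ∣ M) r (ℚ.<⇒≤ (proj₂ (proj₂ (proj₂ attained) e 0<e) M N₂≤M)))
    0≤τ : 0ℚ ℚ.≤ τ
    0≤τ = 0≤p+q (0≤p+q 0≤r+e 0≤e) 0≤e

    τ²+e²≤c : τ² ℚ.+ e ℚ.* e ℚ.≤ c
    τ²+e²≤c = begin
      τ² ℚ.+ e ℚ.* e
        ≤⟨ ≤-witness (2ℚ ℚ.* (τ ℚ.* e)) (*-nonNeg (0≤fromℕ 2) (*-nonNeg 0≤τ 0≤e))
             (solve 2 (λ t e → (t :+ e) :* (t :+ e) := (t :* t :+ e :* e) :+ con 2ℚ :* (t :* e)) refl τ e) ⟩
      (τ ℚ.+ e) ℚ.* (τ ℚ.+ e)           ≤⟨ sq-mono (0≤p+q 0≤τ 0≤e) τ+e≤s ⟩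
      sqrtApprox M c ℚ.* sqrtApprox M c  ≤⟨ sqrtApprox²≤ M c ⟩
      c ℚ.⊔ 0ℚ                           ≡⟨ ℚ.p≥q⇒p⊔q≡p 0≤c ⟩
      c                                  ∎
      where
      τ+e≤s : τ ℚ.+ e ℚ.≤ sqrtApprox M c
      τ+e≤s = subst (ℚ._≤ sqrtApprox M c)
        (solve 2 (λ r d → let e = con ½ :* (con ½ :* d) in r :+ d := (((r :+ e) :+ e) :+ e) :+ e) refl r δ)
        (ρ+δ≤ M (ℕ.m≤m⊔n N₀ (N₁ ℕ.⊔ N₂)))

    bound : ∀ μ → IsEigenvalue adjacency μ → normSqℝ μ ≤ℝ fromℚ τ²
    bound μ ev ε 0<ε =
      let N₃ , ∣μ∣≤ρ    = upperBound μ ev e 0<e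
          N₄ , 1/suc≤e  = archimedean 0<e
      in N₁ ℕ.⊔ (N₃ ℕ.⊔ N₄) , λ m ≤m →
        let N₁≤m = ℕ.m⊔n≤o⇒m≤o N₁ (N₃ ℕ.⊔ N₄) ≤m
            N₃≤m = ℕ.m⊔n≤o⇒m≤o N₃ N₄ (ℕ.m⊔n≤o⇒n≤o N₁ (N₃ ℕ.⊔ N₄) ≤m)
            N₄≤m = ℕ.m⊔n≤o⇒n≤o N₃ N₄ (ℕ.m⊔n≤o⇒n≤o N₁ (N₃ ℕ.⊔ N₄) ≤m)
            s    = sqrtApprox m (normSq (at μ m))
        in begin
          normSq (at μ m)                          ≤⟨ ℚ.p≤p⊔q (normSq (at μ m)) 0ℚ ⟩
          normSq (at μ m) ℚ.⊔ 0ℚ                   ≤⟨ ℚ.<⇒≤ (<sqrtApprox² m (normSq (at μ m))) ⟩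
          (s ℚ.+ 1/suc m) ℚ.* (s ℚ.+ 1/suc m)
            ≤⟨ sq-mono (0≤p+q (0≤sqrtApprox m (normSq (at μ m))) (ℚ.<⇒≤ (0<1/suc m)))
                 (ℚ.+-mono-≤ (ℚ.≤-trans (∣μ∣≤ρ m N₃≤m) (ℚ.+-monoˡ-≤ e
                   (∣p-q∣≤d⇒p≤q+d (seq ρ m) r (ℚ.<⇒≤ (proj₂ (isCauchy ρ e 0<e) m M N₁≤m N₁≤M))))) (1/suc≤e m N₄≤m)) ⟩
          τ²                                       ≤⟨ ≤-witness ε (ℚ.<⇒≤ 0<ε) refl ⟩
          τ² ℚ.+ ε                                 ∎

    2q≤ : ∃[ N ] (∀ m → N ℕ.≤ m → fromℕ (2 * numDigons) ℚ.≤ fromℕ n ℚ.* τ² ℚ.+ ½ ℚ.* (e ℚ.* e))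
    2q≤ = re-≤-resp-≈ {y = fromℚ (fromℕ n ℚ.* τ²)} (trace²-adjacency Φ conjugate) (re-trace²≤ adjacency τ² bound)
      (½ ℚ.* (e ℚ.* e)) (half-pos (*-pos 0<e 0<e))
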